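{- For all positive integers $n$, $$\texttt{SCG}\big(\beta(n,n,\infty)\big)=\Omega\left(\frac{\beta(n,n,\infty)}{n\log n}\right).$$
   Context: A path system is a pair $(V,\Pi)$ with $V$ a finite node set and $\Pi$ a finite multiset of paths, each a finite sequence of pairwise distinct nodes; the size is $\sum_{\pi\in\Pi}|\pi|$ where $|\pi|$ is the number of nodes. A $b$-bridge consists of $b$ distinct nodes $v_1,\dots,v_b$ and $b$ distinct paths $\pi_1,\dots,\pi_b$ with $v_i$ preceding $v_{i+1}$ on $\pi_i$ for $1\le i\le b-1$ and $v_1$ preceding $v_b$ on $\pi_b$. $\beta(n,p,\infty)$ is the maximum size of a path system with $n$ nodes, $p$ paths and no bridges. For a directed graph $G=(V,E)$ and demand pairs $P\subseteq V\times V$: $\textsc{SCut}(G,P)$ (directed sparsest cut) is the minimum over edge sets $E'\subseteq E$ disconnecting at least one pair of $P$ of $|E'|/|P_{E'}|$, where $P_{E'}$ is the set of pairs $(s,t)\in P$ with no directed $s\leadsto t$ path in $G\setminus E'$. $\textsc{MCFlow}(G,P)$ (maximum concurrent flow) is the maximum $\lambda$ such that there are nonnegative weights $f_\pi$ on directed paths, with $\sum_{\pi\text{ an }s\leadsto t\text{ path}}f_\pi\ge\lambda$ for every $(s,t)\in P$ and $\sum_{\pi\ni e}f_\pi\le1$ for every edge $e$. $\texttt{SCG}(N)$ is the least integer $k$ such that for every $N$-node directed graph $G$ and every set of demand pairs $P$, $\textsc{SCut}(G,P)\le k\cdot\textsc{MCFlow}(G,P)$. -}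

module Defs where

open import Data.Nat as ℕ using (ℕ; zero; suc; _<_; _∸_)
open import Data.Fin as Fin using (Fin)
open import Data.Bool using (Bool; true; false; if_then_else_)
open import Data.List as List using (List; []; _∷_; length; lookup)
open import Data.List.Relation.Unary.Unique.Propositional using (Unique)
open import Data.List.Membership.Propositional using (_∈_)
open import Data.Product using (proj₁; proj₂)
open import Data.Vec as Vec using (Vec)
open import Data.Product using (Σ; ∃; _×_; _,_)
open import Data.Sum using (_⊎_)
open import Relation.Nullary using (¬_; does)
open import Relation.Binary.PropositionalEquality using (_≡_)
open import Data.Integer using (+_)
open import Data.Rational as ℚ using (ℚ; 0ℚ)

-- A path system on nodes Fin n with p paths (a multiset, given as a vector
-- of paths); each path is a list of pairwise distinct nodes.
record PathSystem (n p : ℕ) : Set where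
  field
    paths    : Vec (List (Fin n)) p
    distinct : ∀ (i : Fin p) → Unique (Vec.lookup paths i)
open PathSystem public

size : ∀ {n p} → PathSystem n p → ℕ
size S = Vec.foldr _ (λ π acc → length π ℕ.+ acc) 0 (paths S)

Precedes : ∀ {n} → Fin n → Fin n → List (Fin n) → Set
Precedes u v π =
  Σ (Fin (length π)) λ i → Σ (Fin (length π)) λ j →
    (i Fin.< j) × (lookup π i ≡ u) × (lookup π j ≡ v)

-- A b-bridge (nodes v_0..v_{b-1}, paths π_0..π_{b-1}, 0-indexed):
-- distinct nodes, distinct paths (distinct indices in the multiset),
-- v_i precedes v_{i+1} on π_i, and v_0 precedes v_{b-1} on π_{b-1}.
record Bridge {n p : ℕ} (S : PathSystem n p) (b : ℕ) : Set where
  field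
    b≥1      : 1 ℕ.≤ b
    node     : ℕ → Fin n
    pth      : ℕ → Fin p
    node-inj : ∀ i j → i < b → j < b → node i ≡ node j → i ≡ j
    pth-inj  : ∀ i j → i < b → j < b → pth i ≡ pth j → i ≡ j
    steps    : ∀ i → suc i < b →
               Precedes (node i) (node (suc i)) (Vec.lookup (paths S) (pth i))
    closing  : Precedes (node 0) (node (b ∸ 1)) (Vec.lookup (paths S) (pth (b ∸ 1)))

BridgeFree : ∀ {n p} → PathSystem n p → Set
BridgeFree S = ∀ b → ¬ Bridge S b

IsBeta : ℕ → ℕ → ℕ → Set
IsBeta n p s =
  (Σ (PathSystem n p) λ S → BridgeFree S × size S ≡ s) ×
  (∀ (S : PathSystem n p) → BridgeFree S → size S ℕ.≤ s)

-- A directed graph on Fin N: edge relation as a Boolean matrix.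
-- A set of demand pairs is likewise a Boolean matrix.
Rel₂ : ℕ → Set
Rel₂ N = Fin N → Fin N → Bool

allFin : (N : ℕ) → List (Fin N)
allFin N = List.allFin N

count : ∀ {N} → Rel₂ N → ℕ
count {N} R = List.length (List.filterᵇ (λ uv → R (proj₁ uv) (proj₂ uv))
                                          (List.cartesianProduct (allFin N) (allFin N)))

_⊆ᴱ_ : ∀ {N} → Rel₂ N → Rel₂ N → Set
A ⊆ᴱ B = ∀ u v → A u v ≡ true → B u v ≡ true

minus : ∀ {N} → Rel₂ N → Rel₂ N → Rel₂ N
minus E E' u v = if E' u v then false else E u v

data Reach {N : ℕ} (E : Rel₂ N) (s : Fin N) : Fin N → Set where
  here : Reach E s s
  step : ∀ {u v} → Reach E s u → E u v ≡ true → Reach E s v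

Disconnected : ∀ {N} → Rel₂ N → Rel₂ N → Fin N → Fin N → Set
Disconnected E E' s t = ¬ Reach (minus E E') s t

DisconnectsSome : ∀ {N} → Rel₂ N → Rel₂ N → Rel₂ N → Set
DisconnectsSome E P E' = Σ (Fin _) λ s → Σ (Fin _) λ t → P s t ≡ true × Disconnected E E' s t

-- |P_{E'}| : the count of (s,t) ∈ P disconnected.  Since Reach is not
-- decided here, we relate it through a Boolean matrix D characterising P_{E'}.
IsDisconnectedSet : ∀ {N} → Rel₂ N → Rel₂ N → Rel₂ N → Rel₂ N → Set
IsDisconnectedSet E P E' D =
  ∀ s t → (D s t ≡ true → P s t ≡ true × Disconnected E E' s t) ×
          (P s t ≡ true → Disconnected E E' s t → D s t ≡ true)

data Walk {N : ℕ} (E : Rel₂ N) : List (Fin N) → Set where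
  single : ∀ v → Walk E (v ∷ [])
  cons   : ∀ u v π → E u v ≡ true → Walk E (v ∷ π) → Walk E (u ∷ v ∷ π)

record DPath {N : ℕ} (E : Rel₂ N) : Set where
  field
    verts  : List (Fin N)
    walk   : Walk E verts
    simple : Unique verts
open DPath public

lastIs : ∀ {N} → List (Fin N) → Fin N → Bool
lastIs [] t = false
lastIs (x ∷ []) t = does (x Fin.≟ t)
lastIs (_ ∷ y ∷ ys) t = lastIs (y ∷ ys) t

startIs : ∀ {N} → List (Fin N) → Fin N → Bool
startIs [] s = false
startIs (x ∷ _) s = does (x Fin.≟ s)

usesEdge : ∀ {N} → List (Fin N) → Fin N → Fin N → Bool
usesEdge [] u v = false
usesEdge (x ∷ []) u v = false
usesEdge (x ∷ y ∷ ys) u v =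
  if does (x Fin.≟ u) then (if does (y Fin.≟ v) then true else usesEdge (y ∷ ys) u v)
  else usesEdge (y ∷ ys) u v

Flow : ∀ {N} → Rel₂ N → Set
Flow E = List (DPath E × ℚ)

sumWhere : ∀ {N} {E : Rel₂ N} → (List (Fin N) → Bool) → Flow E → ℚ
sumWhere c [] = 0ℚ
sumWhere c ((π , w) ∷ f) = if c (verts π) then w ℚ.+ sumWhere c f else sumWhere c f

FeasibleFlow : ∀ {N} (E P : Rel₂ N) → Flow E → ℚ → Set
FeasibleFlow {N} E P f λ' =
  (∀ (x : DPath E × ℚ) → x ∈ f → 0ℚ ℚ.≤ proj₂ x) ×
  (∀ s t → P s t ≡ true → λ' ℚ.≤ sumWhere (λ π → if startIs π s then lastIs π t else false) f) ×
  (∀ u v → E u v ≡ true → sumWhere (λ π → usesEdge π u v) f ℚ.≤ ℚ.1ℚ)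

ℕtoℚ : ℕ → ℚ
ℕtoℚ m = + m ℚ./ 1

-- SCut(G,P) ≤ k · MCFlow(G,P).
-- Either no edge set disconnects any pair (SCut = ∞, and then also
-- MCFlow = ∞), or some edge set E' ⊆ E disconnecting ≥ 1 pair and some
-- feasible concurrent flow of value λ satisfy |E'|/|P_{E'}| ≤ k·λ
-- (MCFlow is an attained maximum with a rational optimum).
SCutBound : ∀ {N} → Rel₂ N → Rel₂ N → ℕ → Set
SCutBound E P k =
  (∀ E' → E' ⊆ᴱ E → ¬ DisconnectsSome E P E') ⊎
  (Σ _ λ E' → Σ _ λ D → Σ (Flow E) λ f → Σ ℚ λ λ' →
     E' ⊆ᴱ E × DisconnectsSome E P E' × IsDisconnectedSet E P E' D ×
     FeasibleFlow E P f λ' ×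
     (ℕtoℚ (count E') ℚ.≤ (ℕtoℚ k ℚ.* λ') ℚ.* ℕtoℚ (count D)))

GapBound : ℕ → ℕ → Set
GapBound N k = ∀ (E P : Rel₂ N) → SCutBound E P k

IsSCG : ℕ → ℕ → Set
IsSCG N k = GapBound N k × (∀ j → GapBound N j → k ℕ.≤ j)

{-# OPTIONS --safe #-}

-- Let S be bridge-free with n nodes, n paths and size b, and let D be about b / (n log n).  Some dyadic
-- length class carries a 1 / log n fraction of the size; a greedy sample of the nodes then hits most paths
-- of the class 8D times, although there are far fewer sampled nodes than paths.  Cycles formed by different
-- paths are contracted one after the other; this discards at most two paths per sampled node and leaves an
-- acyclic family.  Acyclicity and bridge-freeness together force every walk between two nodes of a path to
-- stay on that path.
--
-- The network has D levels and log n columns.  Every path is a commodity, which may climb one level with each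
-- stop and meets the levels of a stop in an order shifted at random.  As a flow path cannot leave its
-- commodity, it uses D copies of nodes, so that the concurrent flow has value at most 2 log n.  A cut
-- severing y commodities has to block each of them at 7D stops in all columns, and by a union bound over the
-- patterns of blocked stops there is a choice of shifts for which this always takes of order y D log n
-- different copies.  Hence the gap is of order D.

module Submission where

open import Defs hiding (allFin; here)
import Defs
open import Data.Bool using (Bool; false; if_then_else_; true)
import Data.Bool.Properties as Boolₚ
open import Data.Empty using (⊥; ⊥-elim)
open import Data.Fin as Fin using (Fin; _↑ʳ_; _↑ˡ_; combine; fromℕ<; inject≤; remQuot; splitAt; toℕ)
import Data.Fin.Properties as Finₚ
import Data.Integer as ℤ
import Data.Integer.Properties as ℤₚ
open import Data.List as List using (List; []; _++_; _∷_; cartesianProduct; cartesianProductWith; filter; length; lookup; map; mapMaybe)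
import Data.List.Membership.DecPropositional as DecMem
open import Data.List.Membership.Propositional using (_∈_; _∉_)
open import Data.List.Membership.Propositional.Properties using (∈-++⁺ʳ; ∈-++⁺ˡ; ∈-++⁻; ∈-allFin; ∈-cartesianProductWith⁺; ∈-cartesianProduct⁺; ∈-filter⁺; ∈-filter⁻; ∈-lookup; ∈-map⁺; ∈-map⁻; ∈-∃++)
open import Data.List.Properties using (length-++; length-filter; length-map; length-mapMaybe; length-tabulate; map-++; map-id; map-∘; ∷-injectiveˡ)
open import Data.List.Relation.Unary.All as All using (All; []; _∷_)
import Data.List.Relation.Unary.All.Properties as Allₚ
open import Data.List.Relation.Unary.AllPairs using ([]; _∷_)
open import Data.List.Relation.Unary.Any as Any using (here; there)
open import Data.List.Relation.Unary.Any.Properties using (lookup-index)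
open import Data.List.Relation.Unary.Unique.Propositional using (Unique)
import Data.List.Relation.Unary.Unique.Propositional.Properties as Uniqueₚ
open import Data.Maybe as Maybe using (Maybe; just; nothing)
open import Data.Maybe.Properties using (just-injective)
open import Data.Nat as ℕ using (>-nonZero; >-nonZero⁻¹; NonZero; _*_; _+_; _/_; _<?_; _<_; _^_; _∸_; _≤?_; _≤_; suc; s≤s; zero; z≤n; ℕ; ⌈_/2⌉; ⌊_/2⌋)
open import Data.Nat.DivMod using (/-monoˡ-≤; [m+kn]%n≡m%n; _%_; _/_; m%n<n; m/n*n≤m; m<n*o⇒m/o<n; m<n⇒m%n≡m; m≡m%n+[m/n]*n)
open import Data.Nat.Induction using (<-wellFounded)
open import Data.Nat.ListAction using (sum)
open import Data.Nat.ListAction.Properties using (sum-++)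
open import Data.Nat.Logarithm using (⌈log₂_⌉; ⌈log₂⌈n/2⌉⌉≡⌈log₂n⌉∸1; ⌈log₂⌉-mono-≤)
open import Data.Nat.Properties
open import Data.Nat.Solver using (module +-*-Solver)
open import Data.Product using (_,_; _×_; proj₁; proj₂; Σ; ∃; ∃₂)
open import Data.Product.Properties using (≡-dec)
open import Data.Rational as ℚ using (0ℚ; 1ℚ; ℚ)
import Data.Rational.Properties as ℚₚ
import Data.Rational.Unnormalised as ℚᵘ
import Data.Rational.Unnormalised.Properties as ℚᵘₚ
open import Data.Sum using (_⊎_; inj₁; inj₂)
open import Data.Vec as Vec using (Vec; []; _∷_)
open import Data.Vec.Properties using (lookup-replicate; lookup∘tabulate)
open import Function using (Equivalence; _∘_; case_of_; id)
open import Induction.WellFounded using (Acc; acc)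
open import Relation.Binary using (DecidableEquality; tri<; tri>; tri≈)
open import Relation.Binary.PropositionalEquality
open import Relation.Nullary using (Dec; does; no; yes; ¬?; ¬_)
open import Relation.Nullary.Decidable using (_×-dec_; dec-true)
open import Relation.Unary using (Decidable)
open import Data.Rational.Solver using () renaming (module +-*-Solver to ℚ-Solver)

-- Trips along the paths of a system

-- Bridge-freeness only forbids a detour beside a path that already runs the same way. It allows
-- directed cycles of paths, along which a flow path could leave its commodity and come back; so the
-- cycles must go. This may cost two paths per node, which would be every path if all n nodes were
-- kept; hence the sample.
--
-- The shifts are there because aligned levels could be cut all at once: removing one level would
-- sever every commodity cheaply. With independent shifts the copies that a cut needs rarely
-- coincide.
--
-- The columns leave the ratio alone, since flow and cut both scale with their number `g`. They make
-- the failure bound `4 ^ (7 * D * g)` beat the `P` commodities times `2 ^ (8 * D)` patterns even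
-- when `D` is far below log n. One and the same factor log n pays for the dyadic class and for the
-- columns.
--
-- The argument refutes `289 * k ≤ D`, so it suffices that an acyclic family exists up to double
-- negation and that not every choice of shifts fails.

data Repetition {A B : Set} (f : A → B) (xs : List A) : Set where
  repeats : ∀ pre x mid y post → xs ≡ pre ++ x ∷ mid ++ y ∷ post → f x ≡ f y → Repetition f xs

find-image : {A B : Set} (f : A → B) {b : B} {xs : List A} → b ∈ map f xs →
             ∃ λ pre → ∃₂ λ x post → xs ≡ pre ++ x ∷ post × b ≡ f x
find-image f {xs = x ∷ xs} (here eq) = [] , x , xs , refl , eq
find-image f {xs = x ∷ xs} (there b∈) with find-image f b∈
... | pre , y , post , eq , eq′ = x ∷ pre , y , post , cong (x ∷_) eq , eq′

unique-or-repetition : {A B : Set} → DecidableEquality B → (f : A → B) (xs : List A) →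
                       Unique (map f xs) ⊎ Repetition f xs
unique-or-repetition _≟_ f [] = inj₁ []
unique-or-repetition _≟_ f (x ∷ xs) with DecMem._∈?_ _≟_ (f x) (map f xs)
... | yes fx∈ with find-image f fx∈
...   | mid , y , post , eq , eq′ = inj₂ (repeats [] x mid y post (cong (x ∷_) eq) eq′)
unique-or-repetition _≟_ f (x ∷ xs) | no fx∉ with unique-or-repetition _≟_ f xs
... | inj₁ u = inj₁ (Allₚ.¬Any⇒All¬ _ fx∉ ∷ u)
... | inj₂ (repeats pre y mid z post eq eq′) =
        inj₂ (repeats (x ∷ pre) y mid z post (cong (x ∷_) eq) eq′)

-- All that trips use of a path: a transitive order that is total on its nodes. Irreflexivity is not
-- a field; it is the case of the empty trip in `NoDetour`.
record Traversal (n p : ℕ) : Set₁ where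
  field
    On      : Fin p → Fin n → Set
    Prec    : Fin p → Fin n → Fin n → Set
    on-fst  : ∀ {i u v} → Prec i u v → On i u
    on-snd  : ∀ {i u v} → Prec i u v → On i v
    prec-trans : ∀ {i u v w} → Prec i u v → Prec i v w → Prec i u w
    compare : ∀ {i u v} → On i u → On i v → Prec i u v ⊎ u ≡ v ⊎ Prec i v u

module Trips {n p : ℕ} (T : Traversal n p) where
  open Traversal T public

  data Trip : List (Fin p) → Fin n → Fin n → Set where
    []  : ∀ {u} → Trip [] u u
    _∷_ : ∀ {i is u v w} → Prec i u v → Trip is v w → Trip (i ∷ is) u w

  infixr 5 _∷_

  _++ᵗ_ : ∀ {is js u v w} → Trip is u v → Trip js v w → Trip (is ++ js) u w
  [] ++ᵗ t = t
  (e ∷ s) ++ᵗ t = e ∷ (s ++ᵗ t)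

  split : ∀ is {js u w} → Trip (is ++ js) u w → ∃ λ v → Trip is u v × Trip js v w
  split [] t = _ , [] , t
  split (i ∷ is) (e ∷ t) with split is t
  ... | v , t₁ , t₂ = v , e ∷ t₁ , t₂

  NoDetour : Set
  NoDetour = ∀ {i is u v} → Trip is u v → Unique (i ∷ is) → ¬ Prec i u v

  Acyclic : (Fin p → Set) → Set
  Acyclic Q = ∀ {i is u} → All Q (i ∷ is) → ¬ Trip (i ∷ is) u u

  module _ (nd : NoDetour) {Q : Fin p → Set} (ac : Acyclic Q) where

    private
      shorter₁ : ∀ (A : List (Fin p)) {i B} → length A < length (A ++ i ∷ B)
      shorter₁ A {i} {B} = subst (length A <_) (sym (length-++ A)) (m<m+n (length A) (s≤s z≤n))

      shorter₂ : ∀ (A : List (Fin p)) {i B} → length B < length (A ++ i ∷ B)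
      shorter₂ A {i} {B} = subst (length B <_) (sym (length-++ A)) (m≤n+m _ (length A))

      -- Induction on the length. Acyclicity leaves only the case that `u` precedes `v` on `i`. If
      -- `i` occurs in the trip, both parts around it again join nodes of `i`. Otherwise the trip
      -- would be a detour unless some path `k` occurs twice. Comparing the start of the first hop
      -- on `k` with the end of the second either shortens the trip, and induction forces `k` to be
      -- `i`, or closes a cycle.
      go : ∀ {i is u v} → Acc _<_ (length is) → Q i → All Q is → On i u → On i v →
           Trip is u v → All (_≡ i) is
      go {is = []} _ _ _ _ _ _ = []
      go {i} {is@(j ∷ js)} {u} {v} (acc rec) qi qis ou ov t with compare ou ov
      ... | inj₂ (inj₁ refl) = ⊥-elim (ac qis t)
      ... | inj₂ (inj₂ v≺u) = ⊥-elim (ac (qi ∷ qis) (v≺u ∷ t))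
      ... | inj₁ u≺v with DecMem._∈?_ Fin._≟_ i is
      ...   | yes i∈ with ∈-∃++ i∈
      ...     | A , B , eq with split A (subst (λ l → Trip l u v) eq t)
      ...       | x , tA , x≺y ∷ tB =
                  subst (All (_≡ i)) (sym eq)
                    (Allₚ.++⁺ (go (rec (subst (λ l → length A < length l) (sym eq) (shorter₁ A)))
                                qi (Allₚ.++⁻ˡ A qs) ou (on-fst x≺y) tA)
                       (refl ∷ go (rec (subst (λ l → length B < length l) (sym eq) (shorter₂ A)))
                                qi (All.tail (Allₚ.++⁻ʳ A qs)) (on-snd x≺y) ov tB))
        where qs = subst (All Q) eq qis
      go {i} {is@(j ∷ js)} {u} {v} (acc rec) qi qis ou ov t | inj₁ u≺v | no i∉
        with unique-or-repetition Fin._≟_ id is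
      ... | inj₁ uq = ⊥-elim (nd t (Allₚ.¬Any⇒All¬ _ i∉ ∷ subst Unique (map-id is) uq) u≺v)
      ... | inj₂ (repeats A k B .k C eq refl) with split A (subst (λ l → Trip l u v) eq t)
      ...   | x , tA , x≺y ∷ t′ with split B t′
      ...     | x′ , tB , x′≺y′ ∷ tC with compare (on-fst x≺y) (on-snd x′≺y′)
      ...       | inj₁ x≺y′ =
                    ⊥-elim (i∉ (subst (i ∈_) (sym eq) (∈-++⁺ʳ A (here (sym (All.head (Allₚ.++⁻ʳ A
                      (go (rec lt) qi (Allₚ.++⁺ (Allₚ.++⁻ˡ A qs)
                             (All.head qs′ ∷ All.tail (Allₚ.++⁻ʳ B (All.tail qs′)))) ou ov
                        (tA ++ᵗ (x≺y′ ∷ tC))))))))))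
        where
        qs = subst (All Q) eq qis
        qs′ = Allₚ.++⁻ʳ A qs
        lt : length (A ++ k ∷ C) < length is
        lt = subst (λ l → length (A ++ k ∷ C) < length l) (sym eq)
               (subst₂ _<_ (sym (length-++ A)) (sym (length-++ A)) (+-monoʳ-< (length A) (s≤s (shorter₂ B))))
      ...       | inj₂ (inj₁ refl) =
                    ⊥-elim (ac (All.head qs′ ∷ Allₚ.++⁺ (Allₚ.++⁻ˡ B (All.tail qs′))
                              (All.head (Allₚ.++⁻ʳ B (All.tail qs′)) ∷ [])) (x≺y ∷ (tB ++ᵗ (x′≺y′ ∷ []))))
        where qs′ = Allₚ.++⁻ʳ A (subst (All Q) eq qis)
      ...       | inj₂ (inj₂ y′≺x) =
                    ⊥-elim (ac (All.head qs′ ∷ Allₚ.++⁻ˡ B (All.tail qs′))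
                              (prec-trans (prec-trans x′≺y′ y′≺x) x≺y ∷ tB))
        where qs′ = Allₚ.++⁻ʳ A (subst (All Q) eq qis)

    rigid : ∀ {i is u v} → Q i → All Q is → On i u → On i v → Trip is u v → All (_≡ i) is
    rigid = go (<-wellFounded _)

-- Removing the cycles formed by different paths

unique-⊆-length : {A : Set} {xs ys : List A} → Unique xs → (∀ {x} → x ∈ xs → x ∈ ys) → length xs ≤ length ys
unique-⊆-length [] _ = z≤n
unique-⊆-length {xs = x ∷ xs} (x∉ ∷ u) sub with ∈-∃++ (sub (here refl))
... | A , B , refl rewrite length-++ A {x ∷ B} | +-suc (length A) (length B) | sym (length-++ A {B}) =
  s≤s (unique-⊆-length u λ {z} z∈ → drop-x z (λ { refl → All.lookup x∉ z∈ refl }) (sub (there z∈)))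
  where
  drop-x : ∀ z → z ≢ x → z ∈ A ++ x ∷ B → z ∈ A ++ B
  drop-x z z≢x z∈ with ∈-++⁻ A z∈
  ... | inj₁ z∈A = ∈-++⁺ˡ z∈A
  ... | inj₂ (here eq) = ⊥-elim (z≢x eq)
  ... | inj₂ (there z∈B) = ∈-++⁺ʳ A z∈B

length-filter-¬ : {A : Set} {P : A → Set} (P? : Decidable P) (xs : List A) →
                  length (filter P? xs) + length (filter (¬? ∘ P?) xs) ≡ length xs
length-filter-¬ P? [] = refl
length-filter-¬ P? (x ∷ xs) with P? x
... | yes _ = cong suc (length-filter-¬ P? xs)
... | no _ = trans (+-suc _ _) (cong suc (length-filter-¬ P? xs))

unique-++⁻ : {A : Set} (xs : List A) {ys : List A} → Unique (xs ++ ys) →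
             Unique xs × Unique ys × (∀ {x} → x ∈ xs → x ∉ ys)
unique-++⁻ [] u = [] , u , λ ()
unique-++⁻ (x ∷ xs) (x∉ ∷ u) with unique-++⁻ xs u
... | uxs , uys , dis =
  Allₚ.++⁻ˡ xs x∉ ∷ uxs , uys ,
  λ { (here refl) z∈ → All.lookup (Allₚ.++⁻ʳ xs x∉) z∈ refl ; (there x∈) → dis x∈ }

unique-rotate : {A : Set} (xs : List A) {ys : List A} → Unique (xs ++ ys) → Unique (ys ++ xs)
unique-rotate xs u with unique-++⁻ xs u
... | uxs , uys , dis = Uniqueₚ.++⁺ uys uxs λ { (z∈ys , z∈xs) → dis z∈xs z∈ys }

∈-rotate : {A : Set} (xs : List A) {ys : List A} {z : A} → z ∈ xs ++ ys → z ∈ ys ++ xs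
∈-rotate xs {ys} z∈ with ∈-++⁻ xs z∈
... | inj₁ z∈xs = ∈-++⁺ʳ ys z∈xs
... | inj₂ z∈ys = ∈-++⁺ˡ z∈ys

module CycleRemoval {n p : ℕ} (T : Traversal n p) (nd : Trips.NoDetour T)
                    (Vs : List (Fin n)) (on⇒∈ : ∀ {i u} → Traversal.On T i u → u ∈ Vs) where
  open Trips T

  Step : Set
  Step = Fin p × Fin n × Fin n

  path : Step → Fin p
  path = proj₁

  -- Contracting a cycle of k ≥ 2 labels uses up k paths and saves k − 1 ≥ k / 2 labels, whence `budget`.
  -- Since every used path is owned by a single label, trips inside different clusters can be joined
  -- without repeating a path.
  record Clustering : Set where
    field
      cl      : Fin n → Fin n
      labels  : List (Fin n)
      used    : List (Fin p)
      owner   : Fin p → Maybe (Fin n)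
      label∈  : ∀ {x} → x ∈ Vs → cl x ∈ labels
      rainbow : ∀ {x y} → x ∈ Vs → y ∈ Vs → cl x ≡ cl y →
                ∃ λ is → Trip is x y × Unique is × All (λ i → i ∈ used × owner i ≡ just (cl x)) is
      budget  : length used + 2 * length labels ≤ 2 * length Vs

  discrete : Clustering
  discrete = record
    { cl = id ; labels = Vs ; used = [] ; owner = λ _ → nothing ; label∈ = id
    ; rainbow = λ { _ _ refl → [] , [] , [] , [] } ; budget = ≤-refl }

  module Chains (K : Clustering) where
    open Clustering K

    lab : Step → Fin n
    lab (_ , x , _) = cl x

    -- A trip in the contracted system: consecutive hops need only meet in the same cluster. `nil`
    -- stores an equation because the labels are values of `cl`, on which an index could not be
    -- matched.
    data Chain : Fin n → List Step → Fin n → Set where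
      nil  : ∀ {ℓ m} → ℓ ≡ m → Chain ℓ [] m
      cons : ∀ {ℓ m i x y S} → cl x ≡ ℓ → Prec i x y → i ∉ used → Chain (cl y) S m →
             Chain ℓ ((i , x , y) ∷ S) m

    _++ᶜ_ : ∀ {ℓ m k S R} → Chain ℓ S m → Chain m R k → Chain ℓ (S ++ R) k
    nil refl ++ᶜ c = c
    cons e a u c ++ᶜ d = cons e a u (c ++ᶜ d)

    splitᶜ : ∀ S {R ℓ k} → Chain ℓ (S ++ R) k → ∃ λ m → Chain ℓ S m × Chain m R k
    splitᶜ [] c = _ , nil refl , c
    splitᶜ (s ∷ S) (cons e a u c) with splitᶜ S c
    ... | m , c₁ , c₂ = m , cons e a u c₁ , c₂

    unused : ∀ {ℓ S m i} → Chain ℓ S m → i ∈ map path S → i ∉ used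
    unused (cons _ _ u _) (here refl) = u
    unused (cons _ _ _ c) (there i∈) = unused c i∈

    fst∈ : ∀ {i x y} → Prec i x y → x ∈ Vs
    fst∈ = on⇒∈ ∘ on-fst

    snd∈ : ∀ {i x y} → Prec i x y → y ∈ Vs
    snd∈ = on⇒∈ ∘ on-snd

    lab∈ : ∀ {ℓ S m k} → Chain ℓ S m → k ∈ map lab S → k ∈ labels
    lab∈ (cons _ a _ _) (here refl) = label∈ (fst∈ a)
    lab∈ (cons _ _ _ c) (there k∈) = lab∈ c k∈

    route : ∀ {ℓ S m x y} → Chain ℓ S m → Unique (map lab S) → Unique (map path S) →
            cl x ≡ ℓ → x ∈ Vs → y ∈ Vs → cl y ∈ map lab S →
            ∃ λ is → Trip is x y × Unique is ×
              All (λ i → (i ∈ used × ∃ λ k → owner i ≡ just k × k ∈ map lab S) ⊎ i ∈ map path S) is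
    route {S = []} _ _ _ _ _ _ ()
    route {S = (i , a , b) ∷ S} {x = x} {y = y} (cons e a≺b i∉ c) (l∉ ∷ ul) (p∉ ∷ up) ex x∈ y∈ ly
      with cl y Fin.≟ cl a
    ... | yes eq with rainbow x∈ y∈ (trans ex (trans (sym e) (sym eq)))
    ...   | is , t , u , own = is , t , u ,
              All.map (λ { (j∈ , o) → inj₁ (j∈ , _ , o , here (trans ex (sym e))) }) own
    route {S = (i , a , b) ∷ S} {x = x} {y = y} (cons e a≺b i∉ c) (l∉ ∷ ul) (p∉ ∷ up) ex x∈ y∈ (here eq)
      | no neq = ⊥-elim (neq eq)
    route {S = (i , a , b) ∷ S} {x = x} {y = y} (cons e a≺b i∉ c) (l∉ ∷ ul) (p∉ ∷ up) ex x∈ y∈ (there ly)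
      | no neq with rainbow x∈ (fst∈ a≺b) (trans ex (sym e)) | route c ul up refl (snd∈ a≺b) y∈ ly
    ... | is₀ , t₀ , u₀ , own₀ | is₁ , t₁ , u₁ , own₁ =
      is₀ ++ i ∷ is₁ , t₀ ++ᵗ (a≺b ∷ t₁) ,
      Uniqueₚ.++⁺ u₀ (Allₚ.¬Any⇒All¬ _ i∉is₁ ∷ u₁) disj ,
      Allₚ.++⁺ (All.map (λ { (j∈ , o) → inj₁ (j∈ , _ , o , here (trans ex (sym e))) }) own₀)
        (inj₂ (here refl) ∷
         All.map (λ { (inj₁ (j∈ , k , o , k∈)) → inj₁ (j∈ , k , o , there k∈)
                    ; (inj₂ j∈) → inj₂ (there j∈) }) own₁)
      where
      i∉is₁ : i ∉ is₁
      i∉is₁ i∈ with All.lookup own₁ i∈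
      ... | inj₁ (i∈used , _) = i∉ i∈used
      ... | inj₂ i∈S = All.lookup p∉ i∈S refl
      disj : ∀ {z} → z ∈ is₀ × z ∈ i ∷ is₁ → ⊥
      disj (z∈₀ , here refl) = i∉ (proj₁ (All.lookup own₀ z∈₀))
      disj (z∈₀ , there z∈₁) with All.lookup own₀ z∈₀ | All.lookup own₁ z∈₁
      ... | _ , o | inj₁ (_ , k , o′ , k∈) =
        All.lookup l∉ k∈ (trans e (trans (sym ex) (just-injective (trans (sym o) o′))))
      ... | z∈used , _ | inj₂ z∈S = unused c z∈S z∈used

    record SimpleCycle : Set where
      field
        {base}  : Fin n
        {steps} : List Step
        closed  : Chain base steps base
        labs!   : Unique (map lab steps)
        paths!  : Unique (map path steps)
        long    : 2 ≤ length steps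

    private
      longer : ∀ (A B : List Step) {D s t} → suc (length B) < length (A ++ s ∷ B ++ t ∷ D)
      longer A B {D} {s} {t} rewrite length-++ A {s ∷ B ++ t ∷ D} | length-++ B {t ∷ D} =
        ≤-trans (s≤s (≤-trans (≤-reflexive (+-comm 1 _)) (+-monoʳ-≤ (length B) (s≤s z≤n))))
                (m≤n+m _ (length A))

      longer′ : ∀ (A B : List Step) {D r s t} → length (A ++ r ∷ D) < length (A ++ s ∷ B ++ t ∷ D)
      longer′ A B {D} {r} {s} {t} =
        subst₂ _<_ (sym (length-++ A)) (sym (length-++ A)) (+-monoʳ-< (length A) (s≤s
          (subst (length D <_) (sym (length-++ B)) (m≤n+m _ (length B)))))

    -- A repeated label cuts out a shorter closed chain. If a path carries two hops, from `x` to `y`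
    -- and later from `x′` to `y′`, then either `x` precedes `y′` and one hop skips everything
    -- between, or a hop from `x′` to `y` closes up the part between them.
    simplify : ∀ {ℓ s S} → Acc _<_ (length (s ∷ S)) → Chain ℓ (s ∷ S) ℓ → SimpleCycle
    simplify {ℓ} {s} {S} (acc rec) c with unique-or-repetition Fin._≟_ lab (s ∷ S)
    ... | inj₂ (repeats A (i , x , y) B (j , x′ , y′) D eq eq′)
          with splitᶜ A (subst (λ R → Chain ℓ R ℓ) eq c)
    ...   | _ , _ , cons e a u c′ with splitᶜ B c′
    ...     | _ , cB , cons e′ a′ u′ _ =
              simplify (rec (subst (λ R → suc (length B) < length R) (sym eq) (longer A B)))
                       (cons refl a u (subst (Chain (cl y) B) (trans (sym e′) (sym eq′)) cB))
    simplify {ℓ} {s} {S} (acc rec) c | inj₁ ul with unique-or-repetition Fin._≟_ path (s ∷ S)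
    ... | inj₁ up = record { closed = c ; labs! = ul ; paths! = up ; long = two S c }
      where
      two : ∀ S → Chain ℓ (s ∷ S) ℓ → 2 ≤ length (s ∷ S)
      two (_ ∷ _) _ = s≤s (s≤s z≤n)
      two [] (cons e a u (nil e′)) with rainbow (fst∈ a) (snd∈ a) (trans e (sym e′))
      ... | is , t , uis , own =
        ⊥-elim (nd t (Allₚ.¬Any⇒All¬ _ (λ i∈ → u (proj₁ (All.lookup own i∈))) ∷ uis) a)
    ... | inj₂ (repeats A (i , x , y) B (.i , x′ , y′) D eq refl)
          with splitᶜ A (subst (λ R → Chain ℓ R ℓ) eq c)
    ...   | m , cA , cons e a u c′ with splitᶜ B c′
    ...     | _ , cB , cons e′ a′ u′ cD with compare (on-fst a) (on-snd a′)
    ...       | inj₁ x≺y′ = go A eq cA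
      where
      go : ∀ A → s ∷ S ≡ A ++ (i , x , y) ∷ B ++ (i , x′ , y′) ∷ D → Chain ℓ A m → SimpleCycle
      go [] eq (nil q) =
        simplify (rec (subst (λ R → suc (length D) < length R) (sym eq) (longer′ [] B {D} {i , x , y} {i , x , y} {i , x′ , y′})))
                 (cons (trans e (sym q)) x≺y′ u cD)
      go A@(_ ∷ _) eq cA =
        simplify (rec (subst (λ R → length (A ++ (i , x , y′) ∷ D) < length R) (sym eq) (longer′ A B)))
                 (cA ++ᶜ cons e x≺y′ u cD)
    ...       | inj₂ (inj₁ refl) =
                simplify (rec (subst (λ R → suc (length B) < length R) (sym eq) (longer A B)))
                         (cons refl (prec-trans a′ a) u (subst (Chain (cl y) B) (sym e′) cB))
    ...       | inj₂ (inj₂ y′≺x) =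
                simplify (rec (subst (λ R → suc (length B) < length R) (sym eq) (longer A B)))
                         (cons refl (prec-trans (prec-trans a′ y′≺x) a) u
                               (subst (Chain (cl y) B) (sym e′) cB))

    module Merge (Z : SimpleCycle) where
      open SimpleCycle Z

      labs : List (Fin n)
      labs = map lab steps

      colours : List (Fin p)
      colours = map path steps

      base∈ : base ∈ labs
      base∈ = go closed long
        where
        go : ∀ {ℓ S m} → Chain ℓ S m → 2 ≤ length S → ℓ ∈ map lab S
        go (cons e _ _ _) _ = here (sym e)

      pick : Fin n → Fin n
      pick ℓ with DecMem._∈?_ Fin._≟_ ℓ labs
      ... | yes _ = base
      ... | no _ = ℓ

      pick-in : ∀ {ℓ} → ℓ ∈ labs → pick ℓ ≡ base
      pick-in {ℓ} ℓ∈ with DecMem._∈?_ Fin._≟_ ℓ labs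
      ... | yes _ = refl
      ... | no ℓ∉ = ⊥-elim (ℓ∉ ℓ∈)

      pick-out : ∀ {ℓ} → ℓ ∉ labs → pick ℓ ≡ ℓ
      pick-out {ℓ} ℓ∉ with DecMem._∈?_ Fin._≟_ ℓ labs
      ... | yes ℓ∈ = ⊥-elim (ℓ∉ ℓ∈)
      ... | no _ = refl

      owner′ : Fin p → Maybe (Fin n)
      owner′ i with DecMem._∈?_ Fin._≟_ i colours
      ... | yes _ = just base
      ... | no _ = Maybe.map pick (owner i)

      owner′-new : ∀ {i} → i ∈ colours → owner′ i ≡ just base
      owner′-new {i} i∈ with DecMem._∈?_ Fin._≟_ i colours
      ... | yes _ = refl
      ... | no i∉ = ⊥-elim (i∉ i∈)

      owner′-old : ∀ {i ℓ} → i ∈ used → owner i ≡ just ℓ → owner′ i ≡ just (pick ℓ)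
      owner′-old {i} i∈ o with DecMem._∈?_ Fin._≟_ i colours
      ... | yes i∈p = ⊥-elim (unused closed i∈p i∈)
      ... | no _ = cong (Maybe.map pick) o

      outside : List (Fin n)
      outside = filter (¬? ∘ λ ℓ → DecMem._∈?_ Fin._≟_ ℓ labs) labels

      outside-length : length labs + length outside ≤ length labels
      outside-length = ≤-trans
        (+-monoˡ-≤ (length outside) (unique-⊆-length labs! λ ℓ∈ →
          ∈-filter⁺ (λ ℓ → DecMem._∈?_ Fin._≟_ ℓ labs) (lab∈ closed ℓ∈) ℓ∈))
        (≤-reflexive (length-filter-¬ (λ ℓ → DecMem._∈?_ Fin._≟_ ℓ labs) labels))

      rainbow′ : ∀ {x y} → x ∈ Vs → y ∈ Vs → pick (cl x) ≡ pick (cl y) →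
                 ∃ λ is → Trip is x y × Unique is ×
                   All (λ i → i ∈ colours ++ used × owner′ i ≡ just (pick (cl x))) is
      rainbow′ {x} {y} x∈ y∈ eq
        with DecMem._∈?_ Fin._≟_ (cl x) labs in dx | DecMem._∈?_ Fin._≟_ (cl y) labs in dy
      ... | no x∉ | no y∉ with rainbow x∈ y∈ eq
      ...   | is , t , u , own = is , t , u ,
                All.map (λ { (i∈ , o) → ∈-++⁺ʳ colours i∈ , trans (owner′-old i∈ o) (cong just (pick-out x∉)) }) own
      rainbow′ {x} {y} x∈ y∈ eq | yes x∈L | no y∉ = ⊥-elim (y∉ (subst (_∈ labs) eq base∈))
      rainbow′ {x} {y} x∈ y∈ eq | no x∉ | yes y∈L = ⊥-elim (x∉ (subst (_∈ labs) (sym eq) base∈))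
      rainbow′ {x} {y} x∈ y∈ eq | yes x∈L | yes y∈L with find-image lab x∈L
      ... | A , s , B , eqS , ex with splitᶜ A (subst (λ R → Chain base R base) eqS closed)
      -- Start the cycle at the cluster of `x`, so that `route` can run forward until it meets the
      -- cluster of `y`.
      ...   | m , cA , cB with route (cB ++ᶜ cA)
                (rotated lab labs!) (rotated path paths!) (trans ex (start cB)) x∈ y∈ (rot∈ lab y∈L)
        where
        rotated : ∀ {k} (f : Step → Fin k) → Unique (map f steps) → Unique (map f ((s ∷ B) ++ A))
        rotated f u = subst Unique (sym (map-++ f (s ∷ B) A)) (unique-rotate (map f A)
          (subst Unique (map-++ f A (s ∷ B)) (subst (Unique ∘ map f) eqS u)))
        rot∈ : ∀ {k z} (f : Step → Fin k) → z ∈ map f steps → z ∈ map f ((s ∷ B) ++ A)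
        rot∈ {z = z} f z∈ = subst (z ∈_) (sym (map-++ f (s ∷ B) A)) (∈-rotate (map f A)
          (subst (z ∈_) (map-++ f A (s ∷ B)) (subst (λ R → z ∈ map f R) eqS z∈)))
        start : ∀ {ℓ S k} → Chain ℓ (s ∷ S) k → lab s ≡ ℓ
        start (cons e _ _ _) = e
      ...     | is , t , u , own = is , t , u , All.map good own
        where
        back : ∀ {k z} (f : Step → Fin k) → z ∈ map f ((s ∷ B) ++ A) → z ∈ map f steps
        back {z = z} f z∈ = subst (λ R → z ∈ map f R) (sym eqS) (subst (z ∈_) (sym (map-++ f A (s ∷ B)))
          (∈-rotate (map f (s ∷ B)) (subst (z ∈_) (map-++ f (s ∷ B) A) z∈)))
        good : ∀ {i} → (i ∈ used × ∃ λ k → owner i ≡ just k × k ∈ map lab ((s ∷ B) ++ A)) ⊎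
                       i ∈ map path ((s ∷ B) ++ A) →
               i ∈ colours ++ used × owner′ i ≡ just base
        good (inj₁ (i∈ , k , o , k∈)) =
          ∈-++⁺ʳ colours i∈ , trans (owner′-old i∈ o) (cong just (pick-in (back lab k∈)))
        good (inj₂ i∈) = ∈-++⁺ˡ (back path i∈) , owner′-new (back path i∈)

      merged : Clustering
      merged = record
        { cl = pick ∘ cl
        ; labels = base ∷ outside
        ; used = colours ++ used
        ; owner = owner′
        ; label∈ = member
        ; rainbow = rainbow′
        ; budget = ≤-trans saved budget
        }
        where
        member : ∀ {x} → x ∈ Vs → pick (cl x) ∈ base ∷ outside
        member {x} x∈ with DecMem._∈?_ Fin._≟_ (cl x) labs
        ... | yes _ = here refl
        ... | no ∉L = there (∈-filter⁺ (¬? ∘ λ ℓ → DecMem._∈?_ Fin._≟_ ℓ labs) (label∈ x∈) ∉L)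
        k = length steps
        f = length outside
        saved : length (colours ++ used) + 2 * suc f ≤ length used + 2 * length labels
        saved = begin
          length (colours ++ used) + 2 * suc f   ≡⟨ cong (_+ 2 * suc f) (trans (length-++ colours) (cong (_+ length used) (length-map path steps))) ⟩
          (k + length used) + 2 * suc f        ≡⟨ cong₂ _+_ (+-comm k (length used)) (*-distribˡ-+ 2 1 f) ⟩
          (length used + k) + (2 + 2 * f)      ≡⟨ +-assoc (length used) k (2 + 2 * f) ⟩
          length used + (k + (2 + 2 * f))      ≡⟨ cong (length used +_) (+-assoc k 2 (2 * f)) ⟨
          length used + ((k + 2) + 2 * f)      ≤⟨ +-monoʳ-≤ (length used) (+-monoˡ-≤ (2 * f) (+-monoʳ-≤ k (≤-trans long (≤-reflexive (sym (+-identityʳ k)))))) ⟩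
          length used + (2 * k + 2 * f)        ≡⟨ cong (length used +_) (*-distribˡ-+ 2 k f) ⟨
          length used + 2 * (k + f)            ≤⟨ +-monoʳ-≤ (length used) (*-monoʳ-≤ 2 (subst (λ j → j + f ≤ length labels) (length-map lab steps) outside-length)) ⟩
          length used + 2 * length labels      ∎
          where open ≤-Reasoning

      fewer-labels : length (Clustering.labels merged) < length labels
      fewer-labels = ≤-trans (+-monoˡ-≤ (length outside) (subst (2 ≤_) (sym (length-map lab steps)) long)) outside-length

    trip⇒chain : ∀ {is x y} → All (_∉ used) is → Trip is x y →
                 ∃ λ S → Chain (cl x) S (cl y) × length S ≡ length is
    trip⇒chain [] [] = [] , nil refl , refl
    trip⇒chain (u ∷ us) (a ∷ t) with trip⇒chain us t
    ... | S , c , eq = _ ∷ S , cons refl a u c , cong suc eq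

  -- Acyclicity is not decided. Assuming that no acyclic family is found, the present one is offered
  -- as acyclic; any cycle that refutes it yields a clustering with fewer labels, to which the
  -- induction applies.
  acyclic-after : (K : Clustering) → Acc _<_ (length (Clustering.labels K)) →
                  ¬ ¬ (∃ λ K′ → Acyclic (_∉ Clustering.used K′))
  acyclic-after K (acc rec) k = k (K , λ us t → no-cycle us t)
    where
    open Chains K
    no-cycle : ∀ {i is x} → All (_∉ Clustering.used K) (i ∷ is) → ¬ Trip (i ∷ is) x x
    no-cycle us t with trip⇒chain us t
    ... | _ ∷ S , c , _ = acyclic-after (Merge.merged Z) (rec (Merge.fewer-labels Z)) k
      where Z = simplify (<-wellFounded _) c

  remove-cycles : ¬ ¬ (∃ λ used → length used ≤ 2 * length Vs × Acyclic (_∉ used))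
  remove-cycles k = acyclic-after discrete (<-wellFounded _) λ (K , ac) →
    k (Clustering.used K , ≤-trans (m≤m+n _ _) (Clustering.budget K) , ac)

-- Restriction to sampled nodes: a detour is a bridge

lookup-unique : {A : Set} {xs : List A} → Unique xs → ∀ i j → lookup xs i ≡ lookup xs j → i ≡ j
lookup-unique (_ ∷ _) Fin.zero Fin.zero _ = refl
lookup-unique (x∉ ∷ _) Fin.zero (Fin.suc j) eq = ⊥-elim (All.lookup x∉ (∈-lookup j) eq)
lookup-unique (x∉ ∷ _) (Fin.suc i) Fin.zero eq = ⊥-elim (All.lookup x∉ (∈-lookup i) (sym eq))
lookup-unique (_ ∷ u) (Fin.suc i) (Fin.suc j) eq = cong Fin.suc (lookup-unique u i j eq)

nth : {A : Set} → A → List A → ℕ → A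
nth d [] _ = d
nth d (x ∷ xs) zero = x
nth d (x ∷ xs) (suc k) = nth d xs k

nth∈ : {A : Set} (d : A) (xs : List A) {k : ℕ} → k < length xs → nth d xs k ∈ xs
nth∈ d (x ∷ xs) {zero} _ = here refl
nth∈ d (x ∷ xs) {suc k} (s≤s k<) = there (nth∈ d xs k<)

nth-unique : {A : Set} (d : A) {xs : List A} → Unique xs → ∀ k l → k < length xs → l < length xs →
             nth d xs k ≡ nth d xs l → k ≡ l
nth-unique d (_ ∷ _) zero zero _ _ _ = refl
nth-unique d {_ ∷ xs} (x∉ ∷ _) zero (suc l) _ (s≤s l<) eq = ⊥-elim (All.lookup x∉ (nth∈ d xs l<) eq)
nth-unique d {_ ∷ xs} (x∉ ∷ _) (suc k) zero (s≤s k<) _ eq = ⊥-elim (All.lookup x∉ (nth∈ d xs k<) (sym eq))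
nth-unique d (_ ∷ u) (suc k) (suc l) (s≤s k<) (s≤s l<) eq = cong suc (nth-unique d u k l k< l< eq)

nth-last : {A : Set} (d : A) (xs : List A) {x : A} → nth d (xs ++ x ∷ []) (length xs) ≡ x
nth-last d [] = refl
nth-last d (_ ∷ xs) = nth-last d xs

precedes-trans : ∀ {n} {xs : List (Fin n)} {u v w} → Unique xs → Precedes u v xs → Precedes v w xs → Precedes u w xs
precedes-trans uq (i , j , i<j , eu , ev) (i′ , j′ , i′<j′ , ev′ , ew) =
  i , j′ , Finₚ.<-trans i<j (subst (Fin._< j′) (lookup-unique uq i′ j (trans ev′ (sym ev))) i′<j′) , eu , ew

precedes-compare : ∀ {n} {xs : List (Fin n)} {u v} → u ∈ xs → v ∈ xs → Precedes u v xs ⊎ u ≡ v ⊎ Precedes v u xs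
precedes-compare {xs = xs} u∈ v∈ with Finₚ.<-cmp (Any.index u∈) (Any.index v∈)
... | tri< lt _ _ = inj₁ (_ , _ , lt , sym (lookup-index u∈) , sym (lookup-index v∈))
... | tri> _ _ gt = inj₂ (inj₂ (_ , _ , gt , sym (lookup-index v∈) , sym (lookup-index u∈)))
... | tri≈ _ eq _ = inj₂ (inj₁ (trans (lookup-index u∈) (trans (cong (lookup xs) eq) (sym (lookup-index v∈)))))

module Restricted {n p : ℕ} (S : PathSystem n p) (Vs : List (Fin n)) where

  route-of : Fin p → List (Fin n)
  route-of = Vec.lookup (paths S)

  traversal : Traversal n p
  traversal = record
    { On = λ i u → u ∈ route-of i × u ∈ Vs
    ; Prec = λ i u v → Precedes u v (route-of i) × u ∈ Vs × v ∈ Vs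
    ; on-fst = λ { ((i , _ , _ , refl , _) , u∈ , _) → ∈-lookup i , u∈ }
    ; on-snd = λ { ((_ , j , _ , _ , refl) , _ , v∈) → ∈-lookup j , v∈ }
    ; prec-trans = λ { {i} (a , u∈ , _) (b , _ , w∈) → precedes-trans (distinct S i) a b , u∈ , w∈ }
    ; compare = λ { (u∈ , uV) (v∈ , vV) → restrict uV vV (precedes-compare u∈ v∈) }
    }
    where
    restrict : ∀ {i u v} → u ∈ Vs → v ∈ Vs →
      Precedes u v (route-of i) ⊎ u ≡ v ⊎ Precedes v u (route-of i) →
      (Precedes u v (route-of i) × u ∈ Vs × v ∈ Vs) ⊎ u ≡ v ⊎ (Precedes v u (route-of i) × v ∈ Vs × u ∈ Vs)
    restrict uV vV (inj₁ a) = inj₁ (a , uV , vV)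
    restrict uV vV (inj₂ (inj₁ e)) = inj₂ (inj₁ e)
    restrict uV vV (inj₂ (inj₂ a)) = inj₂ (inj₂ (a , vV , uV))

  open Trips traversal

  stops : ∀ {is u v} → Trip is u v → List (Fin n)
  stops {u = u} [] = u ∷ []
  stops {u = u} (_ ∷ t) = u ∷ stops t

  record Detour (is : List (Fin p)) (u v : Fin n) : Set where
    constructor detour
    field
      {via}   : List (Fin p)
      trip    : Trip via u v
      stops!  : Unique (stops trip)
      via!    : Unique is → Unique via
      via⊆    : ∀ {i} → i ∈ via → i ∈ is

  from-stop : ∀ {is u v w} (t : Trip is v w) → u ∈ stops t → Unique (stops t) → Detour is u w
  from-stop [] (here refl) uq = detour [] uq id id
  from-stop t@(_ ∷ _) (here refl) uq = detour t uq id id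
  from-stop (_ ∷ t) (there u∈) (_ ∷ uq) with from-stop t u∈ uq
  ... | detour t′ uq′ via! via⊆ = detour t′ uq′ (λ { (_ ∷ ui) → via! ui }) (there ∘ via⊆)

  -- A bridge needs distinct nodes as well as distinct paths. Excising loops repairs the former and
  -- keeps the latter, since the surviving paths are taken from the old ones in order.
  loop-free : ∀ {is u v} → Trip is u v → Detour is u v
  loop-free [] = detour [] ([] ∷ []) id id
  loop-free {is = i ∷ is} {u} (a ∷ t) with loop-free t
  ... | detour t′ uq via! via⊆ with DecMem._∈?_ Fin._≟_ u (stops t′)
  ...   | yes u∈ with from-stop t′ u∈ uq
  ...     | detour t″ uq″ via!″ via⊆″ = detour t″ uq″ (λ { (_ ∷ ui) → via!″ (via! ui) }) (there ∘ via⊆ ∘ via⊆″)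
  loop-free {is = i ∷ is} {u} (a ∷ t) | detour t′ uq via! via⊆ | no u∉ =
    detour (a ∷ t′) (Allₚ.¬Any⇒All¬ _ u∉ ∷ uq)
      (λ { (i∉ ∷ ui) → All.tabulate (λ j∈ → All.lookup i∉ (via⊆ j∈)) ∷ via! ui })
      (λ { (here e) → here e ; (there j∈) → there (via⊆ j∈) })

  stops-length : ∀ {is u v} (t : Trip is u v) → length (stops t) ≡ suc (length is)
  stops-length [] = refl
  stops-length (_ ∷ t) = cong suc (stops-length t)

  stops-first : ∀ {is u v} (d : Fin n) (t : Trip is u v) → nth d (stops t) 0 ≡ u
  stops-first d [] = refl
  stops-first d (_ ∷ _) = refl

  stops-last : ∀ {is u v} (d : Fin n) (t : Trip is u v) → nth d (stops t) (length is) ≡ v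
  stops-last d [] = refl
  stops-last d (_ ∷ t) = stops-last d t

  stops-step : ∀ {is u v} (d : Fin n) (e : Fin p) (t : Trip is u v) (k : ℕ) → k < length is →
               Precedes (nth d (stops t) k) (nth d (stops t) (suc k)) (route-of (nth e (is ++ e ∷ []) k))
  stops-step {i ∷ _} {u} d e (a ∷ t) zero _ = subst (λ x → Precedes u x (route-of i)) (sym (stops-first d t)) (proj₁ a)
  stops-step d e (_ ∷ t) (suc k) (s≤s k<) = stops-step d e t k k<

  -- The stops of the loop-free trip are the nodes of a bridge, its paths followed by `i` are the
  -- paths, and `i` is the closing one. The defaults `u` and `i` of `nth` are never reached. The
  -- empty trip gives a bridge with `b = 1`.
  no-detour : BridgeFree S → NoDetour
  no-detour bf {i} {is} {u} {v} t (i∉ ∷ uis) a with loop-free t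
  ... | detour {via = js} t′ uq via! via⊆ = bf (suc (length js)) record
    { b≥1 = s≤s z≤n
    ; node = nth u (stops t′)
    ; pth = nth i (js ++ i ∷ [])
    ; node-inj = λ k l k< l< → nth-unique u uq k l (subst (k <_) (sym (stops-length t′)) k<)
                                                   (subst (l <_) (sym (stops-length t′)) l<)
    ; pth-inj = λ k l k< l< → nth-unique i upaths k l (subst (k <_) (sym len) k<) (subst (l <_) (sym len) l<)
    ; steps = λ { k (s≤s k<) → stops-step u i t′ k k< }
    ; closing = subst₂ (λ x y → Precedes x y (route-of (nth i (js ++ i ∷ []) (length js))))
                  (sym (stops-first u t′)) (sym (stops-last u t′))
                  (subst (λ j → Precedes u v (route-of j)) (sym (nth-last i js)) (proj₁ a))
    }
    where
    len : length (js ++ i ∷ []) ≡ suc (length js)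
    len = trans (length-++ js) (+-comm (length js) 1)
    upaths : Unique (js ++ i ∷ [])
    upaths = Uniqueₚ.++⁺ (via! uis) ([] ∷ []) λ { (z∈ , here refl) → All.lookup i∉ (via⊆ z∈) refl }

-- Finite sums

∑ : (n : ℕ) → (Fin n → ℕ) → ℕ
∑ zero f = 0
∑ (suc n) f = f Fin.zero + ∑ n (f ∘ Fin.suc)

∑-mono : ∀ n {f g : Fin n → ℕ} → (∀ i → f i ≤ g i) → ∑ n f ≤ ∑ n g
∑-mono zero le = z≤n
∑-mono (suc n) le = +-mono-≤ (le Fin.zero) (∑-mono n (le ∘ Fin.suc))

∑-cong : ∀ n {f g : Fin n → ℕ} → (∀ i → f i ≡ g i) → ∑ n f ≡ ∑ n g
∑-cong zero eq = refl
∑-cong (suc n) eq = cong₂ _+_ (eq Fin.zero) (∑-cong n (eq ∘ Fin.suc))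

+-interchange : ∀ a b c d → (a + b) + (c + d) ≡ (a + c) + (b + d)
+-interchange = solve 4 (λ a b c d → (a :+ b) :+ (c :+ d) := (a :+ c) :+ (b :+ d)) refl
  where open +-*-Solver

∑-+ : ∀ n (f g : Fin n → ℕ) → ∑ n (λ i → f i + g i) ≡ ∑ n f + ∑ n g
∑-+ zero f g = refl
∑-+ (suc n) f g = trans (cong (f Fin.zero + g Fin.zero +_) (∑-+ n (f ∘ Fin.suc) (g ∘ Fin.suc)))
                        (+-interchange (f Fin.zero) (g Fin.zero) _ _)

∑-* : ∀ n c (f : Fin n → ℕ) → ∑ n (λ i → c * f i) ≡ c * ∑ n f
∑-* zero c f = sym (*-zeroʳ c)
∑-* (suc n) c f = trans (cong (c * f Fin.zero +_) (∑-* n c (f ∘ Fin.suc))) (sym (*-distribˡ-+ c _ _))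

∑-const : ∀ n c → ∑ n (λ _ → c) ≡ n * c
∑-const zero c = refl
∑-const (suc n) c = cong (c +_) (∑-const n c)

∑-zero : ∀ n → ∑ n (λ _ → 0) ≡ 0
∑-zero n = trans (∑-const n 0) (*-zeroʳ n)

∑-++ : ∀ m n (f : Fin (m + n) → ℕ) → ∑ (m + n) f ≡ ∑ m (λ i → f (i Fin.↑ˡ n)) + ∑ n (λ j → f (m Fin.↑ʳ j))
∑-++ zero n f = refl
∑-++ (suc m) n f = trans (cong (f Fin.zero +_) (∑-++ m n (f ∘ Fin.suc))) (sym (+-assoc (f Fin.zero) _ _))

∑-combine : ∀ m n (f : Fin (m * n) → ℕ) → ∑ (m * n) f ≡ ∑ m (λ i → ∑ n (λ j → f (combine i j)))
∑-combine zero n f = refl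
∑-combine (suc m) n f =
  trans (∑-++ n (m * n) f) (cong (∑ n (λ j → f (j Fin.↑ˡ m * n)) +_) (∑-combine m n (λ j → f (n Fin.↑ʳ j))))

sum-mono : {A : Set} {f g : A → ℕ} (xs : List A) → (∀ {x} → x ∈ xs → f x ≤ g x) → sum (map f xs) ≤ sum (map g xs)
sum-mono [] le = z≤n
sum-mono (x ∷ xs) le = +-mono-≤ (le (here refl)) (sum-mono xs (le ∘ there))

sum-const : {A : Set} (c : ℕ) (xs : List A) → sum (map (λ _ → c) xs) ≡ length xs * c
sum-const c [] = refl
sum-const c (x ∷ xs) = cong (c +_) (sum-const c xs)

sum-* : {A : Set} (c : ℕ) (f : A → ℕ) (xs : List A) → sum (map (λ x → c * f x) xs) ≡ c * sum (map f xs)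
sum-* c f [] = sym (*-zeroʳ c)
sum-* c f (x ∷ xs) = trans (cong (c * f x +_) (sum-* c f xs)) (sym (*-distribˡ-+ c _ _))

sum-member : {A : Set} (f : A → ℕ) {xs : List A} {x : A} → x ∈ xs → f x ≤ sum (map f xs)
sum-member f (here refl) = m≤m+n _ _
sum-member f (there x∈) = ≤-trans (sum-member f x∈) (m≤n+m _ _)

sum-two-members : {A : Set} (f : A → ℕ) {xs : List A} {x y : A} → x ∈ xs → y ∈ xs → x ≢ y →
                  f x + f y ≤ sum (map f xs)
sum-two-members f (here refl) (here refl) x≢y = ⊥-elim (x≢y refl)
sum-two-members f (here refl) (there y∈) _ = +-monoʳ-≤ _ (sum-member f y∈)
sum-two-members f {x = x} {y} (there x∈) (here refl) _ =
  ≤-trans (≤-reflexive (+-comm (f x) (f y))) (+-monoʳ-≤ _ (sum-member f x∈))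
sum-two-members f (there x∈) (there y∈) x≢y = ≤-trans (sum-two-members f x∈ y∈ x≢y) (m≤n+m _ _)

∑-sum-swap : {A : Set} (n : ℕ) (f : Fin n → A → ℕ) (xs : List A) →
             ∑ n (λ i → sum (map (f i) xs)) ≡ sum (map (λ x → ∑ n (λ i → f i x)) xs)
∑-sum-swap n f [] = ∑-zero n
∑-sum-swap n f (x ∷ xs) = trans (∑-+ n _ _) (cong (∑ n (λ i → f i x) +_) (∑-sum-swap n f xs))

𝟙 : {A : Set} → Dec A → ℕ
𝟙 (yes _) = 1
𝟙 (no _) = 0

length-filter-sum : {A : Set} {Q : A → Set} (Q? : Decidable Q) (xs : List A) →
                    length (filter Q? xs) ≡ sum (map (λ x → 𝟙 (Q? x)) xs)
length-filter-sum Q? [] = refl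
length-filter-sum Q? (x ∷ xs) with Q? x
... | yes _ = cong suc (length-filter-sum Q? xs)
... | no _ = length-filter-sum Q? xs

sum-allFin : ∀ n (f : Fin n → ℕ) → sum (map f (List.allFin n)) ≡ ∑ n f
sum-allFin n f = go n f id
  where
  go : {A : Set} (n : ℕ) (f : A → ℕ) (h : Fin n → A) → sum (map f (List.tabulate h)) ≡ ∑ n (f ∘ h)
  go zero f h = refl
  go (suc n) f h = cong (f (h Fin.zero) +_) (go n f (h ∘ Fin.suc))

-- Cyclic shifts of the levels

rot : (D : ℕ) .{{_ : NonZero D}} → ℕ → Fin D → Fin D
rot D t x = fromℕ< (m%n<n (t + toℕ x) D)

%-cancelˡ : ∀ D .{{_ : NonZero D}} a {x y} → x < D → y < D → (a + x) % D ≡ (a + y) % D → x ≡ y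
%-cancelˡ D a {x} {y} x< y< eq = begin
  x                        ≡⟨ m<n⇒m%n≡m x< ⟨
  x % D                    ≡⟨ [m+kn]%n≡m%n x ((a + y) / D) D ⟨
  (x + (a + y) / D * D) % D ≡⟨ cong (_% D) shifted ⟩
  (y + (a + x) / D * D) % D ≡⟨ [m+kn]%n≡m%n y ((a + x) / D) D ⟩
  y % D                    ≡⟨ m<n⇒m%n≡m y< ⟩
  y                        ∎
  where
  open ≡-Reasoning
  q = (a + x) / D * D
  q′ = (a + y) / D * D
  ex : a + x ≡ (a + y) % D + q
  ex = trans (m≡m%n+[m/n]*n (a + x) D) (cong (_+ q) eq)
  ey : a + y ≡ (a + y) % D + q′
  ey = m≡m%n+[m/n]*n (a + y) D
  shifted : x + q′ ≡ y + q
  shifted = +-cancelˡ-≡ (a + (a + y) % D) _ _ (begin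
    (a + (a + y) % D) + (x + q′)  ≡⟨ solve 4 (λ a r x q′ → (a :+ r) :+ (x :+ q′) := (a :+ x) :+ (r :+ q′)) refl a ((a + y) % D) x q′ ⟩
    (a + x) + ((a + y) % D + q′)  ≡⟨ cong₂ _+_ ex (sym ey) ⟩
    ((a + y) % D + q) + (a + y)   ≡⟨ solve 4 (λ a r y q → (r :+ q) :+ (a :+ y) := (a :+ r) :+ (y :+ q)) refl a ((a + y) % D) y q ⟩
    (a + (a + y) % D) + (y + q)   ∎)
    where open +-*-Solver

rot-injective : ∀ D .{{_ : NonZero D}} t {x y : Fin D} → rot D t x ≡ rot D t y → x ≡ y
rot-injective D t {x} {y} eq = Finₚ.toℕ-injective (%-cancelˡ D t (Finₚ.toℕ<n x) (Finₚ.toℕ<n y)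
  (Finₚ.fromℕ<-injective _ _ _ _ eq))

-- A copy shows its level only relative to a shift; once the shift is known, the level can be read
-- off.
rot-level : ∀ D .{{_ : NonZero D}} {s t} (x : Fin D) → s < D → t < D → rot D s x ≡ rot D t x → s ≡ t
rot-level D {s} {t} x s< t< eq = %-cancelˡ D (toℕ x) s< t<
  (trans (cong (_% D) (+-comm (toℕ x) s)) (trans (Finₚ.fromℕ<-injective _ _ _ _ eq) (cong (_% D) (+-comm t (toℕ x)))))

-- Random requests

∑ᵛ : (D M : ℕ) → (Vec (Fin D) M → ℕ) → ℕ
∑ᵛ D zero f = f []
∑ᵛ D (suc M) f = ∑ D λ x → ∑ᵛ D M λ xs → f (x ∷ xs)

∑ᵛ-mono : ∀ D M {f g : Vec (Fin D) M → ℕ} → (∀ xs → f xs ≤ g xs) → ∑ᵛ D M f ≤ ∑ᵛ D M g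
∑ᵛ-mono D zero le = le []
∑ᵛ-mono D (suc M) le = ∑-mono D λ x → ∑ᵛ-mono D M λ xs → le (x ∷ xs)

∑ᵛ-const : ∀ D M c → ∑ᵛ D M (λ _ → c) ≡ D ^ M * c
∑ᵛ-const D zero c = sym (+-identityʳ c)
∑ᵛ-const D (suc M) c =
  trans (∑-cong D λ _ → ∑ᵛ-const D M c) (trans (∑-const D (D ^ M * c)) (sym (*-assoc D (D ^ M) c)))

∑ᵛ-* : ∀ D M c (f : Vec (Fin D) M → ℕ) → ∑ᵛ D M (λ xs → c * f xs) ≡ c * ∑ᵛ D M f
∑ᵛ-* D zero c f = refl
∑ᵛ-* D (suc M) c f = trans (∑-cong D λ x → ∑ᵛ-* D M c (f ∘ (x ∷_))) (∑-* D c _)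

∑ᵛ-sum-swap : {A : Set} (D M : ℕ) (f : Vec (Fin D) M → A → ℕ) (xs : List A) →
              ∑ᵛ D M (λ h → sum (map (f h) xs)) ≡ sum (map (λ x → ∑ᵛ D M (λ h → f h x)) xs)
∑ᵛ-sum-swap D zero f xs = refl
∑ᵛ-sum-swap D (suc M) f xs =
  trans (∑-cong D λ x → ∑ᵛ-sum-swap D M (f ∘ (x ∷_)) xs) (∑-sum-swap D _ xs)

-- Requests are served one after the other; serving (c , t) with the random value x asks for the
-- copy (c , rot t x).  `served` collects the different copies asked for.  `charge` is a potential
-- whose average at most doubles with each request, but which is large when few copies are new.
module Requests (D : ℕ) .{{nz : NonZero D}} {Col : Set} (_≟ᶜ_ : DecidableEquality Col) where

  Copy : Set
  Copy = Col × Fin D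

  Request : Set
  Request = Maybe (Col × ℕ)

  _≟ᵏ_ : DecidableEquality Copy
  _≟ᵏ_ = ≡-dec _≟ᶜ_ Fin._≟_

  in-col : Col → List Copy → ℕ
  in-col c zs = length (filter (λ z → proj₁ z ≟ᶜ c) zs)

  addIf : {A : Set} → Dec A → Copy → List Copy → List Copy
  addIf (yes _) z zs = zs
  addIf (no _) z zs = z ∷ zs

  add : Copy → List Copy → List Copy
  add z zs = addIf (DecMem._∈?_ _≟ᵏ_ z zs) z zs

  -- First argument: is the column still sparse; second: is the copy old. In a sparse column at most
  -- `D / 63` copies are served, so the mean is at most `1 + 63 / 63 = 2`, the flat price of a
  -- crowded column. The value 64 is the square of 8: `charge-large` needs `8 ^ a` when only half of
  -- `a` requests are old.
  factorIf : {A B : Set} → Dec A → Dec B → ℕ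
  factorIf (yes _) (yes _) = 64
  factorIf (yes _) (no _) = 1
  factorIf (no _) _ = 2

  factor : List Copy → Copy → ℕ
  factor zs z = factorIf (63 * in-col (proj₁ z) zs ≤? D) (DecMem._∈?_ _≟ᵏ_ z zs)

  active : Request → ℕ
  active nothing = 0
  active (just _) = 1

  actives : ∀ M → (Fin M → Request) → ℕ
  actives M r = ∑ M (active ∘ r)

  serve : Request → Fin D → List Copy → List Copy
  serve nothing x zs = zs
  serve (just (c , t)) x zs = add (c , rot D t x) zs

  pay : Request → Fin D → List Copy → ℕ
  pay nothing x zs = 1
  pay (just (c , t)) x zs = factor zs (c , rot D t x)

  served : ∀ M → (Fin M → Request) → Vec (Fin D) M → List Copy → List Copy
  served zero r [] zs = zs
  served (suc M) r (x ∷ xs) zs = served M (r ∘ Fin.suc) xs (serve (r Fin.zero) x zs)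

  charge : ∀ M → (Fin M → Request) → Vec (Fin D) M → List Copy → ℕ
  charge zero r [] zs = 1
  charge (suc M) r (x ∷ xs) zs = pay (r Fin.zero) x zs * charge M (r ∘ Fin.suc) xs (serve (r Fin.zero) x zs)

  hits : ∀ c t zs → ∑ D (λ x → 𝟙 (DecMem._∈?_ _≟ᵏ_ (c , rot D t x) zs)) ≤ in-col c zs
  hits c t zs = begin
    ∑ D (λ x → 𝟙 (hit? x))                                ≡⟨ sum-allFin D _ ⟨
    sum (map (λ x → 𝟙 (hit? x)) (List.allFin D))            ≡⟨ length-filter-sum hit? (List.allFin D) ⟨
    length (filter hit? (List.allFin D))                    ≡⟨ length-map copy (filter hit? (List.allFin D)) ⟨
    length (map copy (filter hit? (List.allFin D)))         ≤⟨ unique-⊆-length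
      (Uniqueₚ.map⁺ (rot-injective D t ∘ cong proj₂) (Uniqueₚ.filter⁺ hit? (Uniqueₚ.allFin⁺ D))) in-column ⟩
    in-col c zs                                             ∎
    where
    open ≤-Reasoning
    copy : Fin D → Copy
    copy x = c , rot D t x
    hit? : (x : Fin D) → Dec (copy x ∈ zs)
    hit? x = DecMem._∈?_ _≟ᵏ_ (copy x) zs
    in-column : ∀ {z} → z ∈ map copy (filter hit? (List.allFin D)) → z ∈ filter (λ z → proj₁ z ≟ᶜ c) zs
    in-column z∈ with ∈-map⁻ copy z∈
    ... | x , x∈ , refl = ∈-filter⁺ (λ z → proj₁ z ≟ᶜ c) (proj₂ (∈-filter⁻ hit? {xs = List.allFin D} x∈)) refl

  factor-average : ∀ c t zs → ∑ D (λ x → factor zs (c , rot D t x)) ≤ D * 2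
  factor-average c t zs = go (63 * in-col c zs ≤? D)
    where
    open ≤-Reasoning
    hit? : (x : Fin D) → Dec ((c , rot D t x) ∈ zs)
    hit? x = DecMem._∈?_ _≟ᵏ_ (c , rot D t x) zs
    value : {A B : Set} (a : A) (d : Dec B) → factorIf (yes a) d ≡ 1 + 63 * 𝟙 d
    value a (yes _) = refl
    value a (no _) = refl
    go : (d : Dec (63 * in-col c zs ≤ D)) → ∑ D (λ x → factorIf d (hit? x)) ≤ D * 2
    go (no _) = ≤-reflexive (∑-const D 2)
    go (yes few) = begin
      ∑ D (λ x → factorIf (yes few) (hit? x))     ≡⟨ ∑-cong D (λ x → value few (hit? x)) ⟩
      ∑ D (λ x → 1 + 63 * 𝟙 (hit? x))             ≡⟨ ∑-+ D (λ _ → 1) (λ x → 63 * 𝟙 (hit? x)) ⟩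
      ∑ D (λ _ → 1) + ∑ D (λ x → 63 * 𝟙 (hit? x)) ≡⟨ cong₂ _+_ (trans (∑-const D 1) (*-identityʳ D)) (∑-* D 63 (λ x → 𝟙 (hit? x))) ⟩
      D + 63 * ∑ D (λ x → 𝟙 (hit? x))             ≤⟨ +-monoʳ-≤ D (≤-trans (*-monoʳ-≤ 63 (hits c t zs)) few) ⟩
      D + D                                       ≡⟨ trans (cong (D +_) (sym (+-identityʳ D))) (*-comm 2 D) ⟩
      D * 2                                       ∎

  pay-average : ∀ q zs → ∑ D (λ x → pay q x zs) ≤ D * 2 ^ active q
  pay-average nothing zs = ≤-reflexive (∑-const D 1)
  pay-average (just (c , t)) zs = factor-average c t zs

  charge-average : ∀ M r zs → ∑ᵛ D M (λ xs → charge M r xs zs) ≤ 2 ^ actives M r * D ^ M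
  charge-average zero r zs = ≤-refl
  charge-average (suc M) r zs = begin
    ∑ D (λ x → ∑ᵛ D M (λ xs → pay q x zs * charge M r′ xs (serve q x zs)))
      ≡⟨ ∑-cong D (λ x → ∑ᵛ-* D M (pay q x zs) _) ⟩
    ∑ D (λ x → pay q x zs * ∑ᵛ D M (λ xs → charge M r′ xs (serve q x zs)))
      ≤⟨ ∑-mono D (λ x → *-monoʳ-≤ (pay q x zs) (charge-average M r′ _)) ⟩
    ∑ D (λ x → pay q x zs * (2 ^ a * D ^ M))
      ≡⟨ ∑-cong D (λ x → *-comm (pay q x zs) (2 ^ a * D ^ M)) ⟩
    ∑ D (λ x → (2 ^ a * D ^ M) * pay q x zs)
      ≡⟨ ∑-* D (2 ^ a * D ^ M) _ ⟩
    (2 ^ a * D ^ M) * ∑ D (λ x → pay q x zs)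
      ≤⟨ *-monoʳ-≤ (2 ^ a * D ^ M) (pay-average q zs) ⟩
    (2 ^ a * D ^ M) * (D * 2 ^ active q)
      ≡⟨ solve 4 (λ p q d e → (p :* q) :* (d :* e) := (e :* p) :* (d :* q)) refl (2 ^ a) (D ^ M) D (2 ^ active q) ⟩
    (2 ^ active q * 2 ^ a) * (D * D ^ M)
      ≡⟨ cong (_* (D * D ^ M)) (^-distribˡ-+-* 2 (active q) a) ⟨
    2 ^ (active q + a) * (D * D ^ M) ∎
    where
    open ≤-Reasoning
    open +-*-Solver
    q = r Fin.zero
    r′ = r ∘ Fin.suc
    a = actives M r′

  add-unique : ∀ z {zs} → Unique zs → Unique (add z zs)
  add-unique z {zs} u with DecMem._∈?_ _≟ᵏ_ z zs
  ... | yes _ = u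
  ... | no z∉ = Allₚ.¬Any⇒All¬ _ z∉ ∷ u

  serve-unique : ∀ q x {zs} → Unique zs → Unique (serve q x zs)
  serve-unique nothing x u = u
  serve-unique (just _) x u = add-unique _ u

  served-unique : ∀ M r xs {zs} → Unique zs → Unique (served M r xs zs)
  served-unique zero r [] u = u
  served-unique (suc M) r (x ∷ xs) u = served-unique M _ xs (serve-unique (r Fin.zero) x u)

  add⁻ : ∀ z {zs y} → y ∈ add z zs → y ∈ zs ⊎ y ≡ z
  add⁻ z {zs} y∈ with DecMem._∈?_ _≟ᵏ_ z zs
  add⁻ z y∈ | yes _ = inj₁ y∈
  add⁻ z (here eq) | no _ = inj₂ eq
  add⁻ z (there y∈) | no _ = inj₁ y∈

  serve⁻ : ∀ q x {zs z} → z ∈ serve q x zs →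
           z ∈ zs ⊎ ∃₂ λ c t → q ≡ just (c , t) × z ≡ (c , rot D t x)
  serve⁻ nothing x z∈ = inj₁ z∈
  serve⁻ (just (c , t)) x z∈ with add⁻ _ z∈
  ... | inj₁ z∈zs = inj₁ z∈zs
  ... | inj₂ eq = inj₂ (c , t , refl , eq)

  served⁻ : ∀ M r xs {zs z} → z ∈ served M r xs zs →
            z ∈ zs ⊎ ∃ λ i → ∃₂ λ c t → r i ≡ just (c , t) × z ≡ (c , rot D t (Vec.lookup xs i))
  served⁻ zero r [] z∈ = inj₁ z∈
  served⁻ (suc M) r (x ∷ xs) z∈ with served⁻ M (r ∘ Fin.suc) xs z∈
  ... | inj₂ (i , w) = inj₂ (Fin.suc i , w)
  ... | inj₁ z∈′ with serve⁻ (r Fin.zero) x z∈′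
  ...   | inj₁ z∈zs = inj₁ z∈zs
  ...   | inj₂ w = inj₂ (Fin.zero , w)

  saturated : List Copy → Request → ℕ
  saturated zs nothing = 0
  saturated zs (just (c , _)) = 1 ∸ 𝟙 (63 * in-col c zs ≤? D)

  in-col-∷ : ∀ c z zs → in-col c zs ≤ in-col c (z ∷ zs)
  in-col-∷ c z zs with proj₁ z ≟ᶜ c
  ... | yes _ = n≤1+n _
  ... | no _ = ≤-refl

  in-col-add : ∀ c z zs → in-col c zs ≤ in-col c (add z zs)
  in-col-add c z zs with DecMem._∈?_ _≟ᵏ_ z zs
  ... | yes _ = ≤-refl
  ... | no _ = in-col-∷ c z zs

  in-col-serve : ∀ c q x zs → in-col c zs ≤ in-col c (serve q x zs)
  in-col-serve c nothing x zs = ≤-refl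
  in-col-serve c (just _) x zs = in-col-add c _ zs

  in-col-served : ∀ c M r xs zs → in-col c zs ≤ in-col c (served M r xs zs)
  in-col-served c zero r [] zs = ≤-refl
  in-col-served c (suc M) r (x ∷ xs) zs =
    ≤-trans (in-col-serve c (r Fin.zero) x zs) (in-col-served c M _ xs _)

  -- `old` and `new` count the requests to columns that are sparse when served, by whether the copy
  -- was there already; `full` counts the others. Columns only fill up, so `full` is at most the
  -- number `crowded` of requests to columns that are saturated at the end.
  record Ledger (requests paid : ℕ) (before after : List Copy) (crowded : ℕ) : Set where
    field
      old new full : ℕ
      paid≥   : 64 ^ old ≤ paid
      total   : requests ≡ old + new + full
      new≤    : new + length before ≤ length after
      full≤   : full ≤ crowded

  open Ledger

  saturated-later : ∀ {c t zs ys} → ¬ 63 * in-col c zs ≤ D → in-col c zs ≤ in-col c ys →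
                    1 ≤ saturated ys (just (c , t))
  saturated-later {c} {ys = ys} many le with 63 * in-col c ys ≤? D
  ... | yes few = ⊥-elim (many (≤-trans (*-monoʳ-≤ 63 le) few))
  ... | no _ = ≤-refl

  ledger-step : ∀ q x zs {a p ys s} → (∀ c → in-col c (serve q x zs) ≤ in-col c ys) → Ledger a p (serve q x zs) ys s →
                Ledger (active q + a) (pay q x zs * p) zs ys (saturated ys q + s)
  ledger-step nothing x zs mono L = record
    { old = L .old ; new = L .new ; full = L .full ; total = L .total ; new≤ = L .new≤ ; full≤ = L .full≤
    ; paid≥ = ≤-trans (L .paid≥) (≤-reflexive (sym (+-identityʳ _))) }
  ledger-step (just (c , t)) x zs {p = p} {ys} mono L
    with 63 * in-col c zs ≤? D | DecMem._∈?_ _≟ᵏ_ (c , rot D t x) zs | in-col-add c (c , rot D t x) zs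
  ... | yes _ | yes _ | _ = record
    { old = suc (L .old) ; new = L .new ; full = L .full ; new≤ = L .new≤ ; paid≥ = *-monoʳ-≤ 64 (L .paid≥) ; total = cong suc (L .total)
    ; full≤ = ≤-trans (L .full≤) (m≤n+m _ _) }
  ... | yes _ | no _ | _ = record
    { old = L .old ; new = suc (L .new) ; full = L .full ; paid≥ = ≤-trans (L .paid≥) (≤-reflexive (sym (+-identityʳ _)))
    ; total = trans (cong suc (L .total)) (cong (_+ L .full) (sym (+-suc (L .old) (L .new))))
    ; new≤ = ≤-trans (≤-reflexive (sym (+-suc (L .new) (length zs)))) (L .new≤)
    ; full≤ = ≤-trans (L .full≤) (m≤n+m _ _) }
  ... | no many | hit | more = record
    { old = L .old ; new = L .new ; full = suc (L .full) ; paid≥ = ≤-trans (L .paid≥) (m≤m+n _ _)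
    ; total = trans (cong suc (L .total)) (sym (+-suc (L .old + L .new) (L .full)))
    ; new≤ = ≤-trans (+-monoʳ-≤ (L .new) (longer hit)) (L .new≤)
    ; full≤ = +-mono-≤ (saturated-later {c} {t} {zs} {ys} many (≤-trans more (mono c))) (L .full≤) }
    where
    longer : {B : Set} (d : Dec B) → length zs ≤ length (addIf d (c , rot D t x) zs)
    longer (yes _) = ≤-refl
    longer (no _) = n≤1+n _

  ledger : ∀ M r xs zs → Ledger (actives M r) (charge M r xs zs) zs (served M r xs zs)
                                (∑ M (saturated (served M r xs zs) ∘ r))
  ledger zero r [] zs = record
    { old = 0 ; new = 0 ; full = 0 ; paid≥ = ≤-refl ; total = refl ; new≤ = ≤-refl ; full≤ = z≤n }
  ledger (suc M) r (x ∷ xs) zs =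
    ledger-step (r Fin.zero) x zs (λ c → in-col-served c M (r ∘ Fin.suc) xs _) (ledger M (r ∘ Fin.suc) xs _)

  asks : Col → Request → ℕ
  asks c nothing = 0
  asks c (just (c′ , _)) = 𝟙 (c ≟ᶜ c′)

  -- A saturated column holds more than `D / 63` of the served copies and receives at most `8 * D`
  -- requests, which makes `8 * 63 = 504` requests per copy.
  crowd-bound : ∀ M r zs → (∀ c → ∑ M (asks c ∘ r) ≤ 8 * D) →
                ∑ M (saturated zs ∘ r) ≤ 504 * length zs
  crowd-bound M r zs load = *-cancelˡ-≤ D (begin
    D * ∑ M (saturated zs ∘ r)                         ≡⟨ ∑-* M D _ ⟨
    ∑ M (λ i → D * saturated zs (r i))                 ≤⟨ ∑-mono M (λ i → one (r i)) ⟩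
    ∑ M (λ i → 63 * sum (map (λ z → asks (proj₁ z) (r i)) zs)) ≡⟨ ∑-* M 63 _ ⟩
    63 * ∑ M (λ i → sum (map (λ z → asks (proj₁ z) (r i)) zs)) ≡⟨ cong (63 *_) (∑-sum-swap M (λ i z → asks (proj₁ z) (r i)) zs) ⟩
    63 * sum (map (λ z → ∑ M (λ i → asks (proj₁ z) (r i))) zs) ≤⟨ *-monoʳ-≤ 63 (sum-mono zs (λ {z} _ → load (proj₁ z))) ⟩
    63 * sum (map (λ _ → 8 * D) zs)                    ≡⟨ cong (63 *_) (sum-const (8 * D) zs) ⟩
    63 * (length zs * (8 * D))                         ≡⟨ solve 2 (λ l d → con 63 :* (l :* (con 8 :* d)) := d :* (con 504 :* l)) refl (length zs) D ⟩
    D * (504 * length zs)                              ∎)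
    where
    open ≤-Reasoning
    open +-*-Solver
    one : ∀ q → D * saturated zs q ≤ 63 * sum (map (λ z → asks (proj₁ z) q) zs)
    one nothing = ≤-trans (≤-reflexive (*-zeroʳ D)) z≤n
    one (just (c , _)) with 63 * in-col c zs ≤? D
    ... | yes _ = ≤-trans (≤-reflexive (*-zeroʳ D)) z≤n
    ... | no many = ≤-trans (≤-reflexive (*-identityʳ D))
      (≤-trans (<⇒≤ (≰⇒> many)) (≤-reflexive (cong (63 *_) (length-filter-sum (λ z → proj₁ z ≟ᶜ c) zs))))

  -- Let `ℓ` copies be served. At most `ℓ` requests are new and `504 * ℓ` meet a crowded column; if
  -- `1010 * ℓ` does not exceed the number of requests, at least half of them are old and each of
  -- these pays `64 = 8 ^ 2`. As the mean charge is `2 ^ a`, this has probability at most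
  -- `4 ^ (- a)`.
  charge-large : ∀ M r xs → (∀ c → ∑ M (asks c ∘ r) ≤ 8 * D) →
                 1010 * length (served M r xs []) ≤ actives M r → 8 ^ actives M r ≤ charge M r xs []
  charge-large M r xs load few = ≤-trans (^-monoʳ-≤ 8 a≤2o) (≤-trans (≤-reflexive (sym (^-*-assoc 8 2 (L .old)))) (L .paid≥))
    where
    open ≤-Reasoning
    L = ledger M r xs []
    a = actives M r
    ℓ = length (served M r xs [])
    a≤ : a ≤ L .old + 505 * ℓ
    a≤ = begin
      a                              ≡⟨ L .total ⟩
      L .old + L .new + L .full      ≤⟨ +-mono-≤ (+-monoʳ-≤ (L .old) (≤-trans (≤-reflexive (sym (+-identityʳ _))) (L .new≤)))
                                          (≤-trans (L .full≤) (crowd-bound M r (served M r xs []) load)) ⟩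
      L .old + ℓ + 504 * ℓ           ≡⟨ +-assoc (L .old) ℓ (504 * ℓ) ⟩
      L .old + 505 * ℓ               ∎
    a≤2o : a ≤ 2 * L .old
    a≤2o = +-cancelʳ-≤ a a (2 * L .old) (begin
      a + a                          ≡⟨ cong (a +_) (sym (+-identityʳ a)) ⟩
      2 * a                          ≤⟨ *-monoʳ-≤ 2 a≤ ⟩
      2 * (L .old + 505 * ℓ)         ≡⟨ solve 2 (λ o l → con 2 :* (o :+ con 505 :* l) := con 2 :* o :+ con 1010 :* l) refl (L .old) ℓ ⟩
      2 * L .old + 1010 * ℓ          ≤⟨ +-monoʳ-≤ (2 * L .old) few ⟩
      2 * L .old + a                 ∎)
      where open +-*-Solver

-- The union bound over patterns of blocked stops

vecs : {A : Set} (n : ℕ) → List A → List (Vec A n)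
vecs zero xs = [] ∷ []
vecs (suc n) xs = cartesianProductWith _∷_ xs (vecs n xs)

∈-vecs : {A : Set} {n : ℕ} {xs : List A} (v : Vec A n) → (∀ i → Vec.lookup v i ∈ xs) → v ∈ vecs n xs
∈-vecs [] _ = here refl
∈-vecs (x ∷ v) x∈ = ∈-cartesianProductWith⁺ _∷_ (x∈ Fin.zero) (∈-vecs v (x∈ ∘ Fin.suc))

sum-cartesianProductWith : {A B C : Set} (f : C → ℕ) (k : A → B → C) (xs : List A) (ys : List B) →
  sum (map f (cartesianProductWith k xs ys)) ≡ sum (map (λ x → sum (map (f ∘ k x) ys)) xs)
sum-cartesianProductWith f k [] ys = refl
sum-cartesianProductWith f k (x ∷ xs) ys = begin
  sum (map f (map (k x) ys ++ rest))           ≡⟨ cong sum (map-++ f (map (k x) ys) rest) ⟩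
  sum (map f (map (k x) ys) ++ map f rest)     ≡⟨ sum-++ (map f (map (k x) ys)) (map f rest) ⟩
  sum (map f (map (k x) ys)) + sum (map f rest) ≡⟨ cong₂ _+_ (cong sum (sym (map-∘ ys))) (sum-cartesianProductWith f k xs ys) ⟩
  sum (map (f ∘ k x) ys) + sum (map (λ x → sum (map (f ∘ k x) ys)) xs) ∎
  where
  open ≡-Reasoning
  rest = cartesianProductWith k xs ys

∏ : {A : Set} {n : ℕ} → (A → ℕ) → Vec A n → ℕ
∏ w [] = 1
∏ w (x ∷ v) = w x * ∏ w v

sum-∏ : {A : Set} (n : ℕ) (w : A → ℕ) (xs : List A) → sum (map (∏ w) (vecs n xs)) ≡ sum (map w xs) ^ n
sum-∏ zero w xs = refl
sum-∏ (suc n) w xs = begin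
  sum (map (∏ w) (cartesianProductWith _∷_ xs (vecs n xs)))   ≡⟨ sum-cartesianProductWith (∏ w) _∷_ xs (vecs n xs) ⟩
  sum (map (λ x → sum (map (λ v → w x * ∏ w v) (vecs n xs))) xs) ≡⟨ cong sum (map-cong′ xs) ⟩
  sum (map (λ x → s ^ n * w x) xs)                              ≡⟨ sum-* (s ^ n) w xs ⟩
  s ^ n * s                                                     ≡⟨ *-comm (s ^ n) s ⟩
  s * s ^ n                                                     ∎
  where
  open ≡-Reasoning
  s = sum (map w xs)
  map-cong′ : ∀ ys → map (λ x → sum (map (λ v → w x * ∏ w v) (vecs n xs))) ys ≡ map (λ x → s ^ n * w x) ys
  map-cong′ [] = refl
  map-cong′ (y ∷ ys) = cong₂ _∷_
    (trans (sum-* (w y) (∏ w) (vecs n xs)) (trans (cong (w y *_) (sum-∏ n w xs)) (*-comm (w y) (s ^ n)))) (map-cong′ ys)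

length-as-sum : {A : Set} (xs : List A) → length xs ≡ sum (map (λ _ → 1) xs)
length-as-sum xs = sym (trans (sum-const 1 xs) (*-identityʳ _))

∏-one : {A : Set} {n : ℕ} (v : Vec A n) → ∏ (λ _ → 1) v ≡ 1
∏-one [] = refl
∏-one (x ∷ v) = trans (+-identityʳ _) (∏-one v)

length-vecs : {A : Set} (n : ℕ) (xs : List A) → length (vecs n xs) ≡ length xs ^ n
length-vecs n xs = begin
  length (vecs n xs)                          ≡⟨ length-as-sum (vecs n xs) ⟩
  sum (map (λ _ → 1) (vecs n xs))              ≡⟨ cong sum (ones (vecs n xs)) ⟩
  sum (map (∏ (λ _ → 1)) (vecs n xs))          ≡⟨ sum-∏ n (λ _ → 1) xs ⟩
  sum (map (λ _ → 1) xs) ^ n                   ≡⟨ cong (_^ n) (length-as-sum xs) ⟨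
  length xs ^ n                                ∎
  where
  open ≡-Reasoning
  ones : ∀ vs → map (λ _ → 1) vs ≡ map (∏ (λ _ → 1)) vs
  ones [] = refl
  ones (v ∷ vs) = cong₂ _∷_ (sym (∏-one v)) (ones vs)

^-distribʳ-* : ∀ k m n → (m * n) ^ k ≡ m ^ k * n ^ k
^-distribʳ-* zero m n = refl
^-distribʳ-* (suc k) m n = trans (cong (m * n *_) (^-distribʳ-* k m n))
  (solve 4 (λ a b c d → a :* b :* (c :* d) := a :* c :* (b :* d)) refl m n (m ^ k) (n ^ k))
  where open +-*-Solver

-- The inequality `(1 + 1/m) ^ i ≤ 1 / (1 - i/m)` without denominators.
bernoulli : ∀ m i → i ≤ m → suc m ^ i * (m ∸ i) ≤ m ^ suc i
bernoulli m zero _ = ≤-reflexive (trans (+-identityʳ m) (sym (*-identityʳ m)))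
bernoulli m (suc i) i<m = begin
  suc m * suc m ^ i * (m ∸ suc i)      ≡⟨ solve 3 (λ a b c → a :* b :* c := b :* (a :* c)) refl (suc m) (suc m ^ i) (m ∸ suc i) ⟩
  suc m ^ i * (suc m * (m ∸ suc i))    ≤⟨ *-monoʳ-≤ (suc m ^ i) key ⟩
  suc m ^ i * (m * (m ∸ i))            ≡⟨ solve 3 (λ a b c → a :* (b :* c) := b :* (a :* c)) refl (suc m ^ i) m (m ∸ i) ⟩
  m * (suc m ^ i * (m ∸ i))            ≤⟨ *-monoʳ-≤ m (bernoulli m i (<⇒≤ i<m)) ⟩
  m * m ^ suc i                        ∎
  where
  open ≤-Reasoning
  open +-*-Solver
  d = m ∸ suc i
  key : suc m * d ≤ m * (m ∸ i)
  key = begin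
    d + m * d       ≤⟨ +-monoˡ-≤ (m * d) (m∸n≤m m (suc i)) ⟩
    m + m * d       ≡⟨ *-suc m d ⟨
    m * suc d       ≡⟨ cong (m *_) (+-∸-assoc 1 i<m) ⟨
    m * (m ∸ i)     ∎

bit : Bool → ℕ
bit true = 1
bit false = 0

cobit : Bool → ℕ
cobit true = 0
cobit false = 1

trues falses : ∀ {K} → Vec Bool K → ℕ
trues {K} row = ∑ K (bit ∘ Vec.lookup row)
falses {K} row = ∑ K (cobit ∘ Vec.lookup row)

trues+falses : ∀ {K} (row : Vec Bool K) → trues row + falses row ≡ K
trues+falses {K} row = begin
  trues row + falses row                                          ≡⟨ ∑-+ K (bit ∘ Vec.lookup row) (cobit ∘ Vec.lookup row) ⟨
  ∑ K (λ i → bit (Vec.lookup row i) + cobit (Vec.lookup row i))   ≡⟨ ∑-cong K (λ i → one (Vec.lookup row i)) ⟩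
  ∑ K (λ _ → 1)                                                   ≡⟨ trans (∑-const K 1) (*-identityʳ K) ⟩
  K                                                               ∎
  where
  open ≡-Reasoning
  one : ∀ b → bit b + cobit b ≡ 1
  one true = refl
  one false = refl

falsesBefore : ∀ {K} → Vec Bool K → Fin K → ℕ
falsesBefore (b ∷ row) Fin.zero = 0
falsesBefore (b ∷ row) (Fin.suc p) = cobit b + falsesBefore row p

no-trues : ∀ {K} (row : Vec Bool K) → trues row ≡ 0 → row ≡ Vec.replicate K false
no-trues [] _ = refl
no-trues (false ∷ row) eq = cong (false ∷_) (no-trues row eq)

trues-replicate : ∀ K → trues (Vec.replicate K false) ≡ 0
trues-replicate zero = refl
trues-replicate (suc K) = trues-replicate K

module UnionBound (D : ℕ) .{{nz : NonZero D}} {Col : Set} (_≟ᶜ_ : DecidableEquality Col) (P K g : ℕ)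
                  (col : Fin P → Fin K → Fin g → Col)
                  (load : ∀ c → ∑ P (λ i → ∑ K (λ p → ∑ g (λ j → 𝟙 (c ≟ᶜ col i p j)))) ≤ 8 * D) where
  open Requests D _≟ᶜ_ public

  M : ℕ
  M = P * (K * g)

  -- A code marks the stops at which the walker of a severed commodity is stuck on its level; the level
  -- reached before stop p is then the number of unmarked stops before p.
  Code : Set
  Code = Vec (Vec Bool K) P

  index : Fin P → Fin K → Fin g → Fin M
  index i p j = combine i (combine p j)

  ask : Vec Bool K → Fin K → Col → Request
  ask row p c = if Vec.lookup row p then just (c , falsesBefore row p) else nothing

  ask-at : Code → Fin P → Fin K × Fin g → Request
  ask-at code i (p , j) = ask (Vec.lookup code i) p (col i p j)

  ask-from : Code → Fin P × Fin (K * g) → Request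
  ask-from code (i , y) = ask-at code i (remQuot {K} g y)

  request : Code → Fin M → Request
  request code x = ask-from code (remQuot {P} (K * g) x)

  request-index : ∀ code i p j → request code (index i p j) ≡ ask (Vec.lookup code i) p (col i p j)
  request-index code i p j = trans (cong (ask-from code) (Finₚ.remQuot-combine {P} {K * g} i (combine p j)))
                                   (cong (ask-at code i) (Finₚ.remQuot-combine {K} {g} p j))

  ∑-index : ∀ (f : Fin M → ℕ) → ∑ M f ≡ ∑ P (λ i → ∑ K (λ p → ∑ g (λ j → f (index i p j))))
  ∑-index f = trans (∑-combine P (K * g) f) (∑-cong P λ i → ∑-combine K g (f ∘ combine i))

  request-load : ∀ code c → ∑ M (asks c ∘ request code) ≤ 8 * D
  request-load code c = ≤-trans (≤-reflexive (∑-index _))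
    (≤-trans (∑-mono P λ i → ∑-mono K λ p → ∑-mono g λ j →
               ≤-trans (≤-reflexive (cong (asks c) (request-index code i p j))) (at-most (Vec.lookup (Vec.lookup code i) p)))
             (load c))
    where
    at-most : ∀ b {c′ t} → asks c (if b then just (c′ , t) else nothing) ≤ 𝟙 (c ≟ᶜ c′)
    at-most true = ≤-refl
    at-most false = z≤n

  request-actives : ∀ code → actives M (request code) ≡ ∑ P (λ i → trues (Vec.lookup code i) * g)
  request-actives code = trans (∑-index _) (∑-cong P λ i → trans (∑-cong K λ p →
      trans (∑-cong g λ j → trans (cong active (request-index code i p j)) (on-off (Vec.lookup (Vec.lookup code i) p)))
            (trans (∑-const g _) (*-comm g _)))
      (trans (∑-cong K λ p → *-comm _ g) (trans (∑-* K g _) (*-comm g _))))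
    where
    on-off : ∀ b {x} → active (if b then just x else nothing) ≡ bit b
    on-off true = refl
    on-off false = refl

  -- The bound on the mean charge of a row, padded by 8 for each inactive request. The padding gives
  -- all codes the same threshold `8 ^ M`, and it makes the weight of a code the product over its
  -- rows.
  weight : Vec Bool K → ℕ
  weight row = 8 ^ (falses row * g) * 2 ^ (trues row * g)

  spare : Code → ℕ
  spare code = ∑ P (λ i → falses (Vec.lookup code i) * g)

  actives+spare : ∀ code → actives M (request code) + spare code ≡ M
  actives+spare code = begin
    actives M (request code) + spare code                 ≡⟨ cong (_+ spare code) (request-actives code) ⟩
    ∑ P (λ i → trues (Vec.lookup code i) * g) + spare code ≡⟨ ∑-+ P _ _ ⟨
    ∑ P (λ i → trues (Vec.lookup code i) * g + falses (Vec.lookup code i) * g)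
      ≡⟨ ∑-cong P (λ i → trans (sym (*-distribʳ-+ g (trues (Vec.lookup code i)) _)) (cong (_* g) (trues+falses (Vec.lookup code i)))) ⟩
    ∑ P (λ _ → K * g)                                     ≡⟨ ∑-const P (K * g) ⟩
    M                                                     ∎
    where open ≡-Reasoning

  code-weight : ∀ code → 8 ^ spare code * 2 ^ actives M (request code) ≡ ∏ weight code
  code-weight code = trans (cong (λ a → 8 ^ spare code * 2 ^ a) (request-actives code)) (go code)
    where
    go : ∀ {n} (v : Vec (Vec Bool K) n) →
         8 ^ ∑ n (λ i → falses (Vec.lookup v i) * g) * 2 ^ ∑ n (λ i → trues (Vec.lookup v i) * g) ≡ ∏ weight v
    go [] = refl
    go {suc n} (row ∷ v) = begin
      8 ^ (a + b) * 2 ^ (c + d)               ≡⟨ cong₂ _*_ (^-distribˡ-+-* 8 a b) (^-distribˡ-+-* 2 c d) ⟩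
      (8 ^ a * 8 ^ b) * (2 ^ c * 2 ^ d)       ≡⟨ solve 4 (λ a b c d → (a :* b) :* (c :* d) := (a :* c) :* (b :* d)) refl (8 ^ a) (8 ^ b) (2 ^ c) (2 ^ d) ⟩
      (8 ^ a * 2 ^ c) * (8 ^ b * 2 ^ d)       ≡⟨ cong ((8 ^ a * 2 ^ c) *_) (go v) ⟩
      (8 ^ a * 2 ^ c) * ∏ weight v            ∎
      where
      open ≡-Reasoning
      open +-*-Solver
      a = falses row * g
      b = ∑ n (λ i → falses (Vec.lookup v i) * g)
      c = trues row * g
      d = ∑ n (λ i → trues (Vec.lookup v i) * g)

  quiet : Vec Bool K
  quiet = Vec.replicate K false

  loud : List (Vec Bool K)
  loud = filter (λ row → 7 * D ≤? trues row) (vecs K (true ∷ false ∷ []))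

  codes : List Code
  codes = vecs P (quiet ∷ loud)

  w₀ : ℕ
  w₀ = 8 ^ (K * g)

  W : ℕ
  W = sum (map weight loud)

  weight-quiet : weight quiet ≡ w₀
  weight-quiet = begin
    8 ^ (falses quiet * g) * 2 ^ (trues quiet * g) ≡⟨ cong₂ (λ f t → 8 ^ (f * g) * 2 ^ (t * g)) falses-quiet (trues-replicate K) ⟩
    8 ^ (K * g) * 1                                ≡⟨ *-identityʳ _ ⟩
    8 ^ (K * g)                                    ∎
    where
    open ≡-Reasoning
    falses-quiet : falses quiet ≡ K
    falses-quiet = trans (cong (_+ falses quiet) (sym (trues-replicate K))) (trues+falses quiet)

  weight-loud : ∀ {row} → row ∈ loud → weight row * 4 ^ (7 * D * g) ≤ w₀
  weight-loud {row} row∈ = begin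
    8 ^ f * 2 ^ t * 4 ^ (7 * D * g)     ≤⟨ *-monoʳ-≤ (8 ^ f * 2 ^ t) (^-monoʳ-≤ 4 (*-monoˡ-≤ g (proj₂ (∈-filter⁻ (λ row → 7 * D ≤? trues row) {xs = vecs K (true ∷ false ∷ [])} row∈)))) ⟩
    8 ^ f * 2 ^ t * 4 ^ t               ≡⟨ *-assoc (8 ^ f) (2 ^ t) (4 ^ t) ⟩
    8 ^ f * (2 ^ t * 4 ^ t)             ≡⟨ cong (8 ^ f *_) (sym (^-distribʳ-* t 2 4)) ⟩
    8 ^ f * 8 ^ t                       ≡⟨ ^-distribˡ-+-* 8 f t ⟨
    8 ^ (f + t)                         ≡⟨ cong (8 ^_) (trans (+-comm f t) (trans (sym (*-distribʳ-+ g (trues row) (falses row))) (cong (_* g) (trues+falses row)))) ⟩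
    8 ^ (K * g)                         ∎
    where
    open ≤-Reasoning
    f = falses row * g
    t = trues row * g

  -- Compared with the quiet row, a loud row loses a factor 4 for each of at least `7 * D * g`
  -- active requests, and there are at most `2 ^ K` loud rows.
  W-small : 4 * P * 2 ^ K ≤ 4 ^ (7 * D * g) → 4 * P * W ≤ w₀
  W-small big = *-cancelʳ-≤ (4 * P * W) w₀ X {{m^n≢0 4 (7 * D * g)}} (begin
    4 * P * W * X                          ≡⟨ *-assoc (4 * P) W X ⟩
    4 * P * (W * X)                        ≡⟨ cong (4 * P *_) (trans (*-comm W X) (sym (sum-* X weight loud))) ⟩
    4 * P * sum (map (λ row → X * weight row) loud) ≤⟨ *-monoʳ-≤ (4 * P) (sum-mono loud (λ {row} row∈ → ≤-trans (≤-reflexive (*-comm X (weight row))) (weight-loud row∈))) ⟩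
    4 * P * sum (map (λ _ → w₀) loud)      ≡⟨ cong (4 * P *_) (sum-const w₀ loud) ⟩
    4 * P * (length loud * w₀)             ≤⟨ *-monoʳ-≤ (4 * P) (*-monoˡ-≤ w₀ (≤-trans (length-filter (λ row → 7 * D ≤? trues row) (vecs K (true ∷ false ∷ []))) (≤-reflexive (length-vecs K (true ∷ false ∷ []))))) ⟩
    4 * P * (2 ^ K * w₀)                   ≡⟨ *-assoc (4 * P) (2 ^ K) w₀ ⟨
    4 * P * 2 ^ K * w₀                     ≤⟨ *-monoˡ-≤ w₀ big ⟩
    X * w₀                                 ≡⟨ *-comm X w₀ ⟩
    w₀ * X                                 ∎)
    where
    open ≤-Reasoning
    X = 4 ^ (7 * D * g)

  Bad : Vec (Fin D) M → Code → Set
  Bad h code = (∃ λ i → trues (Vec.lookup code i) ≢ 0) ×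
               (∀ i → trues (Vec.lookup code i) ≡ 0 ⊎ 7 * D ≤ trues (Vec.lookup code i)) ×
               1010 * length (served M (request code) h []) ≤ actives M (request code)

  valid∈ : ∀ code → (∀ i → trues (Vec.lookup code i) ≡ 0 ⊎ 7 * D ≤ trues (Vec.lookup code i)) → code ∈ codes
  valid∈ code valid = ∈-vecs code λ i → member i (valid i)
    where
    bits : ∀ (b : Bool) → b ∈ true ∷ false ∷ []
    bits true = here refl
    bits false = there (here refl)
    member : ∀ i → trues (Vec.lookup code i) ≡ 0 ⊎ 7 * D ≤ trues (Vec.lookup code i) →
             Vec.lookup code i ∈ quiet ∷ loud
    member i (inj₁ none) = here (no-trues _ none)
    member i (inj₂ many) = there (∈-filter⁺ (λ row → 7 * D ≤? trues row)
      (∈-vecs (Vec.lookup code i) (λ p → bits (Vec.lookup (Vec.lookup code i) p))) many)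

  silent : Code
  silent = Vec.replicate P quiet

  -- First moment method. If every `h` were bad, the padded charges of all codes would add up to at
  -- least `2 * 8 ^ M` for each `h`: once from the silent code, once from a bad one. Their mean is
  -- at most `(w₀ + W) ^ P`, hence at most `8 ^ M * (1 + 1 / (4 * P)) ^ P`. Keeping the silent code
  -- in the sum is what lets the sum factor over the commodities.
  not-all-bad : 1 ≤ P → 4 * P * 2 ^ K ≤ 4 ^ (7 * D * g) → ¬ (∀ h → ∃ (Bad h))
  not-all-bad P≥1 big bad = <⇒≱ 4<6 contradiction-bound
    where
    open ≤-Reasoning
    open +-*-Solver
    value : Vec (Fin D) M → Code → ℕ
    value h code = 8 ^ spare code * charge M (request code) h []
    full : ℕ
    full = 8 ^ M
    trues-silent : ∀ i → trues (Vec.lookup silent i) ≡ 0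
    trues-silent i = trans (cong trues (lookup-replicate i quiet)) (trues-replicate K)
    value-silent : ∀ h → full ≤ value h silent
    value-silent h = begin
      8 ^ M                              ≡⟨ cong (8 ^_) (trans (sym (actives+spare silent)) (cong (_+ spare silent) (trans (request-actives silent) (trans (∑-cong P λ i → cong (_* g) (trues-silent i)) (∑-zero P))))) ⟩
      8 ^ spare silent                   ≡⟨ *-identityʳ _ ⟨
      8 ^ spare silent * 1               ≤⟨ *-monoʳ-≤ (8 ^ spare silent) (≤-trans (m^n>0 64 (Ledger.old L)) (Ledger.paid≥ L)) ⟩
      value h silent                     ∎
      where L = ledger M (request silent) h []
    value-bad : ∀ h code → Bad h code → full ≤ value h code
    value-bad h code (_ , _ , few) = begin
      8 ^ M                                           ≡⟨ cong (8 ^_) (trans (sym (actives+spare code)) (+-comm a (spare code))) ⟩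
      8 ^ (spare code + a)                            ≡⟨ ^-distribˡ-+-* 8 (spare code) a ⟩
      8 ^ spare code * 8 ^ a                          ≤⟨ *-monoʳ-≤ (8 ^ spare code) (charge-large M (request code) h (request-load code) few) ⟩
      value h code                                    ∎
      where a = actives M (request code)
    distinct-codes : ∀ code → (∃ λ i → trues (Vec.lookup code i) ≢ 0) → silent ≢ code
    distinct-codes code (i , some) refl = some (trues-silent i)
    each : ∀ h → full + full ≤ sum (map (value h) codes)
    each h with bad h
    ... | code , b@(some , valid , few) = ≤-trans (+-mono-≤ (value-silent h) (value-bad h code b))
      (sum-two-members (value h) (valid∈ silent (inj₁ ∘ trues-silent)) (valid∈ code valid) (distinct-codes code some))
    averaged : 2 * w₀ ^ P ≤ (w₀ + W) ^ P
    averaged = *-cancelˡ-≤ (D ^ M) {{m^n≢0 D M}} (begin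
      D ^ M * (2 * w₀ ^ P)                         ≡⟨ cong (D ^ M *_) (cong₂ _+_ (w₀-full) (trans (+-identityʳ (w₀ ^ P)) w₀-full)) ⟩
      D ^ M * (full + full)                        ≡⟨ ∑ᵛ-const D M (full + full) ⟨
      ∑ᵛ D M (λ _ → full + full)                   ≤⟨ ∑ᵛ-mono D M each ⟩
      ∑ᵛ D M (λ h → sum (map (value h) codes))     ≡⟨ ∑ᵛ-sum-swap D M value codes ⟩
      sum (map (λ code → ∑ᵛ D M (λ h → value h code)) codes) ≤⟨ sum-mono codes (λ {code} _ → average code) ⟩
      sum (map (λ code → D ^ M * ∏ weight code) codes) ≡⟨ sum-* (D ^ M) (∏ weight) codes ⟩
      D ^ M * sum (map (∏ weight) codes)           ≡⟨ cong (D ^ M *_) (sum-∏ P weight (quiet ∷ loud)) ⟩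
      D ^ M * (weight quiet + W) ^ P               ≡⟨ cong (λ w → D ^ M * (w + W) ^ P) weight-quiet ⟩
      D ^ M * (w₀ + W) ^ P                         ∎)
      where
      w₀-full : w₀ ^ P ≡ full
      w₀-full = trans (^-*-assoc 8 (K * g) P) (cong (8 ^_) (*-comm (K * g) P))
      average : ∀ code → ∑ᵛ D M (λ h → value h code) ≤ D ^ M * ∏ weight code
      average code = begin
        ∑ᵛ D M (λ h → value h code)                ≡⟨ ∑ᵛ-* D M (8 ^ spare code) _ ⟩
        8 ^ spare code * ∑ᵛ D M (λ h → charge M (request code) h []) ≤⟨ *-monoʳ-≤ (8 ^ spare code) (charge-average M (request code) []) ⟩
        8 ^ spare code * (2 ^ a * D ^ M)           ≡⟨ *-assoc (8 ^ spare code) (2 ^ a) (D ^ M) ⟨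
        8 ^ spare code * 2 ^ a * D ^ M             ≡⟨ cong (_* D ^ M) (code-weight code) ⟩
        ∏ weight code * D ^ M                      ≡⟨ *-comm (∏ weight code) (D ^ M) ⟩
        D ^ M * ∏ weight code                      ∎
        where a = actives M (request code)
    q = 4 * P
    scaled : 2 * q ^ P ≤ suc q ^ P
    scaled = *-cancelʳ-≤ (2 * q ^ P) (suc q ^ P) (w₀ ^ P) {{m^n≢0 w₀ P {{m^n≢0 8 (K * g)}}}} (begin
      2 * q ^ P * w₀ ^ P            ≡⟨ solve 2 (λ a b → con 2 :* a :* b := a :* (con 2 :* b)) refl (q ^ P) (w₀ ^ P) ⟩
      q ^ P * (2 * w₀ ^ P)          ≤⟨ *-monoʳ-≤ (q ^ P) averaged ⟩
      q ^ P * (w₀ + W) ^ P          ≡⟨ ^-distribʳ-* P q (w₀ + W) ⟨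
      (q * (w₀ + W)) ^ P            ≤⟨ ^-monoˡ-≤ P (≤-trans (≤-reflexive (*-distribˡ-+ q w₀ W)) (+-monoʳ-≤ (q * w₀) (W-small big))) ⟩
      (q * w₀ + w₀) ^ P             ≡⟨ cong (_^ P) (+-comm (q * w₀) w₀) ⟩
      (suc q * w₀) ^ P              ≡⟨ ^-distribʳ-* P (suc q) w₀ ⟩
      suc q ^ P * w₀ ^ P            ∎)
    4<6 : 4 < 6
    4<6 = s≤s (s≤s (s≤s (s≤s (s≤s z≤n))))
    -- Bernoulli with `q = 4 * P` bounds `(1 + 1/q) ^ P` by `q / (q - P) = 4/3`, whereas `scaled`
    -- says that it is at least 2; multiplied by 3 this reads `6 ≤ 4`.
    contradiction-bound : 6 ≤ 4
    contradiction-bound = *-cancelʳ-≤ 6 4 (P * q ^ P) {{>-nonZero (*-mono-≤ P≥1 (m^n>0 q {{>-nonZero (≤-trans P≥1 (m≤m+n P (3 * P)))}} P))}} (begin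
      6 * (P * q ^ P)               ≡⟨ solve 2 (λ p a → con 6 :* (p :* a) := con 3 :* p :* (con 2 :* a)) refl P (q ^ P) ⟩
      3 * P * (2 * q ^ P)           ≤⟨ *-monoʳ-≤ (3 * P) scaled ⟩
      3 * P * suc q ^ P             ≡⟨ *-comm (3 * P) _ ⟩
      suc q ^ P * (3 * P)           ≡⟨ cong (suc q ^ P *_) (trans (cong (_∸ P) (+-comm P (3 * P))) (m+n∸n≡m (3 * P) P)) ⟨
      suc q ^ P * (q ∸ P)           ≤⟨ bernoulli q P (m≤m+n P (3 * P)) ⟩
      q * q ^ P                     ≡⟨ *-assoc 4 P (q ^ P) ⟩
      4 * (P * q ^ P)               ∎)

-- Rational arithmetic and sums over flows

ℕtoℚ-rep : ∀ m → ℚ.toℚᵘ (ℕtoℚ m) ℚᵘ.≃ ℚᵘ.mkℚᵘ (ℤ.+ m) 0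
ℕtoℚ-rep m = ℚₚ.toℚᵘ-fromℚᵘ (ℚᵘ.mkℚᵘ (ℤ.+ m) 0)

ℕtoℚ-+ : ∀ m n → ℕtoℚ (m ℕ.+ n) ≡ ℕtoℚ m ℚ.+ ℕtoℚ n
ℕtoℚ-+ m n = ℚₚ.toℚᵘ-injective (begin
  ℚ.toℚᵘ (ℕtoℚ (m ℕ.+ n))                       ≈⟨ ℕtoℚ-rep (m ℕ.+ n) ⟩
  ℚᵘ.mkℚᵘ (ℤ.+ (m ℕ.+ n)) 0                       ≈⟨ ℚᵘ.*≡* (cong (ℤ._* ℤ.+ 1) (sym (cong₂ ℤ._+_ (ℤₚ.*-identityʳ (ℤ.+ m)) (ℤₚ.*-identityʳ (ℤ.+ n))))) ⟩
  ℚᵘ.mkℚᵘ (ℤ.+ m) 0 ℚᵘ.+ ℚᵘ.mkℚᵘ (ℤ.+ n) 0           ≈⟨ ℚᵘₚ.+-cong (ℕtoℚ-rep m) (ℕtoℚ-rep n) ⟨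
  ℚ.toℚᵘ (ℕtoℚ m) ℚᵘ.+ ℚ.toℚᵘ (ℕtoℚ n)           ≈⟨ ℚₚ.toℚᵘ-homo-+ (ℕtoℚ m) (ℕtoℚ n) ⟨
  ℚ.toℚᵘ (ℕtoℚ m ℚ.+ ℕtoℚ n)                     ∎)
  where open ℚᵘₚ.≃-Reasoning

ℕtoℚ-* : ∀ m n → ℕtoℚ (m ℕ.* n) ≡ ℕtoℚ m ℚ.* ℕtoℚ n
ℕtoℚ-* m n = ℚₚ.toℚᵘ-injective (begin
  ℚ.toℚᵘ (ℕtoℚ (m ℕ.* n))                       ≈⟨ ℕtoℚ-rep (m ℕ.* n) ⟩
  ℚᵘ.mkℚᵘ (ℤ.+ (m ℕ.* n)) 0                       ≈⟨ ℚᵘ.*≡* (cong (ℤ._* ℤ.+ 1) (ℤₚ.pos-* m n)) ⟩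
  ℚᵘ.mkℚᵘ (ℤ.+ m) 0 ℚᵘ.* ℚᵘ.mkℚᵘ (ℤ.+ n) 0           ≈⟨ ℚᵘₚ.*-cong (ℕtoℚ-rep m) (ℕtoℚ-rep n) ⟨
  ℚ.toℚᵘ (ℕtoℚ m) ℚᵘ.* ℚ.toℚᵘ (ℕtoℚ n)           ≈⟨ ℚₚ.toℚᵘ-homo-* (ℕtoℚ m) (ℕtoℚ n) ⟨
  ℚ.toℚᵘ (ℕtoℚ m ℚ.* ℕtoℚ n)                     ∎)
  where open ℚᵘₚ.≃-Reasoning

ℕtoℚ-mono : ∀ {m n} → m ℕ.≤ n → ℕtoℚ m ℚ.≤ ℕtoℚ n
ℕtoℚ-mono {m} {n} m≤n = ℚₚ.toℚᵘ-cancel-≤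
  (ℚᵘₚ.≤-respʳ-≃ (ℚᵘₚ.≃-sym (ℕtoℚ-rep n)) (ℚᵘₚ.≤-respˡ-≃ (ℚᵘₚ.≃-sym (ℕtoℚ-rep m))
    (ℚᵘ.*≤* (ℤₚ.*-monoʳ-≤-nonNeg (ℤ.+ 1) (ℤ.+≤+ m≤n)))))

ℕtoℚ-cancel : ∀ {m n} → ℕtoℚ m ℚ.≤ ℕtoℚ n → m ℕ.≤ n
ℕtoℚ-cancel {m} {n} le with ℚᵘₚ.≤-respʳ-≃ (ℕtoℚ-rep n) (ℚᵘₚ.≤-respˡ-≃ (ℕtoℚ-rep m) (ℚₚ.toℚᵘ-mono-≤ le))
... | ℚᵘ.*≤* le′ = ℤₚ.drop‿+≤+ (ℤₚ.*-cancelʳ-≤-pos (ℤ.+ m) (ℤ.+ n) (ℤ.+ 1) le′)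

ℕtoℚ-nonNeg : ∀ m → ℚ.NonNegative (ℕtoℚ m)
ℕtoℚ-nonNeg m = ℚ.nonNegative {ℕtoℚ m} (ℕtoℚ-mono {0} {m} ℕ.z≤n)

ℕtoℚ-pos : ∀ m → 1 ℕ.≤ m → ℚ.Positive (ℕtoℚ m)
ℕtoℚ-pos m 1≤m = ℚ.positive {ℕtoℚ m} (ℚₚ.<-≤-trans (ℚ.*<* (ℤ.+<+ (ℕ.s≤s ℕ.z≤n))) (ℕtoℚ-mono {1} {m} 1≤m))

module FlowSums {N : ℕ} {E : Rel₂ N} where

  Test : Set
  Test = List (Fin N) → Bool

  passed : List Test → List (Fin N) → ℕ
  passed [] π = 0
  passed (c ∷ cs) π = (if c π then 1 else 0) ℕ.+ passed cs π

  sumAll : List Test → Flow E → ℚ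
  sumAll [] f = 0ℚ
  sumAll (c ∷ cs) f = sumWhere c f ℚ.+ sumAll cs f

  sumAll-∷ : ∀ cs (π : DPath E) w f → sumAll cs ((π , w) ∷ f) ≡ ℕtoℚ (passed cs (verts π)) ℚ.* w ℚ.+ sumAll cs f
  sumAll-∷ [] π w f = sym (trans (ℚₚ.+-identityʳ _) (ℚₚ.*-zeroˡ w))
  sumAll-∷ (c ∷ cs) π w f with c (verts π)
  ... | false = trans (cong (sumWhere c f ℚ.+_) (sumAll-∷ cs π w f))
    (solve 3 (λ a b d → a :+ (b :+ d) := b :+ (a :+ d)) refl (sumWhere c f) (ℕtoℚ (passed cs (verts π)) ℚ.* w) (sumAll cs f))
    where open ℚ-Solver
  ... | true = begin
    (w ℚ.+ S) ℚ.+ sumAll cs ((π , w) ∷ f)          ≡⟨ cong ((w ℚ.+ S) ℚ.+_) (sumAll-∷ cs π w f) ⟩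
    (w ℚ.+ S) ℚ.+ (m ℚ.* w ℚ.+ T)                  ≡⟨ solve 4 (λ w s m t → (w :+ s) :+ (m :* w :+ t) := (con 1ℚ :+ m) :* w :+ (s :+ t)) refl w S m T ⟩
    (1ℚ ℚ.+ m) ℚ.* w ℚ.+ (S ℚ.+ T)                 ≡⟨ cong (λ z → z ℚ.* w ℚ.+ (S ℚ.+ T)) (ℕtoℚ-+ 1 (passed cs (verts π))) ⟨
    ℕtoℚ (suc (passed cs (verts π))) ℚ.* w ℚ.+ (S ℚ.+ T) ∎
    where
    open ≡-Reasoning
    open ℚ-Solver
    S = sumWhere c f
    T = sumAll cs f
    m = ℕtoℚ (passed cs (verts π))

  sumAll-[] : ∀ cs → sumAll cs [] ≡ 0ℚ
  sumAll-[] [] = refl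
  sumAll-[] (c ∷ cs) = trans (ℚₚ.+-identityˡ _) (sumAll-[] cs)

  -- Double counting: by `sumAll-∷` each side is a sum over flow paths of weight times number of
  -- passed tests, so nonnegative weights allow a comparison path by path.
  sumAll-dominated : ∀ D cs ds (f : Flow E) → (∀ x → x ∈ f → 0ℚ ℚ.≤ proj₂ x) →
    (∀ (π : DPath E) → D ℕ.* passed cs (verts π) ℕ.≤ passed ds (verts π)) →
    ℕtoℚ D ℚ.* sumAll cs f ℚ.≤ sumAll ds f
  sumAll-dominated D cs ds [] _ _ =
    ℚₚ.≤-reflexive (trans (cong (ℕtoℚ D ℚ.*_) (sumAll-[] cs)) (trans (ℚₚ.*-zeroʳ (ℕtoℚ D)) (sym (sumAll-[] ds))))
  sumAll-dominated D cs ds ((π , w) ∷ f) nn dom = begin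
    ℕtoℚ D ℚ.* sumAll cs ((π , w) ∷ f)               ≡⟨ cong (ℕtoℚ D ℚ.*_) (sumAll-∷ cs π w f) ⟩
    ℕtoℚ D ℚ.* (ℕtoℚ a ℚ.* w ℚ.+ sumAll cs f)        ≡⟨ solve 4 (λ d a w s → d :* (a :* w :+ s) := (d :* a) :* w :+ d :* s) refl (ℕtoℚ D) (ℕtoℚ a) w (sumAll cs f) ⟩
    (ℕtoℚ D ℚ.* ℕtoℚ a) ℚ.* w ℚ.+ ℕtoℚ D ℚ.* sumAll cs f ≡⟨ cong (λ z → z ℚ.* w ℚ.+ ℕtoℚ D ℚ.* sumAll cs f) (ℕtoℚ-* D a) ⟨
    ℕtoℚ (D ℕ.* a) ℚ.* w ℚ.+ ℕtoℚ D ℚ.* sumAll cs f  ≤⟨ ℚₚ.+-mono-≤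
      (ℚₚ.*-monoʳ-≤-nonNeg w {{ℚ.nonNegative (nn (π , w) (here refl))}} (ℕtoℚ-mono (dom π)))
      (sumAll-dominated D cs ds f (λ x x∈ → nn x (there x∈)) dom) ⟩
    ℕtoℚ (passed ds (verts π)) ℚ.* w ℚ.+ sumAll ds f ≡⟨ sumAll-∷ ds π w f ⟨
    sumAll ds ((π , w) ∷ f)                          ∎
    where
    open ℚₚ.≤-Reasoning
    open ℚ-Solver
    a = passed cs (verts π)

  sumAll-lower : ∀ cs (f : Flow E) q → (∀ {c} → c ∈ cs → q ℚ.≤ sumWhere c f) → ℕtoℚ (length cs) ℚ.* q ℚ.≤ sumAll cs f
  sumAll-lower [] f q _ = ℚₚ.≤-reflexive (ℚₚ.*-zeroˡ q)
  sumAll-lower (c ∷ cs) f q le = begin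
    ℕtoℚ (suc (length cs)) ℚ.* q          ≡⟨ cong (ℚ._* q) (ℕtoℚ-+ 1 (length cs)) ⟩
    (1ℚ ℚ.+ ℕtoℚ (length cs)) ℚ.* q       ≡⟨ solve 2 (λ m q → (con 1ℚ :+ m) :* q := q :+ m :* q) refl (ℕtoℚ (length cs)) q ⟩
    q ℚ.+ ℕtoℚ (length cs) ℚ.* q          ≤⟨ ℚₚ.+-mono-≤ (le (here refl)) (sumAll-lower cs f q (le ∘ there)) ⟩
    sumWhere c f ℚ.+ sumAll cs f          ∎
    where
    open ℚₚ.≤-Reasoning
    open ℚ-Solver

  sumAll-upper : ∀ cs (f : Flow E) → (∀ {c} → c ∈ cs → sumWhere c f ℚ.≤ 1ℚ) → sumAll cs f ℚ.≤ ℕtoℚ (length cs)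
  sumAll-upper [] f _ = ℚₚ.≤-refl
  sumAll-upper (c ∷ cs) f le = begin
    sumWhere c f ℚ.+ sumAll cs f          ≤⟨ ℚₚ.+-mono-≤ (le (here refl)) (sumAll-upper cs f (le ∘ there)) ⟩
    1ℚ ℚ.+ ℕtoℚ (length cs)               ≡⟨ ℕtoℚ-+ 1 (length cs) ⟨
    ℕtoℚ (suc (length cs))                ∎
    where open ℚₚ.≤-Reasoning

-- The levelled network

data Ride {P K s : ℕ} (slot : Fin P → Fin K → Fin s) : List (Fin P) → Fin s → Fin s → Set where
  []   : ∀ {u} → Ride slot [] u u
  hop  : ∀ {is u v w} i {p q} → p Fin.< q → slot i p ≡ u → slot i q ≡ v → Ride slot is v w → Ride slot (i ∷ is) u w

-- `slot i p` is the p-th stop of commodity i; a node of the path system may be split into several slots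
-- in order to bound the load.
record Layout (D P K s : ℕ) : Set where
  field
    slot      : Fin P → Fin K → Fin s
    slot-inj  : ∀ i {p q} → slot i p ≡ slot i q → p ≡ q
    rigid     : ∀ {i p q is} → Ride slot is (slot i p) (slot i q) → All (_≡ i) is
    load      : ∀ v → ∑ P (λ i → ∑ K (λ p → 𝟙 (v Fin.≟ slot i p))) ≤ 8 * D

∑-𝟙-unique : ∀ n {Q : Fin n → Set} (Q? : ∀ i → Dec (Q i)) → (∀ {i j} → Q i → Q j → i ≡ j) → ∑ n (λ i → 𝟙 (Q? i)) ≤ 1
∑-𝟙-unique zero Q? inj = z≤n
∑-𝟙-unique (suc n) {Q} Q? inj with Q? Fin.zero
... | no _ = ∑-𝟙-unique n (Q? ∘ Fin.suc) (λ a b → Finₚ.suc-injective (inj a b))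
... | yes q = s≤s (≤-reflexive (trans (∑-cong n none) (∑-zero n)))
  where
  none : ∀ i → 𝟙 (Q? (Fin.suc i)) ≡ 0
  none i with Q? (Fin.suc i)
  ... | no _ = refl
  ... | yes q′ = case inj q q′ of λ ()

module Network {D P K s : ℕ} .{{nz : NonZero D}} (L : Layout D P K s) (g : ℕ) where
  open Layout L

  Col : Set
  Col = Fin s × Fin g

  _≟ᶜ_ : DecidableEquality Col
  _≟ᶜ_ = ≡-dec Fin._≟_ Fin._≟_

  column : Fin P → Fin K → Fin g → Col
  column i p j = slot i p , j

  column-load : ∀ c → ∑ P (λ i → ∑ K (λ p → ∑ g (λ j → 𝟙 (c ≟ᶜ column i p j)))) ≤ 8 * D
  column-load (v , k) = ≤-trans (∑-mono P λ i → ∑-mono K λ p → one (slot i p)) (load v)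
    where
    one : ∀ u → ∑ g (λ j → 𝟙 ((v , k) ≟ᶜ (u , j))) ≤ 𝟙 (v Fin.≟ u)
    one u = go (v Fin.≟ u)
      where
      none : v ≢ u → ∀ j → 𝟙 ((v , k) ≟ᶜ (u , j)) ≡ 0
      none v≢u j with (v , k) ≟ᶜ (u , j)
      ... | yes eq = ⊥-elim (v≢u (cong proj₁ eq))
      ... | no _ = refl
      go : (d : Dec (v ≡ u)) → ∑ g (λ j → 𝟙 ((v , k) ≟ᶜ (u , j))) ≤ 𝟙 d
      go (yes _) = ∑-𝟙-unique g (λ j → (v , k) ≟ᶜ (u , j)) (λ a b → cong proj₂ (trans (sym a) b))
      go (no v≢u) = ≤-reflexive (trans (∑-cong g (none v≢u)) (∑-zero g))

  open UnionBound D _≟ᶜ_ P K g column column-load public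

  #copies : ℕ
  #copies = s * g * D

  toFin : Copy → Fin #copies
  toFin ((v , j) , e) = combine (combine v j) e

  fromFin : Fin #copies → Copy
  fromFin x = remQuot {s} g (proj₁ (remQuot {s * g} D x)) , proj₂ (remQuot {s * g} D x)

  fromFin-toFin : ∀ z → fromFin (toFin z) ≡ z
  fromFin-toFin ((v , j) , e) = trans
    (cong (λ (y , f) → remQuot {s} g y , f) (Finₚ.remQuot-combine {s * g} {D} (combine v j) e))
    (cong (_, e) (Finₚ.remQuot-combine {s} {g} v j))

  toFin-fromFin : ∀ x → toFin (fromFin x) ≡ x
  toFin-fromFin x = trans
    (cong (λ y → combine y (proj₂ (remQuot {s * g} D x))) (Finₚ.combine-remQuot {s} g (proj₁ (remQuot {s * g} D x))))
    (Finₚ.combine-remQuot {s * g} D x)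

  copies : List Copy
  copies = map fromFin (List.allFin #copies)

  ∈-copies : ∀ z → z ∈ copies
  ∈-copies z = subst (_∈ copies) (fromFin-toFin z) (∈-map⁺ fromFin (∈-allFin (toFin z)))

  -- Splitting a copy into entry and exit turns it into an edge, so that the unit capacity bounds
  -- the flow through the copy and a cut can remove it at cost 1.
  data Vertex : Set where
    entry exit  : Copy → Vertex
    source sink : Fin P → Vertex

  #vertices : ℕ
  #vertices = #copies + (#copies + (P + P))

  number : Vertex → Fin #vertices
  number (entry z)  = toFin z ↑ˡ _
  number (exit z)   = #copies ↑ʳ (toFin z ↑ˡ _)
  number (source i) = #copies ↑ʳ (#copies ↑ʳ (i ↑ˡ P))
  number (sink i)   = #copies ↑ʳ (#copies ↑ʳ (P ↑ʳ i))

  read₃ : Fin P ⊎ Fin P → Vertex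
  read₃ (inj₁ i) = source i
  read₃ (inj₂ i) = sink i

  read₂ : Fin #copies ⊎ Fin (P + P) → Vertex
  read₂ (inj₁ x) = exit (fromFin x)
  read₂ (inj₂ y) = read₃ (splitAt P y)

  read₁ : Fin #copies ⊎ Fin (#copies + (P + P)) → Vertex
  read₁ (inj₁ x) = entry (fromFin x)
  read₁ (inj₂ y) = read₂ (splitAt #copies y)

  vertex : Fin #vertices → Vertex
  vertex x = read₁ (splitAt #copies x)

  vertex-number : ∀ v → vertex (number v) ≡ v
  vertex-number (entry z) rewrite Finₚ.splitAt-↑ˡ #copies (toFin z) (#copies + (P + P)) = cong entry (fromFin-toFin z)
  vertex-number (exit z) rewrite Finₚ.splitAt-↑ʳ #copies (#copies + (P + P)) (toFin z ↑ˡ (P + P))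
                               | Finₚ.splitAt-↑ˡ #copies (toFin z) (P + P) = cong exit (fromFin-toFin z)
  vertex-number (source i) rewrite Finₚ.splitAt-↑ʳ #copies (#copies + (P + P)) (#copies ↑ʳ (i ↑ˡ P))
                                 | Finₚ.splitAt-↑ʳ #copies (P + P) (i ↑ˡ P) | Finₚ.splitAt-↑ˡ P i P = refl
  vertex-number (sink i) rewrite Finₚ.splitAt-↑ʳ #copies (#copies + (P + P)) (#copies ↑ʳ (P ↑ʳ i))
                               | Finₚ.splitAt-↑ʳ #copies (P + P) (P ↑ʳ i) | Finₚ.splitAt-↑ʳ P P i = refl

  number-vertex : ∀ x → number (vertex x) ≡ x
  number-vertex x with splitAt #copies x in eq
  ... | inj₁ y = trans (cong (_↑ˡ _) (toFin-fromFin y)) (Finₚ.splitAt⁻¹-↑ˡ eq)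
  ... | inj₂ y with splitAt #copies y in eq′
  ...   | inj₁ z = trans (cong (λ w → #copies ↑ʳ (w ↑ˡ _)) (toFin-fromFin z))
                         (trans (cong (#copies ↑ʳ_) (Finₚ.splitAt⁻¹-↑ˡ eq′)) (Finₚ.splitAt⁻¹-↑ʳ eq))
  ...   | inj₂ z with splitAt P z in eq″
  ...     | inj₁ i = trans (cong (λ w → #copies ↑ʳ (#copies ↑ʳ w)) (Finₚ.splitAt⁻¹-↑ˡ eq″))
                           (trans (cong (#copies ↑ʳ_) (Finₚ.splitAt⁻¹-↑ʳ eq′)) (Finₚ.splitAt⁻¹-↑ʳ eq))
  ...     | inj₂ i = trans (cong (λ w → #copies ↑ʳ (#copies ↑ʳ w)) (Finₚ.splitAt⁻¹-↑ʳ eq″))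
                           (trans (cong (#copies ↑ʳ_) (Finₚ.splitAt⁻¹-↑ʳ eq′)) (Finₚ.splitAt⁻¹-↑ʳ eq))

  module Graph (h : Vec (Fin D) M) {b : ℕ} (fits : #vertices ≤ b) where

    shift : Fin P → Fin K → Fin g → Fin D
    shift i p j = Vec.lookup h (index i p j)

    -- The copy, in column j, of the p-th stop of commodity i at level t.
    copy : Fin P → Fin K → ℕ → Fin g → Copy
    copy i p t j = (slot i p , j) , rot D t (shift i p j)

    -- A hop belongs to some commodity, but a copy does not remember which one, and its last
    -- coordinate is a level only relative to that commodity's shift. A walk may thus change
    -- commodity wherever copies coincide; `rigid` shows that it can then no longer end at its own
    -- sink.
    Edge : Vertex → Vertex → Set
    Edge (entry z)              (exit z′)                = z ≡ z′
    Edge (source i)             (entry ((v , j) , e))    = ∃ λ p → slot i p ≡ v × rot D 0 (shift i p j) ≡ e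
    Edge (exit ((u , j) , d))   (entry ((v , k) , e))    =
      ∃ λ i → ∃ λ p → ∃ λ q → ∃ λ (t : Fin D) → p Fin.< q × suc (toℕ t) < D ×
        slot i p ≡ u × rot D (toℕ t) (shift i p j) ≡ d ×
        slot i q ≡ v × rot D (suc (toℕ t)) (shift i q k) ≡ e
    Edge (exit ((v , j) , e))   (sink i)                 = ∃ λ p → slot i p ≡ v × rot D (D ∸ 1) (shift i p j) ≡ e
    Edge _                      _                        = ⊥

    edge? : ∀ x y → Dec (Edge x y)
    edge? (entry z)            (exit z′)             = z ≟ᵏ z′
    edge? (source i)           (entry ((v , j) , e)) = Finₚ.any? λ p → (slot i p Fin.≟ v) ×-dec (rot D 0 (shift i p j) Fin.≟ e)
    edge? (exit ((u , j) , d)) (entry ((v , k) , e)) =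
      Finₚ.any? λ i → Finₚ.any? λ p → Finₚ.any? λ q → Finₚ.any? λ t →
        (p Finₚ.<? q) ×-dec (suc (toℕ t) <? D) ×-dec
        (slot i p Fin.≟ u) ×-dec (rot D (toℕ t) (shift i p j) Fin.≟ d) ×-dec
        (slot i q Fin.≟ v) ×-dec (rot D (suc (toℕ t)) (shift i q k) Fin.≟ e)
    edge? (exit ((v , j) , e)) (sink i)              = Finₚ.any? λ p → (slot i p Fin.≟ v) ×-dec (rot D (D ∸ 1) (shift i p j) Fin.≟ e)
    edge? (entry _)  (entry _)  = no λ ()
    edge? (entry _)  (source _) = no λ ()
    edge? (entry _)  (sink _)   = no λ ()
    edge? (exit _)   (exit _)   = no λ ()
    edge? (exit _)   (source _) = no λ ()
    edge? (source _) (exit _)   = no λ ()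
    edge? (source _) (source _) = no λ ()
    edge? (source _) (sink _)   = no λ ()
    edge? (sink _)   _          = no λ ()

    -- The network sits on the first `#vertices` of the `b` vertices; the remaining ones are
    -- isolated and read as `nothing`.
    at : Vertex → Fin b
    at v = inject≤ (number v) fits

    what : Fin b → Maybe Vertex
    what u with toℕ u <? #vertices
    ... | yes lt = just (vertex (fromℕ< lt))
    ... | no _ = nothing

    what-at : ∀ v → what (at v) ≡ just v
    what-at v with toℕ (at v) <? #vertices
    ... | yes lt = cong just (trans (cong vertex (trans (Finₚ.fromℕ<-cong _ _ (Finₚ.toℕ-inject≤ (number v) fits) lt (Finₚ.toℕ<n (number v)))
                                                       (Finₚ.fromℕ<-toℕ (number v) _))) (vertex-number v))
    ... | no ge = ⊥-elim (ge (subst (_< #vertices) (sym (Finₚ.toℕ-inject≤ (number v) fits)) (Finₚ.toℕ<n (number v))))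

    at-what : ∀ {u v} → what u ≡ just v → u ≡ at v
    at-what {u} eq with toℕ u <? #vertices
    at-what {u} refl | yes lt = Finₚ.toℕ-injective (sym (trans (Finₚ.toℕ-inject≤ _ fits)
      (trans (cong toℕ (number-vertex (fromℕ< lt))) (Finₚ.toℕ-fromℕ< lt))))

    at-injective : ∀ {v w} → at v ≡ at w → v ≡ w
    at-injective {v} {w} eq = just-injective (trans (sym (what-at v)) (trans (cong what eq) (what-at w)))

    joined : Maybe Vertex → Maybe Vertex → Bool
    joined (just x) (just y) = does (edge? x y)
    joined _ _ = false

    demanded : Maybe Vertex → Maybe Vertex → Bool
    demanded (just (source i)) (just (sink j)) = does (i Fin.≟ j)
    demanded _ _ = false

    E Pairs : Rel₂ b
    E u v = joined (what u) (what v)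
    Pairs u v = demanded (what u) (what v)

    E⁺ : ∀ {x y} → Edge x y → E (at x) (at y) ≡ true
    E⁺ {x} {y} e rewrite what-at x | what-at y with edge? x y
    ... | yes _ = refl
    ... | no ne = ⊥-elim (ne e)

    E⁻ : ∀ {x v} → E (at x) v ≡ true → ∃ λ y → v ≡ at y × Edge x y
    E⁻ {x} {v} eq rewrite what-at x with what v in eqv
    ... | just y with edge? x y
    ...   | yes e = y , at-what eqv , e

    Pairs⁺ : ∀ i → Pairs (at (source i)) (at (sink i)) ≡ true
    Pairs⁺ i rewrite what-at (source i) | what-at (sink i) with i Fin.≟ i
    ... | yes _ = refl
    ... | no ne = ⊥-elim (ne refl)

    Pairs⁻ : ∀ {u v} → Pairs u v ≡ true → ∃ λ i → u ≡ at (source i) × v ≡ at (sink i)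
    Pairs⁻ {u} {v} eq with what u in equ | what v in eqv
    ... | just (source i) | just (sink j) with i Fin.≟ j
    ...   | yes refl = i , at-what equ , at-what eqv

-- The upper bound for concurrent flows

does⁻ : {A : Set} (d : Dec A) → does d ≡ true → A
does⁻ (yes a) _ = a

uses-here : ∀ {N} {x y : Fin N} {ys} → usesEdge (x ∷ y ∷ ys) x y ≡ true
uses-here {x = x} {y} rewrite dec-true (x Fin.≟ x) refl | dec-true (y Fin.≟ y) refl = refl

uses-there : ∀ {N} {x y u v : Fin N} {ys} → usesEdge (y ∷ ys) u v ≡ true → usesEdge (x ∷ y ∷ ys) u v ≡ true
uses-there {x = x} {y} {u} {v} eq with x Fin.≟ u | y Fin.≟ v
... | no _  | _ = eq
... | yes _ | yes _ = refl
... | yes _ | no _ = eq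

walk-tail : ∀ {N} {E : Rel₂ N} {x y ys} → Walk E (x ∷ y ∷ ys) → E x y ≡ true × Walk E (y ∷ ys)
walk-tail (cons _ _ _ e w) = e , w

passed-map : ∀ {N} {E : Rel₂ N} {A : Set} (t : A → List (Fin N) → Bool) (xs : List A) π →
             FlowSums.passed {E = E} (map t xs) π ≡ sum (map (λ x → 𝟙 (t x π Boolₚ.≟ true)) xs)
passed-map t [] π = refl
passed-map {E = E} t (x ∷ xs) π with t x π
... | true = cong suc (passed-map {E = E} t xs π)
... | false = passed-map {E = E} t xs π

module FlowBound {D P K s : ℕ} .{{nz : NonZero D}} (L : Layout D P K s) (g : ℕ)
                 (h : Vec (Fin D) (UnionBound.M D (Network._≟ᶜ_ L g) P K g (Network.column L g) (Network.column-load L g)))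
                 {b : ℕ} (fits : Network.#vertices L g ≤ b) where
  open Layout L
  open Network L g
  open Graph h fits

  data Course (i : Fin P) : Copy → List Copy → Set where
    stop : ∀ {z} → Edge (exit z) (sink i) → Course i z []
    next : ∀ {z z′ zs} → Edge (exit z) (entry z′) → Course i z′ zs → Course i z (z′ ∷ zs)

  course⇒ride : ∀ {i z zs} → Course i z zs → ∃₂ λ is q → Ride slot is (proj₁ (proj₁ z)) (slot i q)
  course⇒ride {z = ((v , j) , e)} (stop (p , refl , _)) = [] , p , []
  course⇒ride (next (i , p , q , t , p<q , _ , eu , _ , ev , _) c) with course⇒ride c
  ... | is , r , ride = i ∷ is , r , hop i p<q eu ev ride

  -- The rest of the course ends at a stop of `i`, so `rigid` identifies the commodity of the next
  -- hop with `i`. Then `slot-inj` recovers the stop, hence the shift, and `rot-level` the level: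
  -- every hop climbs exactly one level, and the sink is entered from level `D ∸ 1`.
  course-length : ∀ {i p t j zs} → t < D → Course i (copy i p t j) zs → t + length zs ≡ D ∸ 1
  course-length {i} {p} {t} {j} t<D (stop (q , eq , lvl)) with slot-inj i eq
  ... | refl = trans (+-identityʳ t) (sym (rot-level D (shift i p j) (≤-reflexive (m+[n∸m]≡n (>-nonZero⁻¹ D))) t<D lvl))
  course-length {i} {p} {t} {j} t<D (next {zs = zs} (i′ , p′ , q , t′ , p<q , st′<D , eu , lu , refl , refl) c)
    with course⇒ride c
  ... | is , r , ride with rigid (hop i′ p<q eu refl ride)
  ...   | refl ∷ _ with slot-inj i eu
  ...     | refl with rot-level D (shift i p j) (Finₚ.toℕ<n t′) t<D lu
  ...       | refl = trans (+-suc t (length zs)) (course-length st′<D c)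

  uses : Copy → List (Fin b) → Bool
  uses z π = usesEdge π (at (entry z)) (at (exit z))

  uses-own : ∀ a z vs → uses z (a ∷ at (entry z) ∷ at (exit z) ∷ vs) ≡ true
  uses-own a z vs = uses-there {x = a} {at (entry z)} {at (entry z)} {at (exit z)} {at (exit z) ∷ vs}
    (uses-here {x = at (entry z)} {at (exit z)} {vs})

  uses-later : ∀ a z vs {y} → uses y (at (exit z) ∷ vs) ≡ true → uses y (a ∷ at (entry z) ∷ at (exit z) ∷ vs) ≡ true
  uses-later a z vs {y} eq = uses-there {x = a} {at (entry z)} {at (entry y)} {at (exit y)} {at (exit z) ∷ vs}
    (uses-there {x = at (entry z)} {at (exit z)} {at (entry y)} {at (exit y)} {vs} eq)

  -- `entries` is what transfers the simplicity of the path to the list of copies and so yields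
  -- `stops!`.
  record Trace (i : Fin P) (z : Copy) (vs : List (Fin b)) : Set where
    field
      {stops}  : List Copy
      course   : Course i z stops
      used     : All (λ y → uses y (at (exit z) ∷ vs) ≡ true) stops
      entries  : All (λ y → at (entry y) ∈ vs) stops
      stops!   : Unique stops

  trace : ∀ {i z} vs → Walk E (at (exit z) ∷ vs) → Unique vs → lastIs (at (exit z) ∷ vs) (at (sink i)) ≡ true → Trace i z vs
  trace {i} {z} [] w u last = ⊥-elim (absurd (at-injective {exit z} {sink i} (does⁻ (at (exit z) Fin.≟ at (sink i)) last)))
    where
    absurd : exit z ≢ sink i
    absurd ()
  trace {i} {z} (v ∷ vs) w u last with E⁻ {exit z} (proj₁ (walk-tail w))
  trace {i} {z} (v ∷ []) w u last | sink i′ , refl , e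
    with at-injective {sink i′} {sink i} (does⁻ (at (sink i′) Fin.≟ at (sink i)) last)
  ... | refl = record { course = stop e ; used = [] ; entries = [] ; stops! = [] }
  trace (v ∷ v′ ∷ vs) w u last | sink i′ , refl , e with E⁻ {sink i′} (proj₁ (walk-tail (proj₂ (walk-tail w))))
  ... | _ , _ , ()
  trace {i} {z} (v ∷ []) w u last | entry y , refl , e =
    ⊥-elim (absurd (at-injective {entry y} {sink i} (does⁻ (at (entry y) Fin.≟ at (sink i)) last)))
    where
    absurd : entry y ≢ sink i
    absurd ()
  trace {i} {z} (v ∷ v′ ∷ vs) w (y∉ ∷ _ ∷ u) last | entry y , refl , e
    with E⁻ {entry y} (proj₁ (walk-tail (proj₂ (walk-tail w))))
  ... | exit .y , refl , refl with trace {i} {y} vs (proj₂ (walk-tail (proj₂ (walk-tail w)))) u last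
  ...   | T = record
    { course = next e (T .course)
    ; used = uses-own (at (exit z)) y vs ∷ All.map (λ {x} → uses-later (at (exit z)) y vs {x}) (T .used)
    ; entries = here refl ∷ All.map (there ∘ there) (T .entries)
    ; stops! = Allₚ.¬Any⇒All¬ _ (λ y∈ → All.lookup y∉ (there (All.lookup (T .entries) y∈)) refl) ∷ T .stops! }
    where open Trace

  test : Fin P → List (Fin b) → Bool
  test i π = if startIs π (at (source i)) then lastIs π (at (sink i)) else false

  test⁻ : ∀ i {π} → test i π ≡ true → (∃ λ π′ → π ≡ at (source i) ∷ π′) × lastIs π (at (sink i)) ≡ true
  test⁻ i {x ∷ π} eq with x Fin.≟ at (source i)
  ... | yes refl = (π , refl) , eq

  long-enough : ∀ i (π : DPath E) → test i (verts π) ≡ true →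
    ∃ λ zs → Unique zs × length zs ≡ D × All (λ z → uses z (verts π) ≡ true) zs
  long-enough i record { verts = vs ; walk = w ; simple = u } eq with test⁻ i {vs} eq
  long-enough i record { verts = _ ; walk = w ; simple = u } eq | ([] , refl) , last =
    ⊥-elim (absurd (at-injective {source i} {sink i} (does⁻ (at (source i) Fin.≟ at (sink i)) last)))
    where
    absurd : source i ≢ sink i
    absurd ()
  long-enough i record { verts = _ ; walk = w ; simple = u } eq | (v ∷ vs , refl) , last with E⁻ {source i} (proj₁ (walk-tail w))
  long-enough i record { verts = _ ; walk = w ; simple = u } eq | (v ∷ [] , refl) , last | entry y , refl , e =
    ⊥-elim (absurd (at-injective {entry y} {sink i} (does⁻ (at (entry y) Fin.≟ at (sink i)) last)))
    where
    absurd : entry y ≢ sink i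
    absurd ()
  long-enough i record { verts = _ ; walk = w ; simple = (_ ∷ y∉ ∷ _ ∷ u) } eq | (v ∷ v′ ∷ vs , refl) , last
    | entry y , refl , (p , refl , refl) with E⁻ {entry y} (proj₁ (walk-tail (proj₂ (walk-tail w))))
  ... | exit .y , refl , refl with trace {i} {y} vs (proj₂ (walk-tail (proj₂ (walk-tail w)))) u last
  ...   | T = y ∷ stops ,
      (Allₚ.¬Any⇒All¬ _ (λ y∈ → All.lookup y∉ (there (All.lookup entries y∈)) refl) ∷ stops!) ,
      trans (cong suc (course-length (>-nonZero⁻¹ D) course)) (m+[n∸m]≡n (>-nonZero⁻¹ D)) ,
      uses-own (at (source i)) y vs ∷ All.map (λ {x} → uses-later (at (source i)) y vs {x}) used
    where open Trace T

  source-injective : ∀ {i j} → source i ≡ source j → i ≡ j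
  source-injective refl = refl

  open FlowSums {b} {E}

  tests : List Test
  tests = map test (List.allFin P)

  usages : List Test
  usages = map uses copies

  -- The first vertex of a path determines its commodity, so at most one test is passed, and a path
  -- that passes one uses `D` distinct copies.
  dominated : ∀ (π : DPath E) → D * passed tests (verts π) ≤ passed usages (verts π)
  dominated π with Finₚ.any? (λ i → test i (verts π) Boolₚ.≟ true)
  ... | no none = ≤-trans (≤-reflexive (trans (cong (D *_) zero-passed) (*-zeroʳ D))) z≤n
    where
    zero-passed : passed tests (verts π) ≡ 0
    zero-passed = trans (passed-map {E = E} test (List.allFin P) (verts π)) (trans (sum-allFin P _) (trans (∑-cong P each) (∑-zero P)))
      where
      each : ∀ i → 𝟙 (test i (verts π) Boolₚ.≟ true) ≡ 0
      each i with test i (verts π) Boolₚ.≟ true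
      ... | yes eq = ⊥-elim (none (i , eq))
      ... | no _ = refl
  ... | yes (i , eq) with long-enough i π eq
  ...   | zs , zs! , len , all = begin
    D * passed tests (verts π)    ≤⟨ *-monoʳ-≤ D at-most-one ⟩
    D * 1                         ≡⟨ *-identityʳ D ⟩
    D                             ≡⟨ len ⟨
    length zs                     ≤⟨ unique-⊆-length zs! (λ {z} z∈ → ∈-filter⁺ used? (∈-copies z) (All.lookup all z∈)) ⟩
    length (filter used? copies)  ≡⟨ length-filter-sum used? copies ⟩
    sum (map (λ z → 𝟙 (used? z)) copies) ≡⟨ passed-map {E = E} uses copies (verts π) ⟨
    passed usages (verts π)       ∎
    where
    open ≤-Reasoning
    used? : (z : Copy) → Dec (uses z (verts π) ≡ true)
    used? z = uses z (verts π) Boolₚ.≟ true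
    same : ∀ {i j} → test i (verts π) ≡ true → test j (verts π) ≡ true → i ≡ j
    same {i} {j} a c with test⁻ i {verts π} a | test⁻ j {verts π} c
    ... | (_ , e) , _ | (_ , e′) , _ =
      source-injective (at-injective {source i} {source j} (∷-injectiveˡ (trans (sym e) e′)))
    at-most-one : passed tests (verts π) ≤ 1
    at-most-one = ≤-trans (≤-reflexive (trans (passed-map {E = E} test (List.allFin P) (verts π)) (sum-allFin P _)))
      (∑-𝟙-unique P (λ i → test i (verts π) Boolₚ.≟ true) same)

  -- Each of the `P` commodities sends `q` units through `D` copies, and the `s * g * D` copies have
  -- capacity 1.
  flow-value : 1 ≤ P → s ≤ 2 * P → ∀ f q → FeasibleFlow E Pairs f q → q ℚ.≤ ℕtoℚ (2 * g)
  flow-value P≥1 s≤ f q (nn , demand , cap) = ℚₚ.*-cancelˡ-≤-pos (ℕtoℚ (D * P)) {{ℕtoℚ-pos (D * P) (*-mono-≤ (>-nonZero⁻¹ D) P≥1)}} (begin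
    ℕtoℚ (D * P) ℚ.* q                  ≡⟨ cong (ℚ._* q) (ℕtoℚ-* D P) ⟩
    (ℕtoℚ D ℚ.* ℕtoℚ P) ℚ.* q           ≡⟨ ℚₚ.*-assoc (ℕtoℚ D) (ℕtoℚ P) q ⟩
    ℕtoℚ D ℚ.* (ℕtoℚ P ℚ.* q)           ≡⟨ cong (λ n → ℕtoℚ D ℚ.* (ℕtoℚ n ℚ.* q)) (trans (length-map test (List.allFin P)) (length-tabulate {n = P} id)) ⟨
    ℕtoℚ D ℚ.* (ℕtoℚ (length tests) ℚ.* q) ≤⟨ ℚₚ.*-monoˡ-≤-nonNeg (ℕtoℚ D) {{ℕtoℚ-nonNeg D}} (sumAll-lower tests f q supply) ⟩
    ℕtoℚ D ℚ.* sumAll tests f           ≤⟨ sumAll-dominated D tests usages f nn dominated ⟩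
    sumAll usages f                     ≤⟨ sumAll-upper usages f capacity ⟩
    ℕtoℚ (length usages)                ≡⟨ cong ℕtoℚ (trans (length-map uses copies) (trans (length-map fromFin (List.allFin #copies)) (length-tabulate {n = #copies} id))) ⟩
    ℕtoℚ (s * g * D)                    ≤⟨ ℕtoℚ-mono (*-monoˡ-≤ D (*-monoˡ-≤ g s≤)) ⟩
    ℕtoℚ (2 * P * g * D)                ≡⟨ cong ℕtoℚ (solve 3 (λ p g d → con 2 :* p :* g :* d := d :* p :* (con 2 :* g)) refl P g D) ⟩
    ℕtoℚ (D * P * (2 * g))              ≡⟨ ℕtoℚ-* (D * P) (2 * g) ⟩
    ℕtoℚ (D * P) ℚ.* ℕtoℚ (2 * g)       ∎)
    where
    open ℚₚ.≤-Reasoning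
    open +-*-Solver
    supply : ∀ {c} → c ∈ tests → q ℚ.≤ sumWhere c f
    supply c∈ with ∈-map⁻ test c∈
    ... | i , _ , refl = demand (at (source i)) (at (sink i)) (Pairs⁺ i)
    capacity : ∀ {c} → c ∈ usages → sumWhere c f ℚ.≤ ℚ.1ℚ
    capacity c∈ with ∈-map⁻ uses c∈
    ... | z , _ , refl = cap (at (entry z)) (at (exit z)) (E⁺ {entry z} {exit z} refl)

-- The lower bound for cuts

∈-mapMaybe : {A B : Set} (f : A → Maybe B) {ys : List A} {x : B} {y : A} → y ∈ ys → f y ≡ just x → x ∈ mapMaybe f ys
∈-mapMaybe f {y ∷ ys} (here refl) eq rewrite eq = here refl
∈-mapMaybe f {y ∷ ys} (there y∈) eq with f y
... | just _ = there (∈-mapMaybe f y∈ eq)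
... | nothing = ∈-mapMaybe f y∈ eq

count⁺ : ∀ {N} (R : Rel₂ N) {A : Set} (f : Fin N × Fin N → Maybe A) {xs : List A} → Unique xs →
         (∀ {x} → x ∈ xs → ∃₂ λ u v → R u v ≡ true × f (u , v) ≡ just x) → length xs ≤ count R
count⁺ {N} R f {xs} xs! pre = ≤-trans (unique-⊆-length xs! inside) (length-mapMaybe f chosen)
  where
  chosen = List.filterᵇ (λ uv → R (proj₁ uv) (proj₂ uv)) (cartesianProduct (List.allFin N) (List.allFin N))
  inside : ∀ {x} → x ∈ xs → x ∈ mapMaybe f chosen
  inside x∈ with pre x∈
  ... | u , v , r , eq = ∈-mapMaybe f (∈-filter⁺ (λ uv → Boolₚ.T? (R (proj₁ uv) (proj₂ uv)))
                           (∈-cartesianProduct⁺ (∈-allFin u) (∈-allFin v)) (Equivalence.from Boolₚ.T-≡ r)) eq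

count⁻ : ∀ {N} (R : Rel₂ N) (ys : List (Fin N × Fin N)) → (∀ {u v} → R u v ≡ true → (u , v) ∈ ys) → count R ≤ length ys
count⁻ {N} R ys cover = unique-⊆-length
  (Uniqueₚ.filter⁺ (λ uv → Boolₚ.T? (R (proj₁ uv) (proj₂ uv))) (Uniqueₚ.cartesianProduct⁺ (Uniqueₚ.allFin⁺ N) (Uniqueₚ.allFin⁺ N)))
  λ {uv} uv∈ → cover (Equivalence.to Boolₚ.T-≡ (proj₂ (∈-filter⁻ (λ uv → Boolₚ.T? (R (proj₁ uv) (proj₂ uv)))
                                       {xs = cartesianProduct (List.allFin N) (List.allFin N)} uv∈)))

minus⁺ : ∀ {N} {E E′ : Rel₂ N} {u v} → E u v ≡ true → E′ u v ≡ false → minus E E′ u v ≡ true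
minus⁺ e e′ rewrite e′ = e

minus-self : ∀ {N} (E : Rel₂ N) u v → minus E E u v ≢ true
minus-self E u v with E u v
... | true = λ ()
... | false = λ ()

rescale : ∀ m r k g y D → 2 * m ≤ 7 * r → r * k ≤ D → m * (k * (2 * g) * y) ≤ 7 * D * g * y
rescale m r k g y D 2m≤7r rk≤D = begin
  m * (k * (2 * g) * y)     ≡⟨ solve 4 (λ m k g y → m :* (k :* (con 2 :* g) :* y) := con 2 :* m :* (k :* (g :* y))) refl m k g y ⟩
  2 * m * (k * (g * y))     ≤⟨ *-monoˡ-≤ (k * (g * y)) 2m≤7r ⟩
  7 * r * (k * (g * y))     ≡⟨ solve 4 (λ r k g y → con 7 :* r :* (k :* (g :* y)) := con 7 :* (r :* k) :* g :* y) refl r k g y ⟩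
  7 * (r * k) * g * y       ≤⟨ *-monoˡ-≤ y (*-monoˡ-≤ g (*-monoʳ-≤ 7 rk≤D)) ⟩
  7 * D * g * y             ∎
  where
  open ≤-Reasoning
  open +-*-Solver

module CutBound {D P s : ℕ} .{{nz : NonZero D}} (L : Layout D P (8 * D) s) (g : ℕ)
                (h : Vec (Fin D) (UnionBound.M D (Network._≟ᶜ_ L g) P (8 * D) g (Network.column L g) (Network.column-load L g)))
                {b : ℕ} (fits : Network.#vertices L g ≤ b) where
  open Layout L
  open Network L g
  open Graph h fits

  -- Every edge is charged to a single copy, a hop to the copy that it enters. Therefore different
  -- cut copies account for different cut edges.
  element : Maybe Vertex → Maybe Vertex → Maybe Copy
  element (just _) (just (entry z)) = just z
  element (just (entry z)) (just (exit _)) = just z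
  element (just (exit z)) (just (sink _)) = just z
  element _ _ = nothing

  module _ (E′ Dm : Rel₂ b) (isD : IsDisconnectedSet E Pairs E′ Dm) where

    Cut : Copy → Set
    Cut z = ∃₂ λ u v → E′ u v ≡ true × element (what u) (what v) ≡ just z

    cut-entry : ∀ x z → E′ (at x) (at (entry z)) ≡ true → Cut z
    cut-entry x z eq = at x , at (entry z) , eq , cong₂ element (what-at x) (what-at (entry z))

    cut-inner : ∀ z → E′ (at (entry z)) (at (exit z)) ≡ true → Cut z
    cut-inner z eq = at (entry z) , at (exit z) , eq , cong₂ element (what-at (entry z)) (what-at (exit z))

    cut-exit : ∀ z i → E′ (at (exit z)) (at (sink i)) ≡ true → Cut z
    cut-exit z i eq = at (exit z) , at (sink i) , eq , cong₂ element (what-at (exit z)) (what-at (sink i))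

    -- The edge to the sink is included on every level. On the top level an open copy then leads to
    -- the sink, and on each level a copy that is not open is charged with a pair of `E′`.
    Open : Fin P → Vertex → Copy → Set
    Open i x z = E′ (at x) (at (entry z)) ≡ false × E′ (at (entry z)) (at (exit z)) ≡ false × E′ (at (exit z)) (at (sink i)) ≡ false

    open? : ∀ i x z → Dec (Open i x z)
    open? i x z = (E′ (at x) (at (entry z)) Boolₚ.≟ false) ×-dec (E′ (at (entry z)) (at (exit z)) Boolₚ.≟ false) ×-dec
                  (E′ (at (exit z)) (at (sink i)) Boolₚ.≟ false)

    closed⇒cut : ∀ i x z → ¬ Open i x z → Cut z
    closed⇒cut i x z ¬open with E′ (at x) (at (entry z)) in e₁ | E′ (at (entry z)) (at (exit z)) in e₂ | E′ (at (exit z)) (at (sink i)) in e₃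
    ... | true | _ | _ = cut-entry x z e₁
    ... | false | true | _ = cut-inner z e₂
    ... | false | false | true = cut-exit z i e₃
    ... | false | false | false = ⊥-elim (¬open (refl , refl , refl))

    Residual : Fin P → Vertex → Set
    Residual i x = Reach (minus E E′) (at (source i)) (at x)

    -- A walker follows commodity i stop by stop and moves up one level whenever some column is open;
    -- the columns of the stops where it does not move up are all cut.
    greedy : ∀ i m (f : Fin m → Fin (8 * D)) → (∀ {x y} → x Fin.< y → f x Fin.< f y) → ∀ t x → t < D →
             Residual i x → (∀ a j → Edge x (entry (copy i (f a) t j))) → ¬ Residual i (sink i) →
             ∃ λ (row : Vec Bool m) → t + falses row < D ×
               (∀ a → Vec.lookup row a ≡ true → ∀ j → Cut (copy i (f a) (t + falsesBefore row a) j))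
    greedy i zero f mono t x t<D r ready dis = [] , subst (_< D) (sym (+-identityʳ t)) t<D , λ ()
    greedy i (suc m) f mono t x t<D r ready dis with Finₚ.any? (λ j → open? i x (copy i (f Fin.zero) t j))
    ... | no none with greedy i m (f ∘ Fin.suc) (mono ∘ s≤s) t x t<D r (ready ∘ Fin.suc) dis
    ...   | row , lt , cuts = true ∷ row , lt , λ where
              Fin.zero _ j → subst (λ u → Cut (copy i (f Fin.zero) u j)) (sym (+-identityʳ t))
                               (closed⇒cut i x (copy i (f Fin.zero) t j) λ o → none (j , o))
              (Fin.suc a) eq j → cuts a eq j
    greedy i (suc m) f mono t x t<D r ready dis | yes (j , o₁ , o₂ , o₃) with suc t <? D
    -- On the top level an open copy would connect the commodity to its sink; so a severed commodity
    -- moves up fewer than `D` times.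
    ... | no ≮ = ⊥-elim (dis (step r′ (minus⁺ {E = E} {E′} (E⁺ {exit z} {sink i} (f Fin.zero , refl ,
                   cong (λ k → rot D k (shift i (f Fin.zero) j)) top)) o₃)))
      where
      z = copy i (f Fin.zero) t j
      top : D ∸ 1 ≡ t
      top = cong (_∸ 1) (≤-antisym (≮⇒≥ ≮) t<D)
      r′ : Residual i (exit z)
      r′ = step (step r (minus⁺ {E = E} {E′} (E⁺ {x} {entry z} (ready Fin.zero j)) o₁)) (minus⁺ {E = E} {E′} (E⁺ {entry z} {exit z} refl) o₂)
    ... | yes st<D with greedy i m (f ∘ Fin.suc) (mono ∘ s≤s) (suc t) (exit z) st<D r′ ready′ dis
      where
      z = copy i (f Fin.zero) t j
      r′ : Residual i (exit z)
      r′ = step (step r (minus⁺ {E = E} {E′} (E⁺ {x} {entry z} (ready Fin.zero j)) o₁)) (minus⁺ {E = E} {E′} (E⁺ {entry z} {exit z} refl) o₂)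
      ready′ : ∀ a k → Edge (exit z) (entry (copy i (f (Fin.suc a)) (suc t) k))
      ready′ a k = i , f Fin.zero , f (Fin.suc a) , fromℕ< t<D , mono (s≤s z≤n) ,
        subst (λ u → suc u < D) (sym (Finₚ.toℕ-fromℕ< t<D)) st<D , refl ,
        cong (λ u → rot D u (shift i (f Fin.zero) j)) (Finₚ.toℕ-fromℕ< t<D) , refl ,
        cong (λ u → rot D (suc u) (shift i (f (Fin.suc a)) k)) (Finₚ.toℕ-fromℕ< t<D)
    ...   | row , lt , cuts = false ∷ row , subst (_< D) (sym (+-suc t (falses row))) lt , λ where
              (Fin.suc a) eq k → subst (λ u → Cut (copy i (f (Fin.suc a)) u k)) (sym (+-suc t (falsesBefore row a))) (cuts a eq k)

    severed : Fin P → Bool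
    severed i = Dm (at (source i)) (at (sink i))

    Row : Fin P → Vec Bool (8 * D) → Set
    Row i row = (trues row ≡ 0 ⊎ 7 * D ≤ trues row) × bit (severed i) * (7 * D) ≤ trues row ×
                (∀ p → Vec.lookup row p ≡ true → ∀ j → Cut (copy i p (falsesBefore row p) j))

    row-for : ∀ i → ∃ (Row i)
    row-for i with severed i in eq
    ... | false = quiet , inj₁ (trues-replicate (8 * D)) , z≤n ,
                  λ p e → case-false (trans (sym e) (lookup-replicate p false))
      where
      case-false : ∀ {A : Set} → true ≡ false → A
      case-false ()
    ... | true with greedy i (8 * D) id id 0 (source i) (>-nonZero⁻¹ D) Defs.here
                      (λ p j → p , refl , refl) (proj₂ (proj₁ (isD _ _) eq))
    ...   | row , lt , cuts = row , inj₂ many , ≤-trans (≤-reflexive (+-identityʳ (7 * D))) many , cuts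
      where
      -- Fewer than `D` of the `8 * D` stops are unmarked.
      many : 7 * D ≤ trues row
      many = +-cancelʳ-≤ D (7 * D) (trues row) (begin
        7 * D + D                ≡⟨ +-comm (7 * D) D ⟩
        8 * D                    ≡⟨ trues+falses row ⟨
        trues row + falses row   ≤⟨ +-monoʳ-≤ (trues row) (<⇒≤ lt) ⟩
        trues row + D            ∎)
        where open ≤-Reasoning

    code : Code
    code = Vec.tabulate (proj₁ ∘ row-for)

    code-row : ∀ i → Row i (Vec.lookup code i)
    code-row i = subst (Row i) (sym (lookup∘tabulate (proj₁ ∘ row-for) i)) (proj₂ (row-for i))

    ask⁻ : ∀ row p c {d t} → ask row p c ≡ just (d , t) → Vec.lookup row p ≡ true × c ≡ d × falsesBefore row p ≡ t
    ask⁻ row p c eq with Vec.lookup row p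
    ask⁻ row p c refl | true = refl , refl , refl

    served-cut : ∀ {z} → z ∈ served M (request code) h [] → Cut z
    served-cut z∈ with served⁻ M (request code) h z∈
    ... | inj₂ (x , c , t , eq , refl) =
      let (i , y) = remQuot {P} (8 * D * g) x
          (p , j) = remQuot {8 * D} g y
          (e , e₁ , e₂) = ask⁻ (Vec.lookup code i) p (column i p j) eq
          ix : index i p j ≡ x
          ix = trans (cong (combine i) (Finₚ.combine-remQuot {8 * D} g y)) (Finₚ.combine-remQuot {P} (8 * D * g) x)
      in subst Cut (cong₂ _,_ e₁ (cong₂ (rot D) e₂ (cong (Vec.lookup h) ix))) (proj₂ (proj₂ (code-row i)) p e j)

    served≤cut : length (served M (request code) h []) ≤ count E′
    served≤cut = count⁺ E′ (λ (u , v) → element (what u) (what v)) (served-unique M (request code) h []) served-cut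

    severed-total : count Dm ≤ ∑ P (bit ∘ severed)
    severed-total = begin
      count Dm                                    ≤⟨ count⁻ Dm pairs cover ⟩
      length pairs                                ≡⟨ length-map _ (filter cut? (List.allFin P)) ⟩
      length (filter cut? (List.allFin P))        ≡⟨ length-filter-sum cut? (List.allFin P) ⟩
      sum (map (λ i → 𝟙 (cut? i)) (List.allFin P)) ≡⟨ sum-allFin P _ ⟩
      ∑ P (λ i → 𝟙 (cut? i))                      ≡⟨ ∑-cong P (λ i → same (severed i)) ⟩
      ∑ P (bit ∘ severed)                         ∎
      where
      open ≤-Reasoning
      cut? : ∀ i → Dec (severed i ≡ true)
      cut? i = severed i Boolₚ.≟ true
      pairs : List (Fin b × Fin b)
      pairs = map (λ i → at (source i) , at (sink i)) (filter cut? (List.allFin P))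
      same : ∀ c → 𝟙 (c Boolₚ.≟ true) ≡ bit c
      same true = refl
      same false = refl
      cover : ∀ {u v} → Dm u v ≡ true → (u , v) ∈ pairs
      cover {u} {v} d with Pairs⁻ {u} {v} (proj₁ (proj₁ (isD u v) d))
      ... | i , refl , refl = ∈-map⁺ (λ i → at (source i) , at (sink i)) (∈-filter⁺ cut? (∈-allFin i) d)

    requested : 7 * D * g * count Dm ≤ actives M (request code)
    requested = begin
      7 * D * g * count Dm                         ≤⟨ *-monoʳ-≤ (7 * D * g) severed-total ⟩
      7 * D * g * ∑ P (bit ∘ severed)              ≡⟨ ∑-* P (7 * D * g) (bit ∘ severed) ⟨
      ∑ P (λ i → 7 * D * g * bit (severed i))      ≤⟨ ∑-mono P row-bound ⟩
      ∑ P (λ i → trues (Vec.lookup code i) * g)    ≡⟨ request-actives code ⟨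
      actives M (request code)                     ∎
      where
      open ≤-Reasoning
      open +-*-Solver
      row-bound : ∀ i → 7 * D * g * bit (severed i) ≤ trues (Vec.lookup code i) * g
      row-bound i = ≤-trans (≤-reflexive (solve 3 (λ d g c → con 7 :* d :* g :* c := c :* (con 7 :* d) :* g) refl D g (bit (severed i))))
                            (*-monoˡ-≤ g (proj₁ (proj₂ (code-row i))))

    -- All served copies are cut, so with `y` severed pairs there are at most `2 * k * g * y` of
    -- them, against at least `7 * D * g * y` active requests. The constant 289 is the least with
    -- `2 * 1010 ≤ 7 * 289`.
    bad-code : ∀ {k} → 289 * k ≤ D → count E′ ≤ k * (2 * g) * count Dm → DisconnectsSome E Pairs E′ → Bad h code
    bad-code {k} k≤ sparse (u , v , pr , dis) = some , proj₁ ∘ code-row , few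
      where
      open ≤-Reasoning
      some : ∃ λ i → trues (Vec.lookup code i) ≢ 0
      some with Pairs⁻ {u} {v} pr
      ... | i , refl , refl = i , λ z → <⇒≱ (*-mono-≤ (s≤s (z≤n {6})) (>-nonZero⁻¹ D)) (≤-trans
        (≤-trans (≤-reflexive (sym (trans (cong (λ c → bit c * (7 * D)) (proj₂ (isD _ _) pr dis)) (+-identityʳ (7 * D)))))
                 (proj₁ (proj₂ (code-row i)))) (≤-reflexive z))
      few : 1010 * length (served M (request code) h []) ≤ actives M (request code)
      few = begin
        1010 * length (served M (request code) h []) ≤⟨ *-monoʳ-≤ 1010 (≤-trans served≤cut sparse) ⟩
        1010 * (k * (2 * g) * count Dm)              ≤⟨ rescale 1010 289 k g (count Dm) D (m≤m+n 2020 3) k≤ ⟩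
        7 * D * g * count Dm                         ≤⟨ requested ⟩
        actives M (request code)                     ∎

  module _ (P≥1 : 1 ≤ P) (s≤ : s ≤ 2 * P) {k : ℕ} (k≤ : 289 * k ≤ D) where

    -- Removing all edges severs a pair; this rules out the alternative of `SCutBound` in which
    -- nothing can be cut.
    some-cut : DisconnectsSome E Pairs E
    some-cut = at (source i₀) , at (sink i₀) , Pairs⁺ i₀ , λ r → stuck r refl
      where
      i₀ : Fin P
      i₀ = fromℕ< P≥1
      stuck : ∀ {v} → Reach (minus E E) (at (source i₀)) v → v ≢ at (sink i₀)
      stuck (step {u} {v} _ e) _ = minus-self E u v e
      stuck Defs.here eq with at-injective {source i₀} {sink i₀} eq
      ... | ()

    sparse-count : ∀ x y f q → FeasibleFlow E Pairs f q → ℕtoℚ x ℚ.≤ (ℕtoℚ k ℚ.* q) ℚ.* ℕtoℚ y → x ≤ k * (2 * g) * y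
    sparse-count x y f q feasible sparse = ℕtoℚ-cancel {x} {k * (2 * g) * y} (begin
      ℕtoℚ x                                   ≤⟨ sparse ⟩
      (ℕtoℚ k ℚ.* q) ℚ.* ℕtoℚ y                ≤⟨ ℚₚ.*-monoʳ-≤-nonNeg (ℕtoℚ y) {{ℕtoℚ-nonNeg y}}
                                                   (ℚₚ.*-monoˡ-≤-nonNeg (ℕtoℚ k) {{ℕtoℚ-nonNeg k}}
                                                     (FlowBound.flow-value L g h fits P≥1 s≤ f q feasible)) ⟩
      (ℕtoℚ k ℚ.* ℕtoℚ (2 * g)) ℚ.* ℕtoℚ y     ≡⟨ cong (ℚ._* ℕtoℚ y) (ℕtoℚ-* k (2 * g)) ⟨
      ℕtoℚ (k * (2 * g)) ℚ.* ℕtoℚ y            ≡⟨ ℕtoℚ-* (k * (2 * g)) y ⟨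
      ℕtoℚ (k * (2 * g) * y)                   ∎)
      where open ℚₚ.≤-Reasoning

    bad-shift : SCutBound E Pairs k → ∃ (Bad h)
    bad-shift (inj₁ none) = ⊥-elim (none E (λ _ _ e → e) some-cut)
    bad-shift (inj₂ (E′ , Dm , f , q , _ , some , isD , feasible , sparse)) =
      code E′ Dm isD , bad-code E′ Dm isD {k} k≤ (sparse-count (count E′) (count Dm) f q feasible sparse) some

gap-large : ∀ {D P s g b k} .{{_ : NonZero D}} (L : Layout D P (8 * D) s) → 1 ≤ P → s ≤ 2 * P →
            Network.#vertices L g ≤ b → 4 * P * 2 ^ (8 * D) ≤ 4 ^ (7 * D * g) → GapBound b k → ¬ 289 * k ≤ D
gap-large {g = g} {k = k} L P≥1 s≤ fits big gap k≤ = Network.not-all-bad L g P≥1 big λ h →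
  CutBound.bad-shift L g h fits P≥1 s≤ {k} k≤ (gap (Network.Graph.E L g h fits) (Network.Graph.Pairs L g h fits))

-- Splitting nodes into slots

∑-strict : ∀ n {f g : Fin n → ℕ} → (∀ i → f i ≤ g i) → ∀ i → f i < g i → ∑ n f < ∑ n g
∑-strict (suc n) le Fin.zero lt = +-mono-<-≤ lt (∑-mono n (le ∘ Fin.suc))
∑-strict (suc n) le (Fin.suc i) lt = +-mono-≤-< (le Fin.zero) (∑-strict n (le ∘ Fin.suc) i lt)

𝟙≤1 : {A : Set} (d : Dec A) → 𝟙 d ≤ 1
𝟙≤1 (yes _) = ≤-refl
𝟙≤1 (no _) = z≤n

𝟙-mono : {A B : Set} (d : Dec A) (e : Dec B) → (A → B) → 𝟙 d ≤ 𝟙 e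
𝟙-mono (no _) e f = z≤n
𝟙-mono (yes a) (yes _) f = ≤-refl
𝟙-mono (yes a) (no nb) f = ⊥-elim (nb (f a))

𝟙-strict : {A B : Set} (d : Dec A) (e : Dec B) → ¬ A → B → 𝟙 d < 𝟙 e
𝟙-strict (yes a) e na b = ⊥-elim (na a)
𝟙-strict (no _) (yes _) na b = ≤-refl
𝟙-strict (no _) (no nb) na b = ⊥-elim (nb b)

-- Items are sorted by colour and cut into blocks of K; an item's slot is its colour plus its block number.
-- Both summands are monotone in the sorted order, so a slot determines the colour and the block.
module Slots (P K : ℕ) .{{_ : NonZero K}} (ν : ℕ) (colour : Fin (P * K) → ℕ) (colour< : ∀ i → colour i < ν) where

  key : Fin (P * K) → ℕ
  key i = colour i * (P * K) + toℕ i

  key-colour : ∀ {i j} → colour i < colour j → key i < key j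
  key-colour {i} {j} lt = begin-strict
    colour i * (P * K) + toℕ i     <⟨ +-monoʳ-< (colour i * (P * K)) (Finₚ.toℕ<n i) ⟩
    colour i * (P * K) + P * K     ≡⟨ +-comm (colour i * (P * K)) (P * K) ⟩
    suc (colour i) * (P * K)       ≤⟨ *-monoˡ-≤ (P * K) lt ⟩
    colour j * (P * K)             ≤⟨ m≤m+n _ (toℕ j) ⟩
    key j                          ∎
    where open ≤-Reasoning

  key-injective : ∀ {i j} → key i ≡ key j → i ≡ j
  key-injective {i} {j} eq with <-cmp (colour i) (colour j)
  ... | tri< lt _ _ = ⊥-elim (<-irrefl eq (key-colour lt))
  ... | tri> _ _ gt = ⊥-elim (<-irrefl (sym eq) (key-colour gt))
  ... | tri≈ _ e _ = Finₚ.toℕ-injective (+-cancelˡ-≡ (colour j * (P * K)) _ _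
                       (trans (cong (λ c → c * (P * K) + toℕ i) (sym e)) eq))

  rank : Fin (P * K) → ℕ
  rank i = ∑ (P * K) (λ j → 𝟙 (key j <? key i))

  rank-mono : ∀ {i j} → key i < key j → rank i < rank j
  rank-mono {i} {j} lt = ∑-strict (P * K) (λ k → 𝟙-mono (key k <? key i) (key k <? key j) (λ l → <-trans l lt)) i
    (𝟙-strict (key i <? key i) (key i <? key j) (<-irrefl refl) lt)

  rank< : ∀ i → rank i < P * K
  rank< i = subst (rank i <_) (trans (∑-const (P * K) 1) (*-identityʳ _))
    (∑-strict (P * K) (λ k → 𝟙≤1 (key k <? key i)) i (s≤s (≤-reflexive (zero-at (key i <? key i)))))
    where
    zero-at : (d : Dec (key i < key i)) → 𝟙 d ≡ 0
    zero-at (yes lt) = ⊥-elim (<-irrefl refl lt)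
    zero-at (no _) = refl

  rank-injective : ∀ {i j} → rank i ≡ rank j → i ≡ j
  rank-injective {i} {j} eq with <-cmp (key i) (key j)
  ... | tri< lt _ _ = ⊥-elim (<-irrefl eq (rank-mono lt))
  ... | tri> _ _ gt = ⊥-elim (<-irrefl (sym eq) (rank-mono gt))
  ... | tri≈ _ e _ = key-injective e

  slotℕ : Fin (P * K) → ℕ
  slotℕ i = colour i + rank i / K

  slotℕ< : ∀ i → slotℕ i < ν + P
  slotℕ< i = +-mono-<-≤ (colour< i) (<⇒≤ (m<n*o⇒m/o<n {rank i} {P} {K} (rank< i)))

  slotℕ-colour : ∀ {i j} → slotℕ i ≡ slotℕ j → colour i ≡ colour j
  slotℕ-colour {i} {j} eq with <-cmp (colour i) (colour j)
  ... | tri≈ _ e _ = e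
  ... | tri< lt _ _ = ⊥-elim (<-irrefl eq (+-mono-<-≤ lt (/-monoˡ-≤ K (<⇒≤ (rank-mono (key-colour lt))))))
  ... | tri> _ _ gt = ⊥-elim (<-irrefl (sym eq) (+-mono-<-≤ gt (/-monoˡ-≤ K (<⇒≤ (rank-mono (key-colour gt))))))

  -- Items in one slot lie in the same block of `K` consecutive ranks, so their ranks differ modulo
  -- `K`.
  slot-load : ∀ {n} (slot : Fin (P * K) → Fin n) → (∀ {i j} → slot i ≡ slot j → slotℕ i ≡ slotℕ j) → ∀ v →
              ∑ (P * K) (λ i → 𝟙 (v Fin.≟ slot i)) ≤ K
  slot-load slot same v = begin
    ∑ (P * K) (λ i → 𝟙 (v Fin.≟ slot i))                             ≡⟨ sum-allFin (P * K) _ ⟨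
    sum (map (λ i → 𝟙 (v Fin.≟ slot i)) (List.allFin (P * K)))       ≡⟨ length-filter-sum (λ i → v Fin.≟ slot i) (List.allFin (P * K)) ⟨
    length here′                                                     ≡⟨ length-map offset here′ ⟨
    length (map offset here′)                                        ≤⟨ unique-⊆-length (map! here′ (Uniqueₚ.filter⁺ (λ i → v Fin.≟ slot i) (Uniqueₚ.allFin⁺ (P * K))) in-slot) (λ {z} _ → ∈-allFin z) ⟩
    length (List.allFin K)                                           ≡⟨ length-tabulate {n = K} id ⟩
    K                                                                ∎
    where
    open ≤-Reasoning
    here′ = filter (λ i → v Fin.≟ slot i) (List.allFin (P * K))
    in-slot : ∀ {i} → i ∈ here′ → v ≡ slot i
    in-slot i∈ = proj₂ (∈-filter⁻ (λ i → v Fin.≟ slot i) {xs = List.allFin (P * K)} i∈)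
    offset : Fin (P * K) → Fin K
    offset i = fromℕ< (m%n<n (rank i) K)
    offset-injective : ∀ {i j} → v ≡ slot i → v ≡ slot j → offset i ≡ offset j → i ≡ j
    offset-injective {i} {j} vi vj eq = rank-injective (begin-equality
      rank i                            ≡⟨ m≡m%n+[m/n]*n (rank i) K ⟩
      rank i % K + rank i / K * K       ≡⟨ cong₂ (λ r q → r + q * K) (Finₚ.fromℕ<-injective _ _ _ _ eq)
                                             (+-cancelˡ-≡ (colour i) _ _ (trans s (cong (_+ rank j / K) (sym (slotℕ-colour s))))) ⟩
      rank j % K + rank j / K * K       ≡⟨ m≡m%n+[m/n]*n (rank j) K ⟨
      rank j                            ∎)
      where
      s : slotℕ i ≡ slotℕ j
      s = same (trans (sym vi) vj)
    map! : ∀ xs → Unique xs → (∀ {i} → i ∈ xs → v ≡ slot i) → Unique (map offset xs)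
    map! [] _ _ = []
    map! (x ∷ xs) (x∉ ∷ u) ins = Allₚ.map⁺ (All.tabulate λ y∈ e →
      All.lookup x∉ y∈ (offset-injective (ins (here refl)) (ins (there y∈)) e)) ∷ map! xs u (ins ∘ there)

-- The layout of a bridge-free system

precedes-∷ : ∀ {n} {u v x : Fin n} {xs} → Precedes u v xs → Precedes u v (x ∷ xs)
precedes-∷ (i , j , i<j , e , e′) = Fin.suc i , Fin.suc j , s≤s i<j , e , e′

precedes-here : ∀ {n} {v x : Fin n} {xs} → v ∈ xs → Precedes x v (x ∷ xs)
precedes-here v∈ = Fin.zero , Fin.suc (Any.index v∈) , s≤s z≤n , refl , sym (lookup-index v∈)

filter-precedes : ∀ {n} {Q : Fin n → Set} (Q? : Decidable Q) (xs : List (Fin n)) {a b : Fin (length (filter Q? xs))} →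
                  a Fin.< b → Precedes (lookup (filter Q? xs) a) (lookup (filter Q? xs) b) xs
filter-precedes Q? (x ∷ xs) a<b with Q? x
filter-precedes Q? (x ∷ xs) a<b | no _ = precedes-∷ (filter-precedes Q? xs a<b)
filter-precedes Q? (x ∷ xs) {Fin.zero} {Fin.suc b} a<b | yes _ =
  precedes-here (proj₁ (∈-filter⁻ Q? {xs = xs} (∈-lookup b)))
filter-precedes Q? (x ∷ xs) {Fin.suc a} {Fin.suc b} (s≤s a<b) | yes _ = precedes-∷ (filter-precedes Q? xs a<b)

visits : ∀ {n p} → PathSystem n p → List (Fin n) → Fin p → List (Fin n)
visits S Vs i = filter (λ v → DecMem._∈?_ Fin._≟_ v Vs) (Vec.lookup (paths S) i)

module BuildLayout {n p : ℕ} (S : PathSystem n p) (bf : BridgeFree S) (Vs : List (Fin n)) (used : List (Fin p))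
                   (ac : Trips.Acyclic (Restricted.traversal S Vs) (_∉ used))
                   (D P : ℕ) .{{nz : NonZero D}} (cand : List (Fin p)) (cand! : Unique cand) (P≤ : P ≤ length cand)
                   (good : ∀ {i} → i ∈ cand → i ∉ used × 8 * D ≤ length (visits S Vs i))
                   (small : length Vs ≤ P) where

  open Restricted S Vs
  open Trips traversal

  line : Fin P → Fin p
  line i = lookup cand (inject≤ i P≤)

  line∈ : ∀ i → line i ∈ cand
  line∈ i = ∈-lookup (inject≤ i P≤)

  line-injective : ∀ {i j} → line i ≡ line j → i ≡ j
  line-injective {i} {j} eq = Finₚ.inject≤-injective P≤ P≤ i j (lookup-unique cand! _ _ eq)

  node : Fin P → Fin (8 * D) → Fin n
  node i q = lookup (visits S Vs (line i)) (inject≤ q (proj₂ (good (line∈ i))))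

  node∈ : ∀ i q → node i q ∈ Vs
  node∈ i q = proj₂ (∈-filter⁻ (λ v → DecMem._∈?_ Fin._≟_ v Vs) {xs = route-of (line i)} (∈-lookup (inject≤ q (proj₂ (good (line∈ i))))))

  node-prec : ∀ i {q r} → q Fin.< r → Prec (line i) (node i q) (node i r)
  node-prec i {q} {r} q<r = filter-precedes _ (route-of (line i))
      (subst₂ _<_ (sym (Finₚ.toℕ-inject≤ q len)) (sym (Finₚ.toℕ-inject≤ r len)) q<r) , node∈ i q , node∈ i r
    where len = proj₂ (good (line∈ i))

  node-on : ∀ i q → On (line i) (node i q)
  node-on i q = proj₁ (∈-filter⁻ (λ v → DecMem._∈?_ Fin._≟_ v Vs) {xs = route-of (line i)} (∈-lookup (inject≤ q (proj₂ (good (line∈ i)))))) , node∈ i q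

  irreflexive : ∀ {i u} → ¬ Prec i u u
  irreflexive = no-detour bf [] ([] ∷ [])

  node-injective : ∀ i {q r} → node i q ≡ node i r → q ≡ r
  node-injective i {q} {r} eq with Finₚ.<-cmp q r
  ... | tri≈ _ e _ = e
  ... | tri< lt _ _ = ⊥-elim (irreflexive (subst (λ u → Prec (line i) u (node i r)) eq (node-prec i lt)))
  ... | tri> _ _ gt = ⊥-elim (irreflexive (subst (Prec (line i) (node i r)) eq (node-prec i gt)))

  private instance
    nz8 : NonZero (8 * D)
    nz8 = m*n≢0 8 D

  place : Fin P → Fin (8 * D) → Fin (length Vs)
  place i q = Any.index (node∈ i q)

  colour-of : Fin P × Fin (8 * D) → ℕ
  colour-of (i , q) = toℕ (place i q)

  colour : Fin (P * (8 * D)) → ℕ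
  colour x = colour-of (remQuot {P} (8 * D) x)

  open Slots P (8 * D) (length Vs) colour (λ x → Finₚ.toℕ<n (place (proj₁ (remQuot {P} (8 * D) x)) (proj₂ (remQuot {P} (8 * D) x))))

  -- Splitting adds at most `P` to the number of nodes. With no more sampled nodes than commodities
  -- this is at most `2 * P`, so the total capacity stays proportional to the number of commodities.
  slotFin : Fin (P * (8 * D)) → Fin (2 * P)
  slotFin x = fromℕ< (≤-trans (slotℕ< x) (+-mono-≤ small (≤-reflexive (sym (+-identityʳ P)))))

  slotFin-same : ∀ {x y} → slotFin x ≡ slotFin y → slotℕ x ≡ slotℕ y
  slotFin-same eq = Finₚ.fromℕ<-injective _ _ _ _ eq

  slot : Fin P → Fin (8 * D) → Fin (2 * P)
  slot i q = slotFin (combine i q)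

  slot-node : ∀ {i j q r} → slot i q ≡ slot j r → node i q ≡ node j r
  slot-node {i} {j} {q} {r} eq = begin
    node i q                  ≡⟨ lookup-index (node∈ i q) ⟩
    lookup Vs (place i q)     ≡⟨ cong (lookup Vs) (Finₚ.toℕ-injective colours) ⟩
    lookup Vs (place j r)     ≡⟨ lookup-index (node∈ j r) ⟨
    node j r                  ∎
    where
    open ≡-Reasoning
    colours : toℕ (place i q) ≡ toℕ (place j r)
    colours = trans (cong colour-of (sym (Finₚ.remQuot-combine {P} {8 * D} i q)))
                (trans (slotℕ-colour (slotFin-same eq)) (cong colour-of (Finₚ.remQuot-combine {P} {8 * D} j r)))

  -- Slots refine nodes, so rides project to trips; this brings the rigidity of trips to the layout.
  ride⇒trip : ∀ {is u w i j q r} → Ride slot is u w → slot i q ≡ u → slot j r ≡ w → Trip (map line is) (node i q) (node j r)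
  ride⇒trip {i = i} {j} {q} {r} [] eu ew = subst (Trip [] (node i q)) (slot-node (trans eu (sym ew))) []
  ride⇒trip {i = i} {q = q} (hop k {p′} {q′} lt e e′ ride) eu ew =
    subst (λ u → Prec (line k) u (node k q′)) (slot-node (trans e (sym eu))) (node-prec k lt) ∷ ride⇒trip ride e′ ew

  layout : Layout D P (8 * D) (2 * P)
  layout = record
    { slot = slot
    ; slot-inj = λ i eq → node-injective i (slot-node eq)
    ; rigid = λ {i} {q} {r} {is} ride → All.map line-injective (Allₚ.map⁻
        (rigid (no-detour bf) ac (proj₁ (good (line∈ i))) (active is) (node-on i q) (node-on i r) (ride⇒trip ride refl refl)))
    ; load = λ v → ≤-trans (≤-reflexive (sym (∑-combine P (8 * D) (λ x → 𝟙 (v Fin.≟ slotFin x)))))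
                           (slot-load slotFin slotFin-same v)
    }
    where
    active : ∀ is → All (_∉ used) (map line is)
    active [] = []
    active (i ∷ is) = proj₁ (good (line∈ i)) ∷ active is

-- Sampling nodes

-- The inequality `1 + s t / y ≤ (1 + t / y) ^ s` without denominators.
bernoulli-lower : ∀ y t s → y ^ s * (y + s * t) ≤ y * (y + t) ^ s
bernoulli-lower y t zero = ≤-reflexive (solve 1 (λ y → con 1 :* (y :+ con 0) := y :* con 1) refl y)
  where open +-*-Solver
bernoulli-lower y t (suc s) = begin
  y * y ^ s * (y + suc s * t)          ≤⟨ m≤m+n _ (y ^ s * (s * t * t)) ⟩
  y * y ^ s * (y + suc s * t) + y ^ s * (s * t * t)
    ≡⟨ solve 4 (λ y w s t → y :* w :* (y :+ (con 1 :+ s) :* t) :+ w :* (s :* t :* t) := (y :+ t) :* (w :* (y :+ s :* t))) refl y (y ^ s) s t ⟩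
  (y + t) * (y ^ s * (y + s * t))      ≤⟨ *-monoʳ-≤ (y + t) (bernoulli-lower y t s) ⟩
  (y + t) * (y * (y + t) ^ s)          ≡⟨ solve 3 (λ a y w → a :* (y :* w) := y :* (a :* w)) refl (y + t) y ((y + t) ^ s) ⟩
  y * ((y + t) * (y + t) ^ s)          ∎
  where
  open ≤-Reasoning
  open +-*-Solver

halved : ∀ y t s .{{_ : NonZero y}} → y + t ≤ s * t → 2 * y ^ s ≤ (y + t) ^ s
halved y t s le = *-cancelˡ-≤ y (begin
  y * (2 * y ^ s)           ≡⟨ solve 2 (λ y w → y :* (con 2 :* w) := w :* (y :+ y)) refl y (y ^ s) ⟩
  y ^ s * (y + y)           ≤⟨ *-monoʳ-≤ (y ^ s) (+-monoʳ-≤ y (≤-trans (m≤m+n y t) le)) ⟩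
  y ^ s * (y + s * t)       ≤⟨ bernoulli-lower y t s ⟩
  y * (y + t) ^ s           ∎)
  where
  open ≤-Reasoning
  open +-*-Solver

halved-repeatedly : ∀ y t s r .{{_ : NonZero y}} → y + t ≤ s * t → 2 ^ r * y ^ (s * r) ≤ (y + t) ^ (s * r)
halved-repeatedly y t s r le = begin
  2 ^ r * y ^ (s * r)       ≡⟨ cong (2 ^ r *_) (^-*-assoc y s r) ⟨
  2 ^ r * (y ^ s) ^ r       ≡⟨ ^-distribʳ-* r 2 (y ^ s) ⟨
  (2 * y ^ s) ^ r           ≤⟨ ^-monoˡ-≤ r (halved y t s le) ⟩
  ((y + t) ^ s) ^ r         ≡⟨ ^-*-assoc (y + t) s r ⟩
  (y + t) ^ (s * r)         ∎
  where open ≤-Reasoning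

_∈ᵇ?_ : ∀ {n} (v : Fin n) (xs : List (Fin n)) → Dec (v ∈ xs)
_∈ᵇ?_ = DecMem._∈?_ Fin._≟_

common : ∀ {n} → List (Fin n) → List (Fin n) → ℕ
common Vs xs = sum (map (λ v → 𝟙 (v ∈ᵇ? xs)) Vs)

common≤ : ∀ {n} {Vs xs : List (Fin n)} → Unique Vs → common Vs xs ≤ length (filter (_∈ᵇ? Vs) xs)
common≤ {Vs = Vs} {xs} Vs! = ≤-trans (≤-reflexive (sym (length-filter-sum (_∈ᵇ? xs) Vs)))
  (unique-⊆-length (Uniqueₚ.filter⁺ (_∈ᵇ? xs) Vs!) λ v∈ →
    let (v∈Vs , v∈xs) = ∈-filter⁻ (_∈ᵇ? xs) {xs = Vs} v∈ in ∈-filter⁺ (_∈ᵇ? Vs) v∈xs v∈Vs)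

fresh : ∀ {n} → List (Fin n) → List (Fin n) → ℕ
fresh {n} Vs xs = ∑ n (λ v → 𝟙 (¬? (v ∈ᵇ? Vs)) * 𝟙 (v ∈ᵇ? xs))

length≤common+fresh : ∀ {n} {Vs xs : List (Fin n)} → Unique xs → length xs ≤ common Vs xs + fresh Vs xs
length≤common+fresh {n} {Vs} {xs} xs! = begin
  length xs                                                        ≡⟨ length-filter-¬ (_∈ᵇ? Vs) xs ⟨
  length (filter (_∈ᵇ? Vs) xs) + length (filter (¬? ∘ (_∈ᵇ? Vs)) xs) ≤⟨ +-mono-≤ old new ⟩
  common Vs xs + fresh Vs xs                                       ∎
  where
  open ≤-Reasoning
  old : length (filter (_∈ᵇ? Vs) xs) ≤ common Vs xs
  old = ≤-trans (unique-⊆-length (Uniqueₚ.filter⁺ (_∈ᵇ? Vs) xs!) λ v∈ →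
          let (v∈xs , v∈Vs) = ∈-filter⁻ (_∈ᵇ? Vs) {xs = xs} v∈ in ∈-filter⁺ (_∈ᵇ? xs) v∈Vs v∈xs)
        (≤-reflexive (length-filter-sum (_∈ᵇ? xs) Vs))
  both? : (v : Fin n) → Dec (¬ v ∈ Vs × v ∈ xs)
  both? v = ¬? (v ∈ᵇ? Vs) ×-dec (v ∈ᵇ? xs)
  product : {A B : Set} (d : Dec A) (e : Dec B) → 𝟙 (d ×-dec e) ≤ 𝟙 d * 𝟙 e
  product (yes _) (yes _) = ≤-refl
  product (yes _) (no _) = z≤n
  product (no _) _ = z≤n
  new : length (filter (¬? ∘ (_∈ᵇ? Vs)) xs) ≤ fresh Vs xs
  new = begin
    length (filter (¬? ∘ (_∈ᵇ? Vs)) xs)   ≤⟨ unique-⊆-length (Uniqueₚ.filter⁺ (¬? ∘ (_∈ᵇ? Vs)) xs!) (λ {v} v∈ →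
                                               let (v∈xs , v∉) = ∈-filter⁻ (¬? ∘ (_∈ᵇ? Vs)) {xs = xs} v∈ in
                                               ∈-filter⁺ both? (∈-allFin v) (v∉ , v∈xs)) ⟩
    length (filter both? (List.allFin n))  ≡⟨ length-filter-sum both? (List.allFin n) ⟩
    sum (map (λ v → 𝟙 (both? v)) (List.allFin n)) ≡⟨ sum-allFin n _ ⟩
    ∑ n (λ v → 𝟙 (both? v))                ≤⟨ ∑-mono n (λ v → product (¬? (v ∈ᵇ? Vs)) (v ∈ᵇ? xs)) ⟩
    fresh Vs xs                            ∎

-- Nodes are picked greedily so that the potential, the sum over the routes of 2^(K ∸ hits) while a
-- route has fewer than K hits, drops by the factor 1 − t/4n each time.
module Sampling {n : ℕ} (K t : ℕ) (rs : List (List (Fin n))) (rs! : ∀ {r} → r ∈ rs → Unique r)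
                (long : ∀ {r} → r ∈ rs → t ≤ length r) (2K≤t : 2 * K ≤ t) (1≤n : 1 ≤ n) (1≤t : 1 ≤ t) where

  weight : ℕ → ℕ
  weight a = 𝟙 (a <? K) * 2 ^ (K ∸ a)

  weight-half : ∀ a → 2 * weight (suc a) ≤ weight a
  weight-half a with suc a <? K | a <? K
  ... | no _ | _ = z≤n
  ... | yes lt | no nlt = ⊥-elim (nlt (<⇒≤ lt))
  ... | yes lt | yes _ = ≤-reflexive (begin
    2 * (2 ^ (K ∸ suc a) + 0)    ≡⟨ cong (2 *_) (+-identityʳ (2 ^ (K ∸ suc a))) ⟩
    2 ^ suc (K ∸ suc a)          ≡⟨ cong (2 ^_) (+-∸-assoc 1 (<⇒≤ lt)) ⟨
    2 ^ (K ∸ a)                  ≡⟨ +-identityʳ _ ⟨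
    2 ^ (K ∸ a) + 0              ∎)
    where open ≡-Reasoning

  potential : List (Fin n) → ℕ
  potential Vs = sum (map (λ r → weight (common Vs r)) rs)

  share : List (Fin n) → Fin n → ℕ
  share Vs v = sum (map (λ r → 𝟙 (v ∈ᵇ? r) * weight (common Vs r)) rs)

  sum-+ : (f g : List (Fin n) → ℕ) (xs : List (List (Fin n))) → sum (map (λ x → f x + g x) xs) ≡ sum (map f xs) + sum (map g xs)
  sum-+ f g [] = refl
  sum-+ f g (x ∷ xs) = trans (cong (f x + g x +_) (sum-+ f g xs)) (+-interchange (f x) (g x) _ _)

  potential-drop : ∀ Vs v → 2 * potential (v ∷ Vs) + share Vs v ≤ 2 * potential Vs
  potential-drop Vs v = begin
    2 * potential (v ∷ Vs) + share Vs v            ≡⟨ cong (_+ share Vs v) (sum-* 2 _ rs) ⟨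
    sum (map (λ r → 2 * weight (common (v ∷ Vs) r)) rs) + share Vs v ≡⟨ sum-+ _ _ rs ⟨
    sum (map (λ r → 2 * weight (common (v ∷ Vs) r) + 𝟙 (v ∈ᵇ? r) * weight (common Vs r)) rs)
      ≤⟨ sum-mono rs (λ {r} _ → each (v ∈ᵇ? r) (common Vs r)) ⟩
    sum (map (λ r → 2 * weight (common Vs r)) rs)  ≡⟨ sum-* 2 _ rs ⟩
    2 * potential Vs                               ∎
    where
    open ≤-Reasoning
    each : {A : Set} (d : Dec A) (a : ℕ) → 2 * weight (𝟙 d + a) + 𝟙 d * weight a ≤ 2 * weight a
    each (no _) a = ≤-reflexive (+-identityʳ _)
    each (yes _) a = ≤-trans (+-mono-≤ (weight-half a) ≤-refl) (≤-refl)

  -- A route with positive weight has fewer than `K ≤ t / 2` hits, hence at least `t / 2` nodes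
  -- outside the sample, and each of these receives the weight of the route.
  shares : ∀ Vs → t * potential Vs ≤ 2 * ∑ n (λ v → 𝟙 (¬? (v ∈ᵇ? Vs)) * share Vs v)
  shares Vs = begin
    t * potential Vs                                    ≡⟨ sum-* t _ rs ⟨
    sum (map (λ r → t * weight (common Vs r)) rs)       ≤⟨ sum-mono rs (λ {r} r∈ → each r r∈) ⟩
    sum (map (λ r → 2 * (fresh Vs r * weight (common Vs r))) rs) ≡⟨ sum-* 2 _ rs ⟩
    2 * sum (map (λ r → fresh Vs r * weight (common Vs r)) rs) ≡⟨ cong (2 *_) (cong sum (rewritten rs)) ⟩
    2 * sum (map (λ r → ∑ n (λ v → 𝟙 (¬? (v ∈ᵇ? Vs)) * (𝟙 (v ∈ᵇ? r) * weight (common Vs r)))) rs)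
      ≡⟨ cong (2 *_) (∑-sum-swap n (λ v r → 𝟙 (¬? (v ∈ᵇ? Vs)) * (𝟙 (v ∈ᵇ? r) * weight (common Vs r))) rs) ⟨
    2 * ∑ n (λ v → sum (map (λ r → 𝟙 (¬? (v ∈ᵇ? Vs)) * (𝟙 (v ∈ᵇ? r) * weight (common Vs r))) rs))
      ≡⟨ cong (2 *_) (∑-cong n (λ v → sum-* (𝟙 (¬? (v ∈ᵇ? Vs))) _ rs)) ⟩
    2 * ∑ n (λ v → 𝟙 (¬? (v ∈ᵇ? Vs)) * share Vs v)      ∎
    where
    open ≤-Reasoning
    spread : ∀ r → fresh Vs r * weight (common Vs r) ≡ ∑ n (λ v → 𝟙 (¬? (v ∈ᵇ? Vs)) * (𝟙 (v ∈ᵇ? r) * weight (common Vs r)))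
    spread r = trans (*-comm (fresh Vs r) w) (trans (sym (∑-* n w _)) (∑-cong n λ v →
        trans (*-comm w _) (*-assoc (𝟙 (¬? (v ∈ᵇ? Vs))) (𝟙 (v ∈ᵇ? r)) w)))
      where w = weight (common Vs r)
    rewritten : ∀ xs → map (λ r → fresh Vs r * weight (common Vs r)) xs ≡
                       map (λ r → ∑ n (λ v → 𝟙 (¬? (v ∈ᵇ? Vs)) * (𝟙 (v ∈ᵇ? r) * weight (common Vs r)))) xs
    rewritten [] = refl
    rewritten (x ∷ xs) = cong₂ _∷_ (spread x) (rewritten xs)
    each : ∀ r → r ∈ rs → t * weight (common Vs r) ≤ 2 * (fresh Vs r * weight (common Vs r))
    each r r∈ = light (common Vs r) (≤-trans (long r∈) (length≤common+fresh {Vs = Vs} (rs! r∈)))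
      where
      light : ∀ a {f} → t ≤ a + f → t * weight a ≤ 2 * (f * weight a)
      light a {f} le with a <? K
      ... | no _ = ≤-trans (≤-reflexive (*-zeroʳ t)) z≤n
      ... | yes a<K = ≤-trans (*-monoˡ-≤ w t≤2f) (≤-reflexive (*-assoc 2 f w))
        where
        w = 1 * 2 ^ (K ∸ a)
        t≤2f : t ≤ 2 * f
        t≤2f = +-cancelʳ-≤ t t (2 * f) (begin
          t + t                ≡⟨ cong (t +_) (+-identityʳ t) ⟨
          2 * t                ≤⟨ *-monoʳ-≤ 2 le ⟩
          2 * (a + f)          ≡⟨ *-distribˡ-+ 2 a f ⟩
          2 * a + 2 * f        ≤⟨ +-monoˡ-≤ (2 * f) (≤-trans (*-monoʳ-≤ 2 (<⇒≤ a<K)) 2K≤t) ⟩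
          t + 2 * f            ≡⟨ +-comm t (2 * f) ⟩
          2 * f + t            ∎)

  pick : ∀ Vs → 1 ≤ potential Vs → ∃ λ v → v ∉ Vs × t * potential Vs ≤ 2 * n * share Vs v
  pick Vs 1≤W with Finₚ.any? (λ v → ¬? (v ∈ᵇ? Vs) ×-dec (t * potential Vs ≤? 2 * n * share Vs v))
  ... | yes found = found
  ... | no none = ⊥-elim (<⇒≱ too-small (shares-scaled))
    where
    open ≤-Reasoning
    W = potential Vs
    term : Fin n → ℕ
    term v = 𝟙 (¬? (v ∈ᵇ? Vs)) * share Vs v
    -- The summand 1 makes the sum over the `n ≥ 1` nodes strictly too small.
    each : ∀ v → 2 * n * term v + 1 ≤ t * W
    each v = small (¬? (v ∈ᵇ? Vs)) (λ v∉ le → none (v , v∉ , le))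
      where
      small : {A : Set} (d : Dec A) → (A → ¬ t * W ≤ 2 * n * share Vs v) → 2 * n * (𝟙 d * share Vs v) + 1 ≤ t * W
      small (no _) _ = ≤-trans (≤-reflexive (cong (_+ 1) (*-zeroʳ (2 * n)))) (*-mono-≤ 1≤t 1≤W)
      small (yes a) f = ≤-trans (≤-reflexive (trans (+-comm _ 1) (cong (λ x → suc (2 * n * x)) (+-identityʳ (share Vs v))))) (≰⇒> (f a))
    shares-scaled : n * (t * W) ≤ ∑ n (λ v → 2 * n * term v)
    shares-scaled = begin
      n * (t * W)                 ≤⟨ *-monoʳ-≤ n (shares Vs) ⟩
      n * (2 * ∑ n term)          ≡⟨ solve 2 (λ n s → n :* (con 2 :* s) := con 2 :* n :* s) refl n (∑ n term) ⟩
      2 * n * ∑ n term            ≡⟨ ∑-* n (2 * n) term ⟨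
      ∑ n (λ v → 2 * n * term v)  ∎
      where open +-*-Solver
    too-small : ∑ n (λ v → 2 * n * term v) < n * (t * W)
    too-small = begin-strict
      ∑ n (λ v → 2 * n * term v)         <⟨ m<m+n _ 1≤n ⟩
      ∑ n (λ v → 2 * n * term v) + n     ≡⟨ cong (∑ n (λ v → 2 * n * term v) +_) (trans (∑-const n 1) (*-identityʳ n)) ⟨
      ∑ n (λ v → 2 * n * term v) + ∑ n (λ _ → 1) ≡⟨ ∑-+ n _ _ ⟨
      ∑ n (λ v → 2 * n * term v + 1)     ≤⟨ ∑-mono n each ⟩
      ∑ n (λ _ → t * W)                  ≡⟨ ∑-const n (t * W) ⟩
      n * (t * W)                        ∎

  sample : ∀ y → y + t ≡ 4 * n → ∀ m → ∃ λ Vs → Unique Vs × length Vs ≤ m × (4 * n) ^ m * potential Vs ≤ y ^ m * potential []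
  sample y y+t zero = [] , [] , z≤n , ≤-refl
  sample y y+t (suc m) with sample y y+t m
  ... | Vs , Vs! , len , le with 1 ≤? potential Vs
  ...   | no W≡0 = Vs , Vs! , m≤n⇒m≤1+n len ,
            ≤-trans (≤-reflexive (trans (cong ((4 * n) ^ suc m *_) (n<1⇒n≡0 (≰⇒> W≡0))) (*-zeroʳ ((4 * n) ^ suc m)))) z≤n
  ...   | yes 1≤W with pick Vs 1≤W
  ...     | v , v∉ , rich = v ∷ Vs , Allₚ.¬Any⇒All¬ _ v∉ ∷ Vs! , s≤s len , (begin
    4 * n * (4 * n) ^ m * potential (v ∷ Vs)      ≡⟨ solve 3 (λ a b c → a :* b :* c := b :* (a :* c)) refl (4 * n) ((4 * n) ^ m) (potential (v ∷ Vs)) ⟩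
    (4 * n) ^ m * (4 * n * potential (v ∷ Vs))    ≤⟨ *-monoʳ-≤ ((4 * n) ^ m) drop ⟩
    (4 * n) ^ m * (y * potential Vs)              ≡⟨ solve 3 (λ a b c → a :* (b :* c) := b :* (a :* c)) refl ((4 * n) ^ m) y (potential Vs) ⟩
    y * ((4 * n) ^ m * potential Vs)              ≤⟨ *-monoʳ-≤ y le ⟩
    y * (y ^ m * potential [])                    ≡⟨ *-assoc y (y ^ m) (potential []) ⟨
    y * y ^ m * potential []                      ∎)
    where
    open ≤-Reasoning
    open +-*-Solver
    W = potential Vs
    W′ = potential (v ∷ Vs)
    drop : 4 * n * W′ ≤ y * W
    drop = +-cancelʳ-≤ (t * W) (4 * n * W′) (y * W) (begin
      4 * n * W′ + t * W                  ≤⟨ +-monoʳ-≤ (4 * n * W′) rich ⟩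
      4 * n * W′ + 2 * n * share Vs v     ≡⟨ solve 3 (λ n w s → con 4 :* n :* w :+ con 2 :* n :* s := con 2 :* n :* (con 2 :* w :+ s)) refl n W′ (share Vs v) ⟩
      2 * n * (2 * W′ + share Vs v)       ≤⟨ *-monoʳ-≤ (2 * n) (potential-drop Vs v) ⟩
      2 * n * (2 * W)                     ≡⟨ solve 2 (λ n w → con 2 :* n :* (con 2 :* w) := con 4 :* n :* w) refl n W ⟩
      4 * n * W                           ≡⟨ cong (_* W) y+t ⟨
      (y + t) * W                         ≡⟨ *-distribʳ-+ W y t ⟩
      y * W + t * W                       ∎)

  missed : List (Fin n) → ℕ
  missed Vs = length (filter (λ r → common Vs r <? K) rs)

  missed≤ : ∀ Vs → 2 * missed Vs ≤ potential Vs
  missed≤ Vs = begin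
    2 * missed Vs                                       ≡⟨ cong (2 *_) (length-filter-sum (λ r → common Vs r <? K) rs) ⟩
    2 * sum (map (λ r → 𝟙 (common Vs r <? K)) rs)       ≡⟨ sum-* 2 _ rs ⟨
    sum (map (λ r → 2 * 𝟙 (common Vs r <? K)) rs)       ≤⟨ sum-mono rs (λ {r} _ → each (common Vs r)) ⟩
    potential Vs                                        ∎
    where
    open ≤-Reasoning
    each : ∀ a → 2 * 𝟙 (a <? K) ≤ weight a
    each a with a <? K
    ... | no _ = z≤n
    ... | yes a<K = ≤-trans (^-monoʳ-≤ 2 (m<n⇒0<n∸m a<K)) (m≤m+n _ 0)

  potential-[] : potential [] ≤ length rs * 2 ^ K
  potential-[] = ≤-trans (sum-mono rs (λ _ → ≤-trans (*-monoˡ-≤ (2 ^ K) (𝟙≤1 (0 <? K))) (≤-reflexive (+-identityʳ _))))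
                         (≤-reflexive (sum-const (2 ^ K) rs))

  -- Every `s` picks halve the potential, so `s * suc K` picks bring it from at most
  -- `length rs * 2 ^ K` down to half of `length rs`. A missed route still has weight at least 2.
  sampled : ∀ s → 4 * n ≤ s * t → t ≤ n → ∃ λ Vs → Unique Vs × length Vs ≤ s * suc K × 4 * missed Vs ≤ length rs
  sampled s 4n≤ t≤n with sample y y+t (s * suc K)
    where
    y = 4 * n ∸ t
    y+t : y + t ≡ 4 * n
    y+t = m∸n+n≡m (≤-trans t≤n (m≤m+n n (3 * n)))
  ... | Vs , Vs! , len , le = Vs , Vs! , len , (begin
    4 * missed Vs             ≡⟨ *-assoc 2 2 (missed Vs) ⟩
    2 * (2 * missed Vs)       ≤⟨ *-monoʳ-≤ 2 (missed≤ Vs) ⟩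
    2 * potential Vs          ≤⟨ *-cancelˡ-≤ (y ^ m * 2 ^ K) {{m*n≢0 (y ^ m) (2 ^ K) {{m^n≢0 y m {{y≢0}}}} {{m^n≢0 2 K}}}} scaled ⟩
    length rs                 ∎)
    where
    open ≤-Reasoning
    open +-*-Solver
    m = s * suc K
    y = 4 * n ∸ t
    y+t : y + t ≡ 4 * n
    y+t = m∸n+n≡m (≤-trans t≤n (m≤m+n n (3 * n)))
    y≢0 : NonZero y
    y≢0 = >-nonZero (m<n⇒0<n∸m (≤-trans (s≤s t≤n) (≤-trans (+-monoˡ-≤ n 1≤n) (+-monoʳ-≤ n (m≤m+n n (2 * n))))))
    scaled : y ^ m * 2 ^ K * (2 * potential Vs) ≤ y ^ m * 2 ^ K * length rs
    scaled = begin
      y ^ m * 2 ^ K * (2 * potential Vs)       ≡⟨ solve 3 (λ a b c → a :* b :* (con 2 :* c) := con 2 :* b :* a :* c) refl (y ^ m) (2 ^ K) (potential Vs) ⟩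
      2 ^ suc K * y ^ m * potential Vs         ≤⟨ *-monoˡ-≤ (potential Vs) (halved-repeatedly y t s (suc K) {{y≢0}} (≤-trans (≤-reflexive y+t) 4n≤)) ⟩
      (y + t) ^ m * potential Vs               ≡⟨ cong (λ z → z ^ m * potential Vs) y+t ⟩
      (4 * n) ^ m * potential Vs               ≤⟨ le ⟩
      y ^ m * potential []                     ≤⟨ *-monoʳ-≤ (y ^ m) potential-[] ⟩
      y ^ m * (length rs * 2 ^ K)              ≡⟨ solve 3 (λ a b c → a :* (c :* b) := a :* b :* c) refl (y ^ m) (2 ^ K) (length rs) ⟩
      y ^ m * 2 ^ K * length rs                ∎

-- Choosing the parameters

1≤⌈log₂_⌉ : ∀ n → 2 ≤ n → 1 ≤ ⌈log₂ n ⌉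
1≤⌈log₂ n ⌉ 2≤n = ⌈log₂⌉-mono-≤ 2≤n

n≤2^⌈log₂n⌉ : ∀ n → n ≤ 2 ^ ⌈log₂ n ⌉
n≤2^⌈log₂n⌉ n = go n (<-wellFounded n)
  where
  go : ∀ n → Acc _<_ n → n ≤ 2 ^ ⌈log₂ n ⌉
  go zero _ = z≤n
  go (suc zero) _ = m^n>0 2 ⌈log₂ 1 ⌉
  go n@(suc (suc m)) (acc rec) = begin
    n                                ≡⟨ ⌊n/2⌋+⌈n/2⌉≡n n ⟨
    ⌊ n /2⌋ + ⌈ n /2⌉                ≤⟨ +-monoˡ-≤ ⌈ n /2⌉ (⌊n/2⌋≤⌈n/2⌉ n) ⟩
    ⌈ n /2⌉ + ⌈ n /2⌉                ≡⟨ cong (⌈ n /2⌉ +_) (+-identityʳ ⌈ n /2⌉) ⟨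
    2 * ⌈ n /2⌉                      ≤⟨ *-monoʳ-≤ 2 (go ⌈ n /2⌉ (rec (⌈n/2⌉<n m))) ⟩
    2 ^ suc ⌈log₂ ⌈ n /2⌉ ⌉          ≡⟨ cong (λ l → 2 ^ suc l) (⌈log₂⌈n/2⌉⌉≡⌈log₂n⌉∸1 n) ⟩
    2 ^ suc (⌈log₂ n ⌉ ∸ 1)          ≡⟨ cong (2 ^_) (m+[n∸m]≡n (1≤⌈log₂ n ⌉ (s≤s (s≤s z≤n)))) ⟩
    2 ^ ⌈log₂ n ⌉                    ∎
    where open ≤-Reasoning

upto : ℕ → (ℕ → ℕ) → ℕ
upto zero f = 0
upto (suc k) f = f k + upto k f

large-term : ∀ (f : ℕ → ℕ) {b k} → 1 ≤ k → b ≤ upto k f → ∃ λ j → j < k × b ≤ k * f j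
large-term f {b} {k} 1≤k b≤ with go k
  where
  -- The summand `l` collects the strictness of `l` failed comparisons.
  go : ∀ l → (∃ λ j → j < l × b ≤ k * f j) ⊎ k * upto l f + l ≤ l * b
  go zero = inj₂ (≤-reflexive (trans (+-identityʳ _) (*-zeroʳ k)))
  go (suc l) with b ≤? k * f l | go l
  ... | yes le | _ = inj₁ (l , ≤-refl , le)
  ... | no _ | inj₁ (j , j<l , le) = inj₁ (j , m<n⇒m<1+n j<l , le)
  ... | no gt | inj₂ le = inj₂ (begin
    k * (f l + upto l f) + suc l         ≡⟨ solve 4 (λ k a u l → k :* (a :+ u) :+ (con 1 :+ l) := (con 1 :+ k :* a) :+ (k :* u :+ l)) refl k (f l) (upto l f) l ⟩
    suc (k * f l) + (k * upto l f + l)   ≤⟨ +-mono-≤ (≰⇒> gt) le ⟩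
    b + l * b                            ∎)
    where
    open ≤-Reasoning
    open +-*-Solver
... | inj₁ found = found
... | inj₂ le = ⊥-elim (<⇒≱ (m<m+n (k * upto k f) 1≤k) (≤-trans le (*-monoʳ-≤ k b≤)))

-- The powers of two up to `m` add up to one less than the next power, hence to at least `m`.
dyadic : ∀ k m → m < 2 ^ k → m ≤ upto k (λ j → 2 ^ j * 𝟙 (2 ^ j ≤? m))
dyadic zero zero _ = z≤n
dyadic zero (suc _) (s≤s ())
dyadic (suc k) m m< with 2 ^ k ≤? m
... | no gt = ≤-trans (dyadic k m (≰⇒> gt)) (m≤n+m _ _)
... | yes le = ≤-trans (≤-pred (≤-trans m< (≤-reflexive total))) (+-mono-≤ (≤-reflexive (sym (*-identityʳ (2 ^ k)))) (all k le))
  where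
  total : 2 ^ suc k ≡ suc (2 ^ k + (2 ^ k ∸ 1))
  total = trans (cong (2 ^ k +_) (trans (+-identityʳ (2 ^ k)) (sym (m+[n∸m]≡n (m^n>0 2 k))))) (+-suc (2 ^ k) (2 ^ k ∸ 1))
  all : ∀ l → 2 ^ l ≤ m → 2 ^ l ∸ 1 ≤ upto l (λ j → 2 ^ j * 𝟙 (2 ^ j ≤? m))
  all zero _ = z≤n
  all (suc l) le with 2 ^ l ≤? m
  ... | no gt = ⊥-elim (gt (≤-trans (m≤m+n (2 ^ l) _) le))
  ... | yes le′ = begin
    2 ^ suc l ∸ 1                        ≡⟨ cong (λ x → 2 ^ l + x ∸ 1) (+-identityʳ (2 ^ l)) ⟩
    2 ^ l + 2 ^ l ∸ 1                    ≡⟨ +-∸-assoc (2 ^ l) (m^n>0 2 l) ⟩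
    2 ^ l + (2 ^ l ∸ 1)                  ≤⟨ +-mono-≤ (≤-reflexive (sym (*-identityʳ (2 ^ l)))) (all l le′) ⟩
    2 ^ l * 1 + upto l _                 ∎
    where open ≤-Reasoning

∑-upto-swap : ∀ p k (f : Fin p → ℕ → ℕ) → ∑ p (λ i → upto k (f i)) ≡ upto k (λ j → ∑ p (λ i → f i j))
∑-upto-swap p zero f = ∑-zero p
∑-upto-swap p (suc k) f = trans (∑-+ p _ _) (cong (∑ p (λ i → f i k) +_) (∑-upto-swap p k f))

upto-cong : ∀ k {f g : ℕ → ℕ} → (∀ j → f j ≡ g j) → upto k f ≡ upto k g
upto-cong zero eq = refl
upto-cong (suc k) eq = cong₂ _+_ (eq k) (upto-cong k eq)

popular-length : ∀ {p b n k} (ℓ : Fin p → ℕ) → (∀ i → ℓ i ≤ n) → n < 2 ^ k → 1 ≤ k → b ≡ ∑ p ℓ →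
                 ∃ λ j → b ≤ k * (2 ^ j * ∑ p (λ i → 𝟙 (2 ^ j ≤? ℓ i)))
popular-length {p} {b} {n} {k} ℓ ℓ≤ n< 1≤k refl
  with large-term (λ j → 2 ^ j * ∑ p (λ i → 𝟙 (2 ^ j ≤? ℓ i))) 1≤k (begin
    ∑ p ℓ                                                          ≤⟨ ∑-mono p (λ i → dyadic k (ℓ i) (≤-<-trans (ℓ≤ i) n<)) ⟩
    ∑ p (λ i → upto k (λ j → 2 ^ j * 𝟙 (2 ^ j ≤? ℓ i)))            ≡⟨ ∑-upto-swap p k _ ⟩
    upto k (λ j → ∑ p (λ i → 2 ^ j * 𝟙 (2 ^ j ≤? ℓ i)))            ≡⟨ upto-cong k (λ j → ∑-* p (2 ^ j) _) ⟩
    upto k (λ j → 2 ^ j * ∑ p (λ i → 𝟙 (2 ^ j ≤? ℓ i)))            ∎)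
  where open ≤-Reasoning
... | j , _ , le = j , le

size-∑ : ∀ {n p} (S : PathSystem n p) → size S ≡ ∑ p (λ i → length (Vec.lookup (paths S) i))
size-∑ S = go (paths S)
  where
  go : ∀ {n p} (v : Vec (List (Fin n)) p) →
       Vec.foldr (λ _ → ℕ) (λ π acc → length π + acc) 0 v ≡ ∑ p (λ i → length (Vec.lookup v i))
  go [] = refl
  go (π ∷ v) = cong (length π +_) (go v)

length-filter-map : {A B : Set} {Q : B → Set} (Q? : Decidable Q) (f : A → B) (xs : List A) →
                    length (filter Q? (map f xs)) ≡ length (filter (Q? ∘ f) xs)
length-filter-map Q? f [] = refl
length-filter-map Q? f (x ∷ xs) with Q? (f x)
... | yes _ = cong suc (length-filter-map Q? f xs)
... | no _ = length-filter-map Q? f xs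

per-scale : ∀ c n l D X b → 1 ≤ l → 2 * c * n * l * D ≤ b → b ≤ suc l * X → c * n * D ≤ X
per-scale c n l D X b 1≤l le le′ = *-cancelˡ-≤ (2 * l) {{m*n≢0 2 l {{_}} {{>-nonZero 1≤l}}}} (begin
  2 * l * (c * n * D)     ≡⟨ solve 4 (λ c l n d → con 2 :* l :* (c :* n :* d) := con 2 :* c :* n :* l :* d) refl c l n D ⟩
  2 * c * n * l * D       ≤⟨ le ⟩
  b                       ≤⟨ le′ ⟩
  suc l * X               ≤⟨ *-monoˡ-≤ X (+-mono-≤ 1≤l (≤-reflexive (sym (+-identityʳ l)))) ⟩
  2 * l * X               ∎)
  where
  open ≤-Reasoning
  open +-*-Solver

cancel-width : ∀ c D t n q .{{_ : NonZero n}} → c * n * D ≤ t * q → q ≤ n → c * D ≤ t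
cancel-width c D t n q le q≤n = *-cancelˡ-≤ n (begin
  n * (c * D)     ≡⟨ solve 3 (λ c n d → n :* (c :* d) := c :* n :* d) refl c n D ⟩
  c * n * D       ≤⟨ le ⟩
  t * q           ≤⟨ *-monoʳ-≤ t q≤n ⟩
  t * n           ≡⟨ *-comm t n ⟩
  n * t           ∎)
  where
  open ≤-Reasoning
  open +-*-Solver

-- A dense system contradicts a small gap

module Assembly {n : ℕ} (S : PathSystem n n) (bf : BridgeFree S) (2≤n : 2 ≤ n) {k : ℕ} (gap : GapBound (size S) k) where

  private
    b lg : ℕ
    b = size S
    lg = ⌈log₂ n ⌉
    route : Fin n → List (Fin n)
    route = Vec.lookup (paths S)
    1≤n : 1 ≤ n
    1≤n = <⇒≤ 2≤n
    1≤lg : 1 ≤ lg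
    1≤lg = 1≤⌈log₂ n ⌉ 2≤n
    route≤ : ∀ i → length (route i) ≤ n
    route≤ i = ≤-trans (unique-⊆-length (distinct S i) (λ {v} _ → ∈-allFin v)) (≤-reflexive (length-tabulate {n = n} id))

  module Dense {D : ℕ} .{{nz : NonZero D}} (dense : 720 * n * lg * D ≤ b) (k≤ : 289 * k ≤ D)
               (t : ℕ) (1≤t : 1 ≤ t) (popular : b ≤ suc lg * (t * ∑ n (λ i → 𝟙 (t ≤? length (route i))))) where
    open ≤-Reasoning

    1≤D : 1 ≤ D
    1≤D = >-nonZero⁻¹ D

    long? : ∀ i → Dec (t ≤ length (route i))
    long? i = t ≤? length (route i)

    Q : List (Fin n)
    Q = filter long? (List.allFin n)

    q : ℕ
    q = length Q

    q≡ : q ≡ ∑ n (λ i → 𝟙 (long? i))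
    q≡ = trans (length-filter-sum long? (List.allFin n)) (sum-allFin n _)

    -- There are `suc lg ≤ 2 * lg` length classes, which halves 720.
    tq≥ : 360 * n * D ≤ t * q
    tq≥ = per-scale 360 n lg D (t * q) b 1≤lg dense (subst (λ x → b ≤ suc lg * (t * x)) (sym q≡) popular)

    q≤n : q ≤ n
    q≤n = ≤-trans (length-filter long? (List.allFin n)) (≤-reflexive (length-tabulate {n = n} id))

    instance
      t≢0 : NonZero t
      t≢0 = >-nonZero 1≤t
      n≢0 : NonZero n
      n≢0 = >-nonZero 1≤n

    360D≤t : 360 * D ≤ t
    360D≤t = cancel-width 360 D t n q tq≥ q≤n

    1≤q : 1 ≤ q
    1≤q = *-cancelˡ-< t 0 q (≤-trans (≤-reflexive (cong suc (*-zeroʳ t)))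
      (≤-trans (*-mono-≤ (*-mono-≤ (s≤s (z≤n {359})) 1≤n) 1≤D) tq≥))

    t≤n : t ≤ n
    t≤n = go Q refl 1≤q
      where
      go : ∀ xs → xs ≡ Q → 1 ≤ length xs → t ≤ n
      go (i ∷ _) eq _ = ≤-trans (proj₂ (∈-filter⁻ long? {xs = List.allFin n} (subst (i ∈_) eq (here refl)))) (route≤ i)

    K : ℕ
    K = 8 * D

    Q-route : ∀ {r} → r ∈ map route Q → Unique r × t ≤ length r
    Q-route r∈ with ∈-map⁻ route r∈
    ... | i , i∈ , refl = distinct S i , proj₂ (∈-filter⁻ long? {xs = List.allFin n} i∈)

    open Sampling K t (map route Q) (proj₁ ∘ Q-route) (proj₂ ∘ Q-route)
      (≤-trans (≤-trans (≤-reflexive (sym (*-assoc 2 8 D))) (*-monoˡ-≤ D (m≤m+n 16 344))) 360D≤t) 1≤n 1≤t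
      using (missed; sampled)

    module Chosen (P : ℕ) (1≤P : 1 ≤ P) (8P≤q : 8 * P ≤ q) (Vs : List (Fin n)) (Vs! : Unique Vs) (Vs≤ : length Vs ≤ P)
                  (few-missed : 4 * missed Vs ≤ length (map route Q))
                  (used : List (Fin n)) (used≤ : length used ≤ 2 * length Vs)
                  (ac : Trips.Acyclic (Restricted.traversal S Vs) (_∉ used)) where

      P≤n : P ≤ n
      P≤n = ≤-trans (m≤m+n P (7 * P)) (≤-trans 8P≤q q≤n)

      low? : ∀ i → Dec (common Vs (route i) < K)
      low? i = common Vs (route i) <? K

      used? : ∀ i → Dec (i ∈ used)
      used? i = i ∈ᵇ? used

      high cand : List (Fin n)
      high = filter (¬? ∘ low?) Q
      cand = filter (¬? ∘ used?) high

      Q! : Unique Q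
      Q! = Uniqueₚ.filter⁺ long? (Uniqueₚ.allFin⁺ n)

      cand! : Unique cand
      cand! = Uniqueₚ.filter⁺ (¬? ∘ used?) (Uniqueₚ.filter⁺ (¬? ∘ low?) Q!)

      good : ∀ {i} → i ∈ cand → i ∉ used × 8 * D ≤ length (visits S Vs i)
      good {i} i∈ with ∈-filter⁻ (¬? ∘ used?) {xs = high} i∈
      ... | i∈high , i∉ = i∉ , ≤-trans (≮⇒≥ (proj₂ (∈-filter⁻ (¬? ∘ low?) {xs = Q} i∈high))) (common≤ Vs!)

      -- At most `q / 4` routes are missed, and cycle removal uses at most `2 * P ≤ q / 4` more; the
      -- remaining half of `q` is larger than `P`.
      P≤cand : P ≤ length cand
      P≤cand = +-cancelʳ-≤ (missed Vs + 2 * P) P (length cand) (*-cancelˡ-≤ 4 (begin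
        4 * (P + (missed Vs + 2 * P))        ≡⟨ solve 2 (λ p m → con 4 :* (p :+ (m :+ con 2 :* p)) := con 4 :* m :+ con 12 :* p) refl P (missed Vs) ⟩
        4 * missed Vs + 12 * P               ≤⟨ +-mono-≤ (≤-trans few-missed (≤-reflexive (length-map route Q))) (≤-trans (*-monoˡ-≤ P (m≤m+n 12 12)) (≤-trans (≤-reflexive (*-assoc 3 8 P)) (*-monoʳ-≤ 3 8P≤q))) ⟩
        q + 3 * q                            ≡⟨⟩
        4 * q                                ≤⟨ *-monoʳ-≤ 4 q≤ ⟩
        4 * (length cand + (missed Vs + 2 * P)) ∎))
        where
        open +-*-Solver
        low-count : length (filter low? Q) ≡ missed Vs
        low-count = sym (length-filter-map (λ r → common Vs r <? K) route Q)
        used-count : length (filter used? high) ≤ 2 * P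
        used-count = ≤-trans (unique-⊆-length (Uniqueₚ.filter⁺ used? (Uniqueₚ.filter⁺ (¬? ∘ low?) Q!))
                               (λ i∈ → proj₂ (∈-filter⁻ used? {xs = high} i∈)))
                             (≤-trans used≤ (*-monoʳ-≤ 2 Vs≤))
        q≤ : q ≤ length cand + (missed Vs + 2 * P)
        q≤ = begin
          q                                                   ≡⟨ length-filter-¬ low? Q ⟨
          length (filter low? Q) + length high                ≡⟨ cong₂ _+_ low-count (sym (length-filter-¬ used? high)) ⟩
          missed Vs + (length (filter used? high) + length cand) ≤⟨ +-monoʳ-≤ (missed Vs) (+-monoˡ-≤ (length cand) used-count) ⟩
          missed Vs + (2 * P + length cand)                   ≡⟨ solve 3 (λ m p c → m :+ (p :+ c) := c :+ (m :+ p)) refl (missed Vs) (2 * P) (length cand) ⟩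
          length cand + (missed Vs + 2 * P)                   ∎

      open BuildLayout S bf Vs used ac D P cand cand! P≤cand good Vs≤ using (layout)

      fits : Network.#vertices layout lg ≤ b
      fits = begin
        2 * P * lg * D + (2 * P * lg * D + (P + P))  ≤⟨ +-monoʳ-≤ (2 * P * lg * D) (+-monoʳ-≤ (2 * P * lg * D) P+P≤) ⟩
        2 * P * lg * D + (2 * P * lg * D + 2 * P * lg * D) ≡⟨ solve 3 (λ p l d → con 2 :* p :* l :* d :+ (con 2 :* p :* l :* d :+ con 2 :* p :* l :* d) := con 6 :* p :* l :* d) refl P lg D ⟩
        6 * P * lg * D                               ≤⟨ *-monoˡ-≤ D (*-monoˡ-≤ lg (*-mono-≤ (m≤m+n 6 714) P≤n)) ⟩
        720 * n * lg * D                             ≤⟨ dense ⟩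
        b                                            ∎
        where
        open +-*-Solver
        P+P≤ : P + P ≤ 2 * P * lg * D
        P+P≤ = begin
          P + P                ≡⟨ cong (P +_) (+-identityʳ P) ⟨
          2 * P                ≡⟨ trans (*-identityʳ (2 * P * 1)) (*-identityʳ (2 * P)) ⟨
          2 * P * 1 * 1        ≤⟨ *-mono-≤ (*-monoʳ-≤ (2 * P) 1≤lg) 1≤D ⟩
          2 * P * lg * D       ∎

      -- This is why there are `lg` columns: they absorb the factor `P ≤ 2 ^ lg` already for
      -- `D = 1`.
      wide : 4 * P * 2 ^ (8 * D) ≤ 4 ^ (7 * D * lg)
      wide = begin
        4 * P * 2 ^ (8 * D)            ≤⟨ *-monoˡ-≤ (2 ^ (8 * D)) (*-monoʳ-≤ 4 (≤-trans P≤n (n≤2^⌈log₂n⌉ n))) ⟩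
        2 ^ 2 * 2 ^ lg * 2 ^ (8 * D)   ≡⟨ cong (_* 2 ^ (8 * D)) (^-distribˡ-+-* 2 2 lg) ⟨
        2 ^ (2 + lg) * 2 ^ (8 * D)     ≡⟨ ^-distribˡ-+-* 2 (2 + lg) (8 * D) ⟨
        2 ^ (2 + lg + 8 * D)           ≤⟨ ^-monoʳ-≤ 2 exponents ⟩
        2 ^ (2 * (7 * D * lg))         ≡⟨ ^-*-assoc 2 2 (7 * D * lg) ⟨
        4 ^ (7 * D * lg)               ∎
        where
        open +-*-Solver
        exponents : 2 + lg + 8 * D ≤ 2 * (7 * D * lg)
        exponents = begin
          2 + lg + 8 * D                               ≤⟨ +-mono-≤ (+-mono-≤ (*-monoʳ-≤ 2 (*-mono-≤ 1≤D 1≤lg)) (≤-trans (≤-reflexive (sym (+-identityʳ lg))) (*-monoˡ-≤ lg 1≤D)))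
                                                            (≤-trans (≤-reflexive (sym (*-identityʳ (8 * D)))) (*-monoʳ-≤ (8 * D) 1≤lg)) ⟩
          2 * (D * lg) + D * lg + 8 * D * lg           ≤⟨ m≤m+n _ (3 * (D * lg)) ⟩
          2 * (D * lg) + D * lg + 8 * D * lg + 3 * (D * lg) ≡⟨ solve 2 (λ d l → con 2 :* (d :* l) :+ d :* l :+ con 8 :* d :* l :+ con 3 :* (d :* l) := con 2 :* (con 7 :* d :* l)) refl D lg ⟩
          2 * (7 * D * lg)                             ∎

      absurd : ⊥
      absurd = gap-large {D} {P} {2 * P} {lg} {b} {k} layout 1≤P ≤-refl fits wide gap k≤

    -- `P` bounds the size of the sample and is also the number of commodities. From
    -- `t * s₀ ≤ 5 * n` and `suc K ≤ 9 * D` follows `t * P ≤ 45 * n * D`, an eighth of the lower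
    -- bound `360 * n * D` for `t * q`.
    s₀ P : ℕ
    s₀ = suc (4 * n / t)
    P = s₀ * suc K

    4n≤s₀t : 4 * n ≤ s₀ * t
    4n≤s₀t = begin
      4 * n                                   ≡⟨ m≡m%n+[m/n]*n (4 * n) t ⟩
      4 * n % t + 4 * n / t * t  ≤⟨ +-monoˡ-≤ (4 * n / t * t) (<⇒≤ (m%n<n (4 * n) t)) ⟩
      t + 4 * n / t * t                       ∎

    tP≤ : t * P ≤ 45 * n * D
    tP≤ = begin
      t * (s₀ * suc K)                ≡⟨ *-assoc t s₀ (suc K) ⟨
      t * s₀ * suc K                  ≤⟨ *-mono-≤ {t * s₀} {5 * n} ts₀≤ (+-monoˡ-≤ K 1≤D) ⟩
      5 * n * (D + 8 * D)             ≡⟨ solve 2 (λ n d → con 5 :* n :* (d :+ con 8 :* d) := con 45 :* n :* d) refl n D ⟩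
      45 * n * D                      ∎
      where
      open +-*-Solver
      ts₀≤ : t * s₀ ≤ 5 * n
      ts₀≤ = begin
        t * suc (4 * n / t)           ≡⟨ *-suc t (4 * n / t) ⟩
        t + t * (4 * n / t)           ≡⟨ cong (t +_) (*-comm t (4 * n / t)) ⟩
        t + 4 * n / t * t             ≤⟨ +-mono-≤ t≤n (m/n*n≤m (4 * n) t) ⟩
        n + 4 * n                     ∎

    8P≤q : 8 * P ≤ q
    8P≤q = *-cancelˡ-≤ t (begin
      t * (8 * P)        ≡⟨ solve 2 (λ t p → t :* (con 8 :* p) := con 8 :* (t :* p)) refl t P ⟩
      8 * (t * P)        ≤⟨ *-monoʳ-≤ 8 tP≤ ⟩
      8 * (45 * n * D)   ≡⟨ trans (sym (*-assoc 8 (45 * n) D)) (cong (_* D) (sym (*-assoc 8 45 n))) ⟩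
      360 * n * D        ≤⟨ tq≥ ⟩
      t * q              ∎)
      where open +-*-Solver

    1≤P : 1 ≤ P
    1≤P = s≤s z≤n

    contradictory : ⊥
    contradictory =
      let (Vs , Vs! , Vs≤ , few) = sampled s₀ 4n≤s₀t t≤n
      in CycleRemoval.remove-cycles (Restricted.traversal S Vs) (Restricted.no-detour S Vs bf) Vs proj₂
           λ (used , used≤ , ac) → Chosen.absurd P 1≤P 8P≤q Vs Vs! Vs≤ few used used≤ ac

  not-dense : ∀ {D} .{{_ : NonZero D}} → 720 * n * lg * D ≤ b → ¬ 289 * k ≤ D
  not-dense dense k≤ =
    let (j , popular) = popular-length {n} {b} {n} {suc lg} (length ∘ route) route≤
          (≤-<-trans (n≤2^⌈log₂n⌉ n) (^-monoʳ-< 2 (s≤s (s≤s z≤n)) {lg} {suc lg} ≤-refl)) (s≤s z≤n) (size-∑ S)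
    in Dense.contradictory dense k≤ (2 ^ j) (m^n>0 2 j) popular

-- Degenerate cases and the final bound

singletons : ∀ n → PathSystem (suc n) (suc n)
singletons n = record
  { paths    = Vec.replicate (suc n) (Fin.zero ∷ [])
  ; distinct = λ i → subst Unique (sym (lookup-replicate i (Fin.zero ∷ []))) ([] ∷ [])
  }

singletons-bridge-free : ∀ n → BridgeFree (singletons n)
singletons-bridge-free n b B = no-order (subst (Precedes _ _) (lookup-replicate (pth (b ∸ 1)) (Fin.zero ∷ [])) closing)
  where
  open Bridge B
  no-order : ∀ {u v} → ¬ Precedes u v (Fin.zero {n} ∷ [])
  no-order (Fin.zero , Fin.zero , () , _)

singletons-size : ∀ n → size (singletons n) ≡ suc n
singletons-size n = go (suc n)
  where
  go : ∀ m → Vec.foldr (λ _ → ℕ) (λ π acc → length π + acc) 0 (Vec.replicate m (Fin.zero {n} ∷ [])) ≡ m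
  go zero = refl
  go (suc m) = cong suc (go m)

nodes≤beta : ∀ {n b} → 1 ≤ n → IsBeta n n b → n ≤ b
nodes≤beta {suc n} {b} _ (_ , max) = subst (_≤ b) (singletons-size n) (max (singletons n) (singletons-bridge-free n))

single-arc : ∀ {N} → Rel₂ (suc (suc N))
single-arc Fin.zero (Fin.suc Fin.zero) = true
single-arc _ _ = false

count≤0 : ∀ {N} (R : Rel₂ N) → count R ≤ 0 → ∀ u v → R u v ≡ false
count≤0 R none u v = go (R u v) refl
  where
  go : ∀ c → R u v ≡ c → c ≡ false
  go false _ = refl
  go true e = ⊥-elim (<⇒≱ (count⁺ R just {(u , v) ∷ []} ([] ∷ []) λ { (here refl) → u , v , e , refl }) none)

zero-factor⇒≤0 : ∀ x y q → ℕtoℚ x ℚ.≤ (ℕtoℚ 0 ℚ.* q) ℚ.* ℕtoℚ y → x ≤ 0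
zero-factor⇒≤0 x y q le = ℕtoℚ-cancel {x} {0} (ℚₚ.≤-trans le (ℚₚ.≤-reflexive
  (trans (cong (ℚ._* ℕtoℚ y) (ℚₚ.*-zeroˡ q)) (ℚₚ.*-zeroˡ (ℕtoℚ y)))))

gap-nonzero : ∀ {N} → ¬ SCutBound (single-arc {N}) single-arc 0
gap-nonzero {N} (inj₁ uncut) =
  uncut single-arc (λ _ _ e → e) (Fin.zero , Fin.suc Fin.zero , refl , blocked)
  where
  blocked : ¬ Reach (minus single-arc single-arc) Fin.zero (Fin.suc (Fin.zero {N}))
  blocked (step {u} _ e) = minus-self single-arc u (Fin.suc Fin.zero) e
gap-nonzero (inj₂ (E′ , D , f , q , _ , (s , t , p , cut) , _ , _ , le)) =
  cut (step Defs.here (minus⁺ {E = single-arc} {E′ = E′} p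
    (count≤0 E′ (zero-factor⇒≤0 (count E′) (count D) q le) s t)))

-- With factor 0, a single arc that is also the demand would have to be severed by a cut without
-- edges.
gap-positive : ∀ {N k} → 2 ≤ N → GapBound N k → 1 ≤ k
gap-positive {k = suc _} _ _ = s≤s z≤n
gap-positive {suc (suc N)} {zero} (s≤s (s≤s _)) gap = ⊥-elim (gap-nonzero {N} (gap single-arc single-arc))

m≤[1+m/n]*n : ∀ m n .{{_ : NonZero n}} → m ≤ suc (m / n) * n
m≤[1+m/n]*n m n = begin
  m                        ≡⟨ m≡m%n+[m/n]*n m n ⟩
  m % n + m / n * n        ≤⟨ +-monoˡ-≤ (m / n * n) (<⇒≤ (m%n<n m n)) ⟩
  suc (m / n) * n          ∎
  where open ≤-Reasoning

quotient-small⇒≤ : ∀ c d k n l b .{{_ : NonZero (d * n * l)}} → b / (d * n * l) < c * k → b ≤ c * d * k * n * l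
quotient-small⇒≤ c d k n l b lt = begin
  b                                ≤⟨ m≤[1+m/n]*n b (d * n * l) ⟩
  suc (b / (d * n * l)) * (d * n * l) ≤⟨ *-monoˡ-≤ (d * n * l) lt ⟩
  c * k * (d * n * l)              ≡⟨ solve 5 (λ c d k n l → c :* k :* (d :* n :* l) := c :* d :* k :* n :* l) refl c d k n l ⟩
  c * d * k * n * l                ∎
  where
  open ≤-Reasoning
  open +-*-Solver

-- Take for `D` the integer part of the size over `720 * n * ⌈log₂ n ⌉`. If `D` is positive,
-- `not-dense` gives `D < 289 * k`; if it is 0, this is `1 ≤ k`.
beta-bound : ∀ {n k} (S : PathSystem n n) → BridgeFree S → 2 ≤ n → 1 ≤ k → GapBound (size S) k →
             size S ≤ 289 * 720 * k * n * ⌈log₂ n ⌉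
beta-bound {n} {k} S bf 2≤n 1≤k gap = quotient-small⇒≤ 289 720 k n ⌈log₂ n ⌉ (size S) (sparse (size S / M) (m/n*n≤m (size S) M))
  where
  M : ℕ
  M = 720 * n * ⌈log₂ n ⌉
  instance
    M≢0 : NonZero M
    M≢0 = m*n≢0 (720 * n) ⌈log₂ n ⌉ {{m*n≢0 720 n {{_}} {{>-nonZero (<⇒≤ 2≤n)}}}} {{>-nonZero (1≤⌈log₂ n ⌉ 2≤n)}}
  sparse : ∀ D → D * M ≤ size S → D < 289 * k
  sparse zero _ = *-mono-≤ (s≤s (z≤n {288})) 1≤k
  sparse D@(suc _) le = ≰⇒> (Assembly.not-dense S bf 2≤n {k} gap {D} (≤-trans (≤-reflexive (*-comm M D)) le))

mainTheorem11 : Σ ℕ λ C → Σ ℕ λ n₀ →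
    ∀ (n b k : ℕ) → 1 ≤ n → n₀ ≤ n → IsBeta n n b → IsSCG b k →
    b ≤ C * k * n * ⌈log₂ n ⌉
-- The threshold is 2 because at `n = 1` the logarithm is 0 while the maximal size is 1.
mainTheorem11 = 289 * 720 , 2 , bound
  where
  bound : ∀ n b k → 1 ≤ n → 2 ≤ n → IsBeta n n b → IsSCG b k → b ≤ 289 * 720 * k * n * ⌈log₂ n ⌉
  bound n b k 1≤n 2≤n β@((S , bf , refl) , _) (gap , _) =
    beta-bound {n} {k} S bf 2≤n (gap-positive {b} {k} (≤-trans 2≤n (nodes≤beta 1≤n β)) gap) gap
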